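{- Let $k\ge 3$ be a fixed integer with $k\equiv 1$ or $3\pmod 6$. There exist constants $c_3>0$ and $C>0$ such that for every $\epsilon$ with $0\le\epsilon\le c_3$ there exists $n_0$ such that the following holds for all $n\ge n_0$. Every cancellative $3$-graph $\mathcal{H}$ on $n$ vertices with $|\partial\mathcal{H}|=(1-\epsilon)\frac{k-1}{2k}n^2$ satisfies \[ |\mathcal{H}|\le \frac{k-1}{6k^2}n^3-\frac{k-1}{4k^2}\epsilon n^3 + C\epsilon^{3/2}n^3 . \]
   Context: A $3$-graph $\mathcal{H}$ is cancellative if it contains no three distinct edges $A,B,C$ with $A\triangle B\subseteq C$. $\partial\mathcal{H}=\{A:|A|=2,\ A\subset B\text{ for some } B\in\mathcal{H}\}$. -}

module Defs where

open import Data.Nat using (ℕ; zero; suc)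
open import Data.Bool using (Bool; true; false; _∧_)
open import Data.List using (List; []; _∷_; _++_; map; length; filterᵇ)
open import Data.Bool.ListAction using (any)
open import Data.Vec using (_∷_; [])
open import Data.Fin.Subset using (Subset; _∪_; _─_; _⊆_; ∣_∣; inside; outside)
open import Data.Fin.Subset.Properties using (_⊆?_)
open import Relation.Nullary using (¬_; does)
open import Relation.Binary.PropositionalEquality using (_≡_; _≢_)
open import Data.Rational using (ℚ; _≤_; _*_)
open import Data.Rational using (0ℚ; _/_)
open import Data.Integer using (+_)
open import Data.Sum using (_⊎_)
import Data.Nat as ℕ

allSubsets : (n : ℕ) → List (Subset n)
allSubsets zero = [] ∷ []
allSubsets (suc n) = map (outside ∷_) (allSubsets n) ++ map (inside ∷_) (allSubsets n)

record Graph3 (n : ℕ) : Set where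
  field
    edge    : Subset n → Bool
    uniform : ∀ A → edge A ≡ true → ∣ A ∣ ≡ 3
open Graph3 public

numEdges : ∀ {n} → Graph3 n → ℕ
numEdges {n} H = length (filterᵇ (edge H) (allSubsets n))

_△_ : ∀ {n} → Subset n → Subset n → Subset n
A △ B = (A ─ B) ∪ (B ─ A)

Cancellative : ∀ {n} → Graph3 n → Set
Cancellative H = ∀ A B C → edge H A ≡ true → edge H B ≡ true → edge H C ≡ true →
  A ≢ B → B ≢ C → A ≢ C → ¬ ((A △ B) ⊆ C)

inShadow : ∀ {n} → Graph3 n → Subset n → Bool
inShadow {n} H A = (∣ A ∣ ℕ.≡ᵇ 2) ∧ any (λ B → edge H B ∧ does (A ⊆? B)) (allSubsets n)

shadowSize : ∀ {n} → Graph3 n → ℕ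
shadowSize {n} H = length (filterᵇ (inShadow H) (allSubsets n))

-- For a ≥ 0 and e ≥ 0:  x ≤ a * √e   (stated without square roots, exactly equivalent)
LeMulSqrt : ℚ → ℚ → ℚ → Set
LeMulSqrt x a e = x ≤ 0ℚ ⊎ x * x ≤ a * a * e

-- the rational number a / d (only used with d > 0; value at d = 0 is an irrelevant junk 0)
frac : ℕ → ℕ → ℚ
frac a zero = 0ℚ
frac a (suc d) = + a / suc d

-- Let N(uv) = {w : uvw ∈ H}, and let a(v) count the vertices not adjacent to v in the shadow. As H is
-- cancellative, N(uv) is independent in the shadow, so |N(uv)| ≤ a(w) for w ∈ N(uv). Summing
-- a(w)/|N(uw)| + a(v)/|N(uv)| ≥ 2 over the edges vw of the link of u gives
-- Σ_{v ∈ N(u)} |N(uv)| ≤ Σ_{v ∈ N(u)} a(v). Hence, if |H| exceeds the bound, then a(v) and |N(uv)| are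
-- close to n/k outside O(εn) exceptional vertices. On the other vertices "almost equal
-- non-neighbourhoods" is an equivalence relation with exactly k classes, each independent in the shadow,
-- and the sets N(uv) define a Steiner triple system on the classes. Counting edges block by block gives
-- |H'| - (n/2k)|∂H'| at most its value at the balanced blow-up. An exceptional vertex u lies in at most
-- (n/2k) deg(u) + (1/2) Σ_v |a(v) - n/k| edges, and by Cauchy–Schwarz the last sum is O(ε^(1/2) n²): the
-- exceptional vertices cost O(ε^(3/2) n³). All estimates are exact, so n₀ = 1 works.
module Submission where

-- The linear term of the bound has slope exactly `n/2k` in `|∂H|`, so the claim is an upper bound
-- for `|H| - (n/2k)|∂H|`. This dictates the treatment of exceptional vertices. Discarding O(εn) of
-- them at up to n² edges each would cost O(εn³), as much as the term to be proved; their edges have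
-- to be traded against their own shadow pairs at this very rate, and only the surplus may be
-- estimated crudely. Among the other vertices there is slack: a missing pair between two classes,
-- or a pair inside a class, costs about twice the rate, and the spare half absorbs every error of
-- the approximate structure. The whole argument runs under the assumption `0 < Y` of an excess,
-- since otherwise nothing is to be proved. All counts are of ordered tuples with integer weights:
-- the tolerance is `n/100k²`, one part in `100k` of a class, and multiplying by `M = 100k²` makes
-- both it and `n/k` integers. Square roots never appear, because `Y * Y` is bounded instead of `Y`.

module Combinatorics where

  open import Data.Bool using (Bool; true; false; _∧_; _∨_; not)
  import Data.Bool as Bool
  open import Data.Bool.Properties using (∨-identityʳ; ∧-zeroʳ)
  open import Data.Empty using (⊥-elim)
  open import Data.Fin using (Fin; zero; suc)
  import Data.Fin as Fin
  open import Data.Fin.Induction using (<-wellFounded)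
  import Data.Fin.Properties as Fin
  open import Data.Fin.Properties using (any?)
  open import Data.Integer hiding (suc)
  open import Data.Integer.Properties
  open import Data.Integer.Tactic.RingSolver using (solve-∀)
  open import Data.Nat using (ℕ; zero; suc; _!)
  import Data.Nat as ℕ
  import Data.Nat.Divisibility as ℕ
  import Data.Nat.DivMod as ℕ
  import Data.Nat.Properties as ℕ
  open import Data.Product using (∃; ∃₂; _×_; _,_; proj₁; proj₂)
  open import Algebra.Properties.Semiring.Sum +-*-semiring using (sum; sum-cong-≗; ∑-distrib-+; ∑-comm; *-distribˡ-sum)
  open import Induction.WellFounded using (Acc; acc)
  open import Relation.Binary.Definitions using (tri<; tri≈; tri>)
  open import Relation.Binary.PropositionalEquality
  open import Relation.Nullary using (¬_; Dec; yes; no; does; _×-dec_)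

  -- Linear arithmetic: p ≤ q is a combination of the hypotheses, and the ring solver checks b - a ≡ q - p.
  ≤-from : ∀ {a b p q} → p ≤ q → b - a ≡ q - p → a ≤ b
  ≤-from p≤q eq = 0≤i-j⇒j≤i (subst (0ℤ ≤_) (sym eq) (i≤j⇒0≤j-i p≤q))

  infixl 6 _⊕_
  _⊕_ : ∀ {a b c d} → a ≤ b → c ≤ d → a + c ≤ b + d
  _⊕_ = +-mono-≤

  infixr 7 _⊗_
  _⊗_ : ∀ {x a b} → 0ℤ ≤ x → a ≤ b → x * a ≤ x * b
  _⊗_ {x} 0≤x = *-monoˡ-≤-nonNeg x {{nonNegative 0≤x}}

  *-nonNeg : ∀ {x y} → 0ℤ ≤ x → 0ℤ ≤ y → 0ℤ ≤ x * y
  *-nonNeg {x} {y} 0≤x 0≤y = subst (_≤ x * y) (*-zeroʳ x) (0≤x ⊗ 0≤y)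

  +-nonNeg : ∀ {x y} → 0ℤ ≤ x → 0ℤ ≤ y → 0ℤ ≤ x + y
  +-nonNeg = +-mono-≤

  sq-nonNeg : ∀ x → 0ℤ ≤ x * x
  sq-nonNeg (+ m) = *-nonNeg {+ m} {+ m} (+≤+ ℕ.z≤n) (+≤+ ℕ.z≤n)
  sq-nonNeg -[1+ m ] = +≤+ ℕ.z≤n

  0≤+ : ∀ {m} → 0ℤ ≤ + m
  0≤+ = +≤+ ℕ.z≤n

  *-cancelˡ-≤ : ∀ {x a b} → 0ℤ < x → x * a ≤ x * b → a ≤ b
  *-cancelˡ-≤ {x} {a} {b} 0<x = *-cancelˡ-≤-pos a b x {{positive 0<x}}

  *-pos : ∀ {x y} → 0ℤ < x → 0ℤ < y → 0ℤ < x * y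
  *-pos {x} {y} 0<x 0<y = subst (_< x * y) (*-zeroʳ x) (*-monoˡ-<-pos x {{positive 0<x}} 0<y)

  <⇒1+≤ : ∀ {a b} → a < b → 1ℤ + a ≤ b
  <⇒1+≤ = i<j⇒suc[i]≤j

  <-from : ∀ {a b p q} → p < q → b - a ≡ q - p → a < b
  <-from {a} {b} {p} {q} p<q eq = suc[i]≤j⇒i<j (≤-from (<⇒1+≤ p<q) (trans (reassoc b a) (trans (cong (_- 1ℤ) eq) (sym (reassoc q p)))))
    where
    reassoc : ∀ x y → x - (1ℤ + y) ≡ x - y - 1ℤ
    reassoc = solve-∀

  ≤-absurd : ∀ {A : Set} {a b} → a ≤ b → b < a → A
  ≤-absurd a≤b b<a = ⊥-elim (≤⇒≯ a≤b b<a)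

  -- Finite sums of integers.

  opaque

    ∑ : ∀ {n} → (Fin n → ℤ) → ℤ
    ∑ = sum

    ∑-cong : ∀ {n} {f h : Fin n → ℤ} → (∀ i → f i ≡ h i) → ∑ f ≡ ∑ h
    ∑-cong = sum-cong-≗

    ∑-zero : (f : Fin 0 → ℤ) → ∑ f ≡ 0ℤ
    ∑-zero f = refl

    ∑-suc : ∀ {n} (f : Fin (suc n) → ℤ) → ∑ f ≡ f zero + ∑ (λ i → f (suc i))
    ∑-suc f = refl

    ∑-swap : ∀ {m n} (f : Fin m → Fin n → ℤ) → ∑ (λ i → ∑ (λ j → f i j)) ≡ ∑ (λ j → ∑ (λ i → f i j))
    ∑-swap = ∑-comm

    ∑-mono : ∀ {n} {f h : Fin n → ℤ} → (∀ i → f i ≤ h i) → ∑ f ≤ ∑ h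
    ∑-mono {zero}  f≤h = ≤-refl
    ∑-mono {suc n} f≤h = f≤h zero ⊕ ∑-mono (λ i → f≤h (suc i))

    ∑-nonNeg : ∀ {n} {f : Fin n → ℤ} → (∀ i → 0ℤ ≤ f i) → 0ℤ ≤ ∑ f
    ∑-nonNeg {zero}  0≤f = ≤-refl
    ∑-nonNeg {suc n} 0≤f = +-nonNeg (0≤f zero) (∑-nonNeg (λ i → 0≤f (suc i)))

    ∑-+ : ∀ {n} (f h : Fin n → ℤ) → ∑ (λ i → f i + h i) ≡ ∑ f + ∑ h
    ∑-+ = ∑-distrib-+

    ∑-* : ∀ {n} x (f : Fin n → ℤ) → ∑ (λ i → x * f i) ≡ x * ∑ f
    ∑-* x f = sym (*-distribˡ-sum x f)

    ∑-*ʳ : ∀ {n} x (f : Fin n → ℤ) → ∑ (λ i → f i * x) ≡ ∑ f * x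
    ∑-*ʳ x f = trans (∑-cong (λ i → *-comm (f i) x)) (trans (∑-* x f) (*-comm x (∑ f)))

    ∑-neg : ∀ {n} (f : Fin n → ℤ) → ∑ (λ i → - f i) ≡ - ∑ f
    ∑-neg f = trans (∑-cong (λ i → sym (-1*i≡-i (f i)))) (trans (∑-* -1ℤ f) (-1*i≡-i (∑ f)))

    ∑-- : ∀ {n} (f h : Fin n → ℤ) → ∑ (λ i → f i - h i) ≡ ∑ f - ∑ h
    ∑-- f h = trans (∑-+ f (λ i → - h i)) (cong (_+_ (∑ f)) (∑-neg h))

    ∑-const : ∀ n x → ∑ {n} (λ _ → x) ≡ + n * x
    ∑-const zero    x = sym (*-zeroˡ x)
    ∑-const (suc n) x = trans (cong (_+_ x) (∑-const n x)) (sym (suc-* (+ n) x))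

    -- The pigeonhole behind the existence steps: a vertex with several prescribed properties is
    -- found by comparing two sums of indicators.
    ∑-pick : ∀ {n} (f h : Fin n → ℤ) → ∑ f < ∑ h → ∃ λ i → f i < h i
    ∑-pick {zero}  f h (+<+ ())
    ∑-pick {suc n} f h lt with f zero <? h zero
    ... | yes p = zero , p
    ... | no ¬p with ∑ (λ i → f (suc i)) <? ∑ (λ i → h (suc i))
    ...   | yes q = let i , r = ∑-pick _ _ q in suc i , r
    ...   | no ¬q = ≤-absurd (≮⇒≥ ¬p ⊕ ≮⇒≥ ¬q) lt

  -- Indicators and cardinalities of Boolean predicates.

  ι : Bool → ℤ
  ι true  = 1ℤ
  ι false = 0ℤ

  0≤ι : ∀ b → 0ℤ ≤ ι b
  0≤ι true  = +≤+ ℕ.z≤n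
  0≤ι false = +≤+ ℕ.z≤n

  ι≤1 : ∀ b → ι b ≤ 1ℤ
  ι≤1 true  = ≤-refl
  ι≤1 false = +≤+ ℕ.z≤n

  # : ∀ {n} → (Fin n → Bool) → ℤ
  # P = ∑ (λ i → ι (P i))

  0≤# : ∀ {n} (P : Fin n → Bool) → 0ℤ ≤ # P
  0≤# P = ∑-nonNeg (λ i → 0≤ι (P i))

  #≤n : ∀ {n} (P : Fin n → Bool) → # P ≤ + n
  #≤n {n} P = ≤-trans (∑-mono (λ i → ι≤1 (P i))) (≤-reflexive (trans (∑-const n 1ℤ) (*-identityʳ (+ n))))

  _⊆_ : ∀ {n} → (Fin n → Bool) → (Fin n → Bool) → Set
  P ⊆ Q = ∀ i → P i ≡ true → Q i ≡ true

  _∩_ _∪_ : ∀ {n} → (Fin n → Bool) → (Fin n → Bool) → Fin n → Bool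
  (P ∩ Q) i = P i ∧ Q i
  (P ∪ Q) i = P i ∨ Q i

  ∁ : ∀ {n} → (Fin n → Bool) → Fin n → Bool
  ∁ P i = not (P i)

  #-∁ : ∀ {n} (P : Fin n → Bool) → # P + # (∁ P) ≡ + n
  #-∁ {n} P = trans (sym (∑-+ (λ i → ι (P i)) (λ i → ι (∁ P i)))) (trans (∑-cong λ i → pointwise (P i)) (trans (∑-const n 1ℤ) (*-identityʳ (+ n))))
    where
    pointwise : ∀ b → ι b + ι (not b) ≡ 1ℤ
    pointwise true  = refl
    pointwise false = refl

  ∩-intro : ∀ {a b} → a ≡ true → b ≡ true → a ∧ b ≡ true
  ∩-intro refl refl = refl

  ∩-elim : ∀ a {b} → a ∧ b ≡ true → a ≡ true × b ≡ true
  ∩-elim true eq = refl , eq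

  ∪-elim : ∀ a {b} → a ∨ b ≡ false → a ≡ false × b ≡ false
  ∪-elim false eq = refl , eq

  true≢false : ∀ {A : Set} {b} → b ≡ true → b ≡ false → A
  true≢false refl ()

  ≢true : ∀ {b} → ¬ b ≡ true → b ≡ false
  ≢true {true}  h = ⊥-elim (h refl)
  ≢true {false} h = refl

  ≢false : ∀ {b} → ¬ b ≡ false → b ≡ true
  ≢false {true}  h = refl
  ≢false {false} h = ⊥-elim (h refl)

  ι-mono : ∀ {a b} → (a ≡ true → b ≡ true) → ι a ≤ ι b
  ι-mono {false} {b} h = 0≤ι b
  ι-mono {true}  h rewrite h refl = ≤-refl

  #-mono : ∀ {n} {P Q : Fin n → Bool} → P ⊆ Q → # P ≤ # Q
  #-mono P⊆Q = ∑-mono (λ i → ι-mono (P⊆Q i))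

  does-true : ∀ {P : Set} (d : Relation.Nullary.Dec P) → P → does d ≡ true
  does-true (yes _) p = refl
  does-true (no ¬p) p = ⊥-elim (¬p p)

  from-true : ∀ {P : Set} (d : Relation.Nullary.Dec P) → does d ≡ true → P
  from-true (yes p) _ = p

  from-false : ∀ {P : Set} (d : Relation.Nullary.Dec P) → does d ≡ false → ¬ P
  from-false (no ¬p) _ = ¬p

  not-elim : ∀ {b} → not b ≡ true → b ≡ false
  not-elim {false} _ = refl

  not-intro : ∀ {b} → b ≡ false → not b ≡ true
  not-intro refl = refl

  ι<ι : ∀ {a b} → ι a < ι b → b ≡ true × a ≡ false
  ι<ι {a}     {false} lt = ≤-absurd (0≤ι a) lt
  ι<ι {false} {true}  lt = refl , refl
  ι<ι {true}  {true}  lt = ≤-absurd ≤-refl lt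

  pick₂-pointwise : ∀ x x′ a a′ b → (x ≡ true → a ≡ true) → (x′ ≡ true → a′ ≡ true) →
    ι a + ι a′ + ι b < ι x + ι x′ + ι (a ∧ a′) → (x ≡ true × x′ ≡ true) × b ≡ false
  pick₂-pointwise true true a a′ false _ _ _ = (refl , refl) , refl
  pick₂-pointwise true true a a′ true h h′ lt rewrite h refl | h′ refl = ≤-absurd ≤-refl lt
  pick₂-pointwise false x′ a a′ b h h′ lt =
    ≤-absurd (≤-from (ι-mono h′ ⊕ ι-mono {a ∧ a′} (λ t → proj₁ (∩-elim a t)) ⊕ 0≤ι b) (lemma (ι a) (ι a′) (ι b) (ι x′) (ι (a ∧ a′)))) lt
    where
    lemma : ∀ a a′ b x′ i → a + a′ + b - (0ℤ + x′ + i) ≡ a′ + a + b - (x′ + i + 0ℤ)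
    lemma = solve-∀
  pick₂-pointwise true false a a′ b h h′ lt =
    ≤-absurd (≤-from (ι-mono h ⊕ ι-mono {a ∧ a′} (λ t → proj₂ (∩-elim a t)) ⊕ 0≤ι b) (lemma (ι a) (ι a′) (ι b) 1ℤ (ι (a ∧ a′)))) lt
    where
    lemma : ∀ a a′ b x i → a + a′ + b - (x + 0ℤ + i) ≡ a + a′ + b - (x + i + 0ℤ)
    lemma = solve-∀

  pick₃-pointwise : ∀ x x′ y a a′ → (x ≡ true → a ≡ true) → (y ≡ true → a ≡ true) →
    (x′ ≡ true → a′ ≡ true) → (y ≡ true → a′ ≡ true) →
    ι a + ι a′ < ι x + ι x′ + ι y → x ≡ true × x′ ≡ true
  pick₃-pointwise true  true  y a a′ _ _ _ _ _ = refl , refl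
  pick₃-pointwise false x′ y a a′ _ hy h′ _ lt =
    ≤-absurd (≤-from (ι-mono h′ ⊕ ι-mono hy) (lemma (ι a) (ι a′) (ι x′) (ι y))) lt
    where
    lemma : ∀ a a′ x′ y → a + a′ - (0ℤ + x′ + y) ≡ a′ + a - (x′ + y)
    lemma = solve-∀
  pick₃-pointwise true false y a a′ h _ _ hy lt =
    ≤-absurd (≤-from (ι-mono h ⊕ ι-mono hy) (lemma (ι a) (ι a′) 1ℤ (ι y))) lt
    where
    lemma : ∀ a a′ x y → a + a′ - (x + 0ℤ + y) ≡ a + a′ - (x + y)
    lemma = solve-∀

  intersect-pointwise : ∀ x x′ a → (x ≡ true → a ≡ true) → (x′ ≡ true → a ≡ true) → ι x + ι x′ ≤ ι a + ι (x ∧ x′)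
  intersect-pointwise false x′ a h h′ = ≤-from (ι-mono h′) (lemma (ι x′) (ι a))
    where
    lemma : ∀ x′ a → a + 0ℤ - (0ℤ + x′) ≡ a - x′
    lemma = solve-∀
  intersect-pointwise true  x′ a h h′ rewrite h refl = ≤-refl

  ∪-pointwise : ∀ a b → ι (a ∨ b) ≤ ι a + ι b
  ∪-pointwise false b = ≤-reflexive (sym (+-identityˡ (ι b)))
  ∪-pointwise true false = ≤-refl
  ∪-pointwise true true  = +≤+ (ℕ.s≤s ℕ.z≤n)

  -- Scaled cardinality and the pigeonhole principles built on it.

  module Measure {n : ℕ} (M : ℤ) (0<M : 0ℤ < M) where
    opaque

      ∥_∥ : (Fin n → Bool) → ℤ
      ∥ P ∥ = M * # P

      ∥∥-def : ∀ P → ∥ P ∥ ≡ M * # P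
      ∥∥-def P = refl

      0≤M : 0ℤ ≤ M
      0≤M = <⇒≤ 0<M

      ∥∥-mono : ∀ {P Q} → P ⊆ Q → ∥ P ∥ ≤ ∥ Q ∥
      ∥∥-mono P⊆Q = 0≤M ⊗ #-mono P⊆Q

      ∥∥-∪ : ∀ P Q → ∥ P ∪ Q ∥ ≤ ∥ P ∥ + ∥ Q ∥
      ∥∥-∪ P Q = ≤-trans (0≤M ⊗ ∑-mono (λ i → ∪-pointwise (P i) (Q i)))
        (≤-reflexive (trans (cong (M *_) (∑-+ _ _)) (*-distribˡ-+ M (# P) (# Q))))

      ∥∥-disjoint : ∀ P Q → (∀ i → P i ≡ true → Q i ≡ false) → ∥ P ∥ + ∥ Q ∥ ≤ ∥ P ∪ Q ∥
      ∥∥-disjoint P Q h = ≤-trans (≤-reflexive (trans (sym (*-distribˡ-+ M (# P) (# Q))) (cong (M *_) (sym (∑-+ _ _)))))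
        (0≤M ⊗ ∑-mono (λ i → pointwise (P i) (Q i) (h i)))
        where
        pointwise : ∀ a b → (a ≡ true → b ≡ false) → ι a + ι b ≤ ι (a ∨ b)
        pointwise false b _ = ≤-reflexive (+-identityˡ (ι b))
        pointwise true  b h rewrite h refl = ≤-refl

      ∥∥-∁ : ∀ P → ∥ P ∥ + ∥ ∁ P ∥ ≡ M * + n
      ∥∥-∁ P = trans (sym (*-distribˡ-+ M (# P) (# (∁ P)))) (cong (M *_) (#-∁ P))

      pick₁ : ∀ {X B} → ∥ B ∥ < ∥ X ∥ → ∃ λ z → X z ≡ true × B z ≡ false
      pick₁ lt = let z , lt′ = ∑-pick _ _ (*-cancelˡ-<-nonNeg M {{nonNegative 0≤M}} lt) in z , ι<ι lt′

      private
        gather : ∀ P Q R → ∥ P ∥ + ∥ Q ∥ + ∥ R ∥ ≡ M * ∑ (λ i → ι (P i) + ι (Q i) + ι (R i))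
        gather P Q R = trans (lemma M (# P) (# Q) (# R)) (cong (M *_) (sym (trans (∑-+ _ _) (cong (_+ # R) (∑-+ _ _)))))
          where
          lemma : ∀ M x y z → M * x + M * y + M * z ≡ M * (x + y + z)
          lemma = solve-∀

        gather₂ : ∀ P Q → ∥ P ∥ + ∥ Q ∥ ≡ M * ∑ (λ i → ι (P i) + ι (Q i))
        gather₂ P Q = trans (sym (*-distribˡ-+ M (# P) (# Q))) (cong (M *_) (sym (∑-+ _ _)))

      -- Inside `A ∩ A′` the set `X` misses at most `|A| - |X|` points and `X′` at most
      -- `|A′| - |X′|`. The hypothesis says that more than `|B|` points remain in both. This is how
      -- two sets that nearly fill two overlapping sets are shown to meet outside a small bad set.
      pick₂ : ∀ {X X′ A A′ B} → X ⊆ A → X′ ⊆ A′ → ∥ A ∥ + ∥ A′ ∥ + ∥ B ∥ < ∥ X ∥ + ∥ X′ ∥ + ∥ A ∩ A′ ∥ →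
              ∃ λ z → (X z ≡ true × X′ z ≡ true) × B z ≡ false
      pick₂ {X} {X′} {A} {A′} {B} X⊆A X′⊆A′ lt =
        let z , lt′ = ∑-pick _ _ (*-cancelˡ-<-nonNeg M {{nonNegative 0≤M}} (subst₂ _<_ (gather A A′ B) (gather X X′ (A ∩ A′)) lt))
        in z , pick₂-pointwise (X z) (X′ z) (A z) (A′ z) (B z) (X⊆A z) (X′⊆A′ z) lt′

      -- Outside `Y` the sets `X` and `X′` have room for at most `|A| - |Y|` and `|A′| - |Y|`
      -- points, so together they put more than `|Y|` points into `Y` and must meet. No lower bound
      -- on `A ∩ A′` is needed, as `Y` lies in it.
      pick₃ : ∀ {X X′ Y A A′} → X ⊆ A → Y ⊆ A → X′ ⊆ A′ → Y ⊆ A′ → ∥ A ∥ + ∥ A′ ∥ < ∥ X ∥ + ∥ X′ ∥ + ∥ Y ∥ →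
              ∃ λ z → X z ≡ true × X′ z ≡ true
      pick₃ {X} {X′} {Y} {A} {A′} X⊆A Y⊆A X′⊆A′ Y⊆A′ lt =
        let z , lt′ = ∑-pick _ _ (*-cancelˡ-<-nonNeg M {{nonNegative 0≤M}} (subst₂ _<_ (gather₂ A A′) (gather X X′ Y) lt))
        in z , pick₃-pointwise (X z) (X′ z) (Y z) (A z) (A′ z) (X⊆A z) (Y⊆A z) (X′⊆A′ z) (Y⊆A′ z) lt′

      intersect : ∀ {X X′ A} → X ⊆ A → X′ ⊆ A → ∥ X ∥ + ∥ X′ ∥ ≤ ∥ A ∥ + ∥ X ∩ X′ ∥
      intersect {X} {X′} {A} X⊆A X′⊆A = subst₂ _≤_ (sym (gather₂ X X′)) (sym (gather₂ A (X ∩ X′)))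
        (0≤M ⊗ ∑-mono (λ i → intersect-pointwise (X i) (X′ i) (A i) (X⊆A i) (X′⊆A i)))

  ∑-zeros : ∀ {n} {f : Fin n → ℤ} → (∀ i → f i ≡ 0ℤ) → ∑ f ≡ 0ℤ
  ∑-zeros {n} h = trans (∑-cong h) (trans (∑-const n 0ℤ) (*-zeroʳ (+ n)))

  #-unique : ∀ {n} (P : Fin n → Bool) i → P i ≡ true → (∀ j → P j ≡ true → j ≡ i) → # P ≡ 1ℤ
  #-unique P zero Pi uniq = trans (∑-suc _) (cong₂ _+_ (cong ι Pi) (∑-zeros λ j → cong ι (≢true λ Pj → case-suc (uniq (suc j) Pj))))
    where
    case-suc : ∀ {A : Set} {m} {j : Fin m} → suc j ≡ zero → A
    case-suc ()
  #-unique P (suc i) Pi uniq = trans (∑-suc _) (trans (cong₂ _+_ (cong ι (≢true λ P0 → case-zero (uniq zero P0)))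
      (#-unique (λ j → P (suc j)) i Pi (λ j Pj → Fin.suc-injective (uniq (suc j) Pj)))) refl)
    where
    case-zero : ∀ {A : Set} {m} {j : Fin m} → zero ≡ suc j → A
    case-zero ()

  module IteratedSums {n : ℕ} where

    ∑₂ : (Fin n → Fin n → ℤ) → ℤ
    ∑₂ f = ∑ λ u → ∑ (f u)

    ∑₃ : (Fin n → Fin n → Fin n → ℤ) → ℤ
    ∑₃ f = ∑ λ u → ∑₂ (f u)

    ∑₂-cong : ∀ {f h} → (∀ u v → f u v ≡ h u v) → ∑₂ f ≡ ∑₂ h
    ∑₂-cong eq = ∑-cong λ u → ∑-cong (eq u)

    ∑₂-mono : ∀ {f h} → (∀ u v → f u v ≤ h u v) → ∑₂ f ≤ ∑₂ h
    ∑₂-mono le = ∑-mono λ u → ∑-mono (le u)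

    ∑₂-+ : ∀ f h → ∑₂ (λ u v → f u v + h u v) ≡ ∑₂ f + ∑₂ h
    ∑₂-+ f h = trans (∑-cong λ u → ∑-+ (f u) (h u)) (∑-+ (λ u → ∑ (f u)) (λ u → ∑ (h u)))

    ∑₂-* : ∀ x f → ∑₂ (λ u v → x * f u v) ≡ x * ∑₂ f
    ∑₂-* x f = trans (∑-cong λ u → ∑-* x (f u)) (∑-* x (λ u → ∑ (f u)))

    ∑₂-nonNeg : ∀ {f : Fin n → Fin n → ℤ} → (∀ u v → 0ℤ ≤ f u v) → 0ℤ ≤ ∑₂ f
    ∑₂-nonNeg le = ∑-nonNeg λ u → ∑-nonNeg (le u)

    ∑₃-cong : ∀ {f h} → (∀ u v w → f u v w ≡ h u v w) → ∑₃ f ≡ ∑₃ h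
    ∑₃-cong eq = ∑-cong λ u → ∑₂-cong (eq u)

    ∑₃-mono : ∀ {f h} → (∀ u v w → f u v w ≤ h u v w) → ∑₃ f ≤ ∑₃ h
    ∑₃-mono le = ∑-mono λ u → ∑₂-mono (le u)

    ∑₃-+ : ∀ f h → ∑₃ (λ u v w → f u v w + h u v w) ≡ ∑₃ f + ∑₃ h
    ∑₃-+ f h = trans (∑-cong λ u → ∑₂-+ (f u) (h u)) (∑-+ (λ u → ∑₂ (f u)) (λ u → ∑₂ (h u)))

  open IteratedSums public

  ι-cong : ∀ {a b} → (a ≡ true → b ≡ true) → (b ≡ true → a ≡ true) → ι a ≡ ι b
  ι-cong h h′ = ≤-antisym (ι-mono h) (ι-mono h′)

  -- Steiner triple systems on classes of vertices, without quotients.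

  record BlockStructure (n : ℕ) : Set where
    field
      p         : Fin n → Bool
      sim       : Fin n → Fin n → Bool
      sim-p     : ∀ {u v} → sim u v ≡ true → p u ≡ true
      sim-refl  : ∀ {u} → p u ≡ true → sim u u ≡ true
      sim-sym   : ∀ {u v} → sim u v ≡ true → sim v u ≡ true
      sim-trans : ∀ {u v w} → sim u v ≡ true → sim v w ≡ true → sim u w ≡ true
      T         : Fin n → Fin n → Fin n → Bool
      T-p       : ∀ {u v w} → T u v w ≡ true → p w ≡ true
      T-swap    : ∀ {u v w} → T u v w ≡ true → T v u w ≡ true
      T-swap₂₃  : ∀ {u v w} → T u v w ≡ true → T u w v ≡ true
      T-resp    : ∀ {u v w w′} → sim w w′ ≡ true → T u v w ≡ true → T u v w′ ≡ true
      T⇒≁       : ∀ {u v w} → T u v w ≡ true → sim u v ≡ false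
      -- With `T-full` this is the Steiner property: two distinct classes lie in exactly one block.
      -- `T⇒≁` and the symmetries make the three classes of a block distinct.
      T-linear  : ∀ {u v w w′} → T u v w ≡ true → T u v w′ ≡ true → sim w w′ ≡ true
      T-full    : ∀ {u v} → p u ≡ true → p v ≡ true → sim u v ≡ false → ∃ λ w → T u v w ≡ true

  module Blocks {n : ℕ} (B : BlockStructure n) where

    open BlockStructure B public

    size : Fin n → ℤ
    size u = # (sim u)

    private
      Earlier : Fin n → Set
      Earlier ρ = ∃ λ v → v Fin.< ρ × sim ρ v ≡ true

      earlier? : ∀ ρ → Dec (Earlier ρ)
      earlier? ρ = Fin.any? λ v → v Fin.<? ρ ×-dec sim ρ v Bool.≟ true

    rep : Fin n → Bool
    rep ρ = p ρ ∧ not (does (earlier? ρ))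

    rep⇒p : ∀ {ρ} → rep ρ ≡ true → p ρ ≡ true
    rep⇒p {ρ} h = proj₁ (∩-elim (p ρ) h)

    private
      rep⇒first : ∀ {ρ} → rep ρ ≡ true → ¬ Earlier ρ
      rep⇒first {ρ} h = from-false (earlier? ρ) (not-elim (proj₂ (∩-elim (p ρ) h)))

      rep-exists : ∀ {u} → Acc Fin._<_ u → p u ≡ true → ∃ λ ρ → rep ρ ≡ true × sim u ρ ≡ true
      rep-exists {u} (acc rec) pu with earlier? u in eq
      ... | yes (v , v<u , s) = let ρ , rρ , t = rep-exists (rec v<u) (sim-p (sim-sym s)) in ρ , rρ , sim-trans s t
      ... | no ¬q = u , ∩-intro pu (cong (λ d → not (does d)) eq) , sim-refl pu

      rep-unique : ∀ {ρ σ} → rep ρ ≡ true → rep σ ≡ true → sim ρ σ ≡ true → ρ ≡ σ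
      rep-unique {ρ} {σ} rρ rσ s with Fin.<-cmp ρ σ
      ... | tri< lt _ _ = ⊥-elim (rep⇒first rσ (ρ , lt , sim-sym s))
      ... | tri≈ _ eq _ = eq
      ... | tri> _ _ gt = ⊥-elim (rep⇒first rρ (σ , gt , s))

    rep-count : ∀ {u} → p u ≡ true → # (λ ρ → rep ρ ∧ sim u ρ) ≡ 1ℤ
    rep-count {u} pu =
      let ρ , rρ , s = rep-exists (<-wellFounded u) pu
      in #-unique _ ρ (∩-intro rρ s) (λ σ h → let rσ , t = ∩-elim (rep σ) h in rep-unique rσ rρ (sim-trans (sim-sym t) s))

    -- The sum over the classes of a class function φ, through their least representatives.
    R : (Fin n → ℤ) → ℤ
    R φ = ∑ λ ρ → ι (rep ρ) * φ ρ

    R-cong : ∀ {φ ψ} → (∀ {u} → p u ≡ true → φ u ≡ ψ u) → R φ ≡ R ψ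
    R-cong {φ} {ψ} h = ∑-cong pointwise
      where
      pointwise : ∀ u → ι (rep u) * φ u ≡ ι (rep u) * ψ u
      pointwise u with rep u in eq
      ... | true  = cong (1ℤ *_) (h (rep⇒p eq))
      ... | false = trans (*-zeroˡ (φ u)) (sym (*-zeroˡ (ψ u)))

    R-mono : ∀ {φ ψ} → (∀ {u} → p u ≡ true → φ u ≤ ψ u) → R φ ≤ R ψ
    R-mono {φ} {ψ} h = ∑-mono pointwise
      where
      pointwise : ∀ u → ι (rep u) * φ u ≤ ι (rep u) * ψ u
      pointwise u with rep u in eq
      ... | true  = _⊗_ {1ℤ} 0≤+ (h (rep⇒p eq))
      ... | false = ≤-reflexive (trans (*-zeroˡ (φ u)) (sym (*-zeroˡ (ψ u))))

    R-+ : ∀ φ ψ → R (λ u → φ u + ψ u) ≡ R φ + R ψ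
    R-+ φ ψ = trans (∑-cong (λ u → *-distribˡ-+ (ι (rep u)) (φ u) (ψ u))) (∑-+ _ _)

    R-* : ∀ x φ → R (λ u → x * φ u) ≡ x * R φ
    R-* x φ = trans (∑-cong (λ u → lemma (ι (rep u)) x (φ u))) (∑-* x _)
      where
      lemma : ∀ r x f → r * (x * f) ≡ x * (r * f)
      lemma = solve-∀

    R-swap : ∀ (φ : Fin n → Fin n → ℤ) → R (λ u → R (λ v → φ u v)) ≡ R (λ v → R (λ u → φ u v))
    R-swap φ = trans (∑-cong λ u → sym (∑-* (ι (rep u)) _))
      (trans (∑-swap _) (∑-cong λ v → trans (∑-cong λ u → lemma (ι (rep u)) (ι (rep v)) (φ u v)) (∑-* (ι (rep v)) _)))
      where
      lemma : ∀ r s x → r * (s * x) ≡ s * (r * x)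
      lemma = solve-∀

    Invariant : (Fin n → ℤ) → Set
    Invariant φ = ∀ {u v} → sim u v ≡ true → φ u ≡ φ v

    R-sim : ∀ {φ} → Invariant φ → ∀ {u} → p u ≡ true → R (λ v → ι (sim u v) * φ v) ≡ φ u
    R-sim {φ} inv {u} pu = trans (∑-cong (λ v → pointwise v)) (trans (∑-*ʳ (φ u) _) (trans (cong (_* φ u) (rep-count pu)) (*-identityˡ (φ u))))
      where
      pointwise : ∀ v → ι (rep v) * (ι (sim u v) * φ v) ≡ ι (rep v ∧ sim u v) * φ u
      pointwise v with rep v | sim u v in s
      ... | false | t     = trans (*-zeroˡ (ι t * φ v)) (sym (*-zeroˡ (φ u)))
      ... | true  | false = trans (cong (1ℤ *_) (*-zeroˡ (φ v))) (sym (*-zeroˡ (φ u)))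
      ... | true  | true  = trans (*-identityˡ (1ℤ * φ v)) (cong (1ℤ *_) (sym (inv s)))

    size-invariant : Invariant size
    size-invariant s = ∑-cong λ w → ι-cong (sim-trans (sim-sym s)) (sim-trans s)

    -- Each vertex of the support is charged to the representative of its class; exchanging the sums
    -- then collects one copy of `φ` per member.
    ∑⇒R : ∀ {φ} → (∀ {u} → p u ≡ false → φ u ≡ 0ℤ) → Invariant φ → ∑ φ ≡ R (λ u → size u * φ u)
    ∑⇒R {φ} supp inv = begin
      ∑ φ ≡⟨ ∑-cong pointwise ⟩
      ∑ (λ u → R (λ ρ → ι (sim ρ u) * φ ρ)) ≡⟨ ∑-swap _ ⟩
      ∑ (λ ρ → ∑ (λ u → ι (rep ρ) * (ι (sim ρ u) * φ ρ))) ≡⟨ ∑-cong (λ ρ → trans (∑-* (ι (rep ρ)) _) (cong (ι (rep ρ) *_) (∑-*ʳ (φ ρ) _))) ⟩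
      R (λ u → size u * φ u)                       ∎
      where
      open ≡-Reasoning
      pointwise : ∀ u → φ u ≡ R (λ ρ → ι (sim ρ u) * φ ρ)
      pointwise u with p u in pu
      ... | true  = trans (sym (R-sim inv pu)) (∑-cong λ ρ → cong (λ b → ι (rep ρ) * (b * φ ρ)) (ι-cong sim-sym sim-sym))
      ... | false = trans (supp pu) (sym (∑-zeros λ ρ → trans (cong (ι (rep ρ) *_) (trans (cong (_* φ ρ) (cong ι (isolated ρ))) (*-zeroˡ (φ ρ)))) (*-zeroʳ (ι (rep ρ)))))
        where
        isolated : ∀ ρ → sim ρ u ≡ false
        isolated ρ = ≢true λ s → true≢false (sim-p (sim-sym s)) pu

    T-rot : ∀ {u v w} → T u v w ≡ true → T v w u ≡ true
    T-rot t = T-swap₂₃ (T-swap t)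

    ιT-swap₂₃ : ∀ u v w → ι (T u v w) ≡ ι (T u w v)
    ιT-swap₂₃ u v w = ι-cong T-swap₂₃ T-swap₂₃

    ιT-rot : ∀ u v w → ι (T u v w) ≡ ι (T v w u)
    ιT-rot u v w = ι-cong T-rot (λ t → T-rot (T-rot t))

    -- The only point at which the Steiner property enters the counting: distinct classes have one
    -- third class, a class paired with itself has none.
    R-T : ∀ {u v} → p u ≡ true → p v ≡ true → R (λ w → ι (T u v w)) ≡ 1ℤ - ι (sim u v)
    R-T {u} {v} pu pv with sim u v in s
    ... | true  = ∑-zeros λ w → trans (cong (λ b → ι (rep w) * ι b) (≢true λ t → true≢false s (T⇒≁ t))) (*-zeroʳ (ι (rep w)))
    ... | false =
      let w₀ , t₀ = T-full pu pv s
      in trans (R-cong {ψ = λ w → ι (sim w₀ w) * 1ℤ} (λ {w} _ → trans (ι-cong (T-linear t₀) (λ r → T-resp r t₀)) (sym (*-identityʳ (ι (sim w₀ w))))))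
           (R-sim (λ _ → refl) (T-p t₀))

    T-total : ℤ
    T-total = ∑ λ u → ∑ λ v → ∑ λ w → ι (T u v w)

    private
      ∑T₁ : ∀ u v → ∑ (λ w → ι (T u v w)) ≡ R (λ w → size w * ι (T u v w))
      ∑T₁ u v = ∑⇒R (λ pw → cong ι (≢true λ t → true≢false (T-p t) pw)) (λ s → ι-cong (T-resp s) (T-resp (sim-sym s)))

      ∑T₂ : ∀ u → ∑ (λ v → ∑ (λ w → ι (T u v w))) ≡ R (λ v → size v * R (λ w → size w * ι (T u v w)))
      ∑T₂ u = trans (∑⇒R (λ pv → ∑-zeros λ w → cong ι (≢true λ t → true≢false (T-p (T-swap₂₃ t)) pv))
                         (λ s → ∑-cong λ w → ι-cong (λ t → T-swap₂₃ (T-resp s (T-swap₂₃ t))) (λ t → T-swap₂₃ (T-resp (sim-sym s) (T-swap₂₃ t)))))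
                    (∑-cong λ v → cong (λ x → ι (rep v) * (size v * x)) (∑T₁ u v))

    T-total-R : T-total ≡ R (λ u → size u * R (λ v → size v * R (λ w → size w * ι (T u v w))))
    T-total-R = trans (∑⇒R (λ pu → ∑-zeros λ v → ∑-zeros λ w → cong ι (≢true λ t → true≢false (T-p (T-rot t)) pu))
                           (λ s → ∑-cong λ v → ∑-cong λ w → ι-cong (λ t → T-rot (T-rot (T-resp s (T-rot t)))) (λ t → T-rot (T-rot (T-resp (sim-sym s) (T-rot t))))))
                      (∑-cong λ u → cong (λ x → ι (rep u) * (size u * x)) (∑T₂ u))

    R₃ : (Fin n → Fin n → Fin n → ℤ) → ℤ
    R₃ φ = R λ u → R λ v → R λ w → φ u v w

    R₃-* : ∀ x φ → R₃ (λ u v w → x * φ u v w) ≡ x * R₃ φ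
    R₃-* x φ = trans (R-cong λ _ → trans (R-cong λ _ → R-* x _) (R-* x _)) (R-* x _)

    R₃-+ : ∀ φ ψ → R₃ (λ u v w → φ u v w + ψ u v w) ≡ R₃ φ + R₃ ψ
    R₃-+ φ ψ = trans (R-cong λ _ → trans (R-cong λ _ → R-+ _ _) (R-+ _ _)) (R-+ _ _)

    R₃-mono : ∀ {φ ψ} → (∀ {u v w} → p u ≡ true → p v ≡ true → p w ≡ true → φ u v w ≤ ψ u v w) → R₃ φ ≤ R₃ ψ
    R₃-mono h = R-mono λ pu → R-mono λ pv → R-mono λ pw → h pu pv pw

    T-total-R₃ : T-total ≡ R₃ (λ u v w → size u * (size v * (size w * ι (T u v w))))
    T-total-R₃ = trans T-total-R (R-cong λ {u} _ → trans (sym (R-* (size u) _)) (R-cong λ {v} _ →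
      trans (cong (size u *_) (sym (R-* (size v) _))) (sym (R-* (size u) _))))

    offDiag : (Fin n → Fin n → ℤ) → ℤ
    offDiag ψ = R λ u → R λ v → ψ u v * (1ℤ - ι (sim u v))

    -- A weight that depends on two of the three classes of a block sums over all blocks to its sum
    -- over ordered pairs of distinct classes, since each such pair completes to one block. Hence
    -- the particular triple system does not matter for the count.
    marginal₁₂ : ∀ ψ → R₃ (λ u v w → ψ u v * ι (T u v w)) ≡ offDiag ψ
    marginal₁₂ ψ = R-cong λ {u} pu → R-cong λ {v} pv → trans (R-* (ψ u v) _) (cong (ψ u v *_) (R-T pu pv))

    marginal₁₃ : ∀ ψ → R₃ (λ u v w → ψ u w * ι (T u v w)) ≡ offDiag ψ
    marginal₁₃ ψ = trans (R-cong λ {u} _ → trans (R-swap _) (R-cong λ {w} _ → R-cong λ {v} _ → cong (ψ u w *_) (ιT-swap₂₃ u v w))) (marginal₁₂ ψ)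

    marginal₂₃ : ∀ ψ → R₃ (λ u v w → ψ v w * ι (T u v w)) ≡ offDiag ψ
    marginal₂₃ ψ = trans (R-swap _) (trans (R-cong λ {v} _ → trans (R-swap _) (R-cong λ {w} _ → R-cong λ {u} _ → cong (ψ v w *_) (ιT-rot u v w))) (marginal₁₂ ψ))

    offDiag-+ : ∀ φ ψ → offDiag (λ u v → φ u v + ψ u v) ≡ offDiag φ + offDiag ψ
    offDiag-+ φ ψ = trans (R-cong λ {u} _ → trans (R-cong λ {v} _ → *-distribʳ-+ (1ℤ - ι (sim u v)) (φ u v) (ψ u v)) (R-+ _ _)) (R-+ _ _)

    offDiag-diag : ∀ ψ → (∀ u → Invariant (ψ u)) → offDiag ψ ≡ R (λ u → R (ψ u)) - R (λ u → ψ u u)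
    offDiag-diag ψ inv = trans (R-cong λ {u} pu → trans (split u) (cong (_-_ (R (ψ u))) (R-sim (inv u) pu))) (minus (λ u → R (ψ u)) (λ u → ψ u u))
      where
      minus : ∀ φ χ → R (λ u → φ u - χ u) ≡ R φ - R χ
      minus φ χ = trans (∑-cong λ u → lemma (ι (rep u)) (φ u) (χ u)) (∑-- _ _)
        where
        lemma : ∀ r a b → r * (a - b) ≡ r * a - r * b
        lemma = solve-∀
      split : ∀ u → R (λ v → ψ u v * (1ℤ - ι (sim u v))) ≡ R (ψ u) - R (λ v → ι (sim u v) * ψ u v)
      split u = trans (R-cong λ {v} _ → lemma (ψ u v) (ι (sim u v))) (minus (ψ u) (λ v → ι (sim u v) * ψ u v))
        where
        lemma : ∀ a s → a * (1ℤ - s) ≡ a - s * a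
        lemma = solve-∀

    R-constant : ∀ x → R (λ _ → x) ≡ x * # rep
    R-constant x = trans (∑-*ʳ x (λ u → ι (rep u))) (*-comm (# rep) x)

    R-sizes≡#p : R size ≡ # p
    R-sizes≡#p = trans (R-cong λ {u} pu → sym (trans (cong (λ b → size u * ι b) pu) (*-identityʳ (size u))))
      (sym (∑⇒R (cong ι) λ s → ι-cong (λ _ → sim-p (sim-sym s)) (λ _ → sim-p s)))

    -- Block triples of a nearly balanced partition.

    module Balance (k N D Δ : ℤ) (#rep≡k : # rep ≡ k) (#p≡N : # p ≡ N)
      (spread-lo : ∀ {u} → p u ≡ true → - Δ ≤ D * (k * size u - N))
      (spread-hi : ∀ {u} → p u ≡ true → D * (k * size u - N) ≤ Δ)
      where

      y : Fin n → ℤ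
      y u = k * size u - N

      Z : ℤ
      Z = R λ u → y u * y u

      private
        R-const : ∀ x → R (λ _ → x) ≡ x * k
        R-const x = trans (R-constant x) (cong (x *_) #rep≡k)

        R-size : R size ≡ N
        R-size = trans R-sizes≡#p #p≡N

      R-y : R y ≡ 0ℤ
      R-y = trans (R-+ (λ u → k * size u) (λ _ → - N)) (trans (cong₂ _+_ (trans (R-* k size) (cong (k *_) R-size)) (R-const (- N))) (lemma k N))
        where
        lemma : ∀ k N → k * N + (- N) * k ≡ 0ℤ
        lemma = solve-∀

      -- The linear term vanishes because the deviations `y` sum to zero, so imbalance shows up only
      -- through the second moment `Z`.
      R-quad : ∀ a b c → R (λ u → a + b * y u + c * (y u * y u)) ≡ a * k + c * Z
      R-quad a b c = trans (R-+ (λ u → a + b * y u) (λ u → c * (y u * y u)))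
        (cong₂ _+_ (trans (R-+ (λ _ → a) (λ u → b * y u)) (trans (cong₂ _+_ (R-const a) (trans (R-* b y) (cong (b *_) R-y))) (lemma a b k)))
          (R-* c (λ u → y u * y u)))
        where
        lemma : ∀ a b k → a * k + b * 0ℤ ≡ a * k
        lemma = solve-∀

      y-invariant : Invariant y
      y-invariant s = cong (λ x → k * x - N) (size-invariant s)

      -- The variance identity. Summed over vertices, `size` counts ordered pairs inside classes, so
      -- `Z` becomes a pair count that can be set against missing pairs and shadow pairs.
      Z≡ : Z ≡ k * (k * ∑ size - N * N)
      Z≡ = trans (R-cong λ {u} _ → lemma k N (size u)) (trans (R-+ (λ u → k * k * (size u * size u)) (λ u → (- (+ 2 * k * N)) * size u + N * N))
          (trans (cong₂ _+_ (trans (R-* (k * k) (λ u → size u * size u)) (cong (k * k *_) (sym R-sizes)))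
            (trans (R-+ (λ u → (- (+ 2 * k * N)) * size u) (λ _ → N * N))
              (cong₂ _+_ (trans (R-* (- (+ 2 * k * N)) size) (cong ((- (+ 2 * k * N)) *_) R-size)) (R-const (N * N))))) (lemma′ k N (∑ size))))
        where
        lemma : ∀ k N x → (k * x - N) * (k * x - N) ≡ k * k * (x * x) + ((- (+ 2 * k * N)) * x + N * N)
        lemma = solve-∀
        lemma′ : ∀ k N s → k * k * s + ((- (+ 2 * k * N)) * N + N * N * k) ≡ k * (k * s - N * N)
        lemma′ = solve-∀
        R-sizes : ∑ size ≡ R (λ u → size u * size u)
        R-sizes = ∑⇒R (λ pu → ∑-zeros λ v → cong ι (≢true λ s → true≢false (sim-p s) pu)) size-invariant

      private
        -- The expansion of `4D(N + a)(N + b)(N + c)` with the term `abc` replaced by its quadratic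
        -- majorant, dealt out to the three pairs of coordinates. Any distribution serves, as the
        -- three marginals agree.
        ψ₁₂ ψ₁₃ ψ₂₃ : ℤ → ℤ → ℤ
        ψ₁₂ a b = + 4 * D * (N * N * N) + + 4 * D * (N * N) * (a + b) + + 4 * D * N * (a * b) + + 2 * Δ * (a * a + b * b)
        ψ₁₃ a c = + 4 * D * (N * N) * c + + 4 * D * N * (a * c)
        ψ₂₃ b c = + 4 * D * N * (b * c)

        -- With Dc ∈ [-Δ, Δ] the cubic term is absorbed: 2Δ(a² + b²) - 4Dabc = (Δ - Dc)(a + b)² + (Δ + Dc)(a - b)².
        product-bound : ∀ {s t r} → - Δ ≤ D * (k * r - N) → D * (k * r - N) ≤ Δ →
          + 4 * D * (k * k * k) * (s * (t * r)) ≤ ψ₁₂ (k * s - N) (k * t - N) + (ψ₁₃ (k * s - N) (k * r - N) + ψ₂₃ (k * t - N) (k * r - N))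
        product-bound {s} {t} {r} lo hi = ≤-from
          (*-nonNeg (i≤j⇒0≤j-i hi) (sq-nonNeg ((k * s - N) + (k * t - N))) ⊕ *-nonNeg (i≤j⇒0≤j-i lo) (sq-nonNeg ((k * s - N) - (k * t - N))))
          (lemma k N D Δ s t r)
          where
          lemma : ∀ k N D Δ s t r →
            (+ 4 * D * (N * N * N) + + 4 * D * (N * N) * ((k * s - N) + (k * t - N)) + + 4 * D * N * ((k * s - N) * (k * t - N)) + + 2 * Δ * ((k * s - N) * (k * s - N) + (k * t - N) * (k * t - N)))
            + ((+ 4 * D * (N * N) * (k * r - N) + + 4 * D * N * ((k * s - N) * (k * r - N))) + (+ 4 * D * N * ((k * t - N) * (k * r - N))))
            - + 4 * D * (k * k * k) * (s * (t * r)) ≡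
            (Δ - D * (k * r - N)) * (((k * s - N) + (k * t - N)) * ((k * s - N) + (k * t - N)))
            + (D * (k * r - N) - (- Δ)) * (((k * s - N) - (k * t - N)) * ((k * s - N) - (k * t - N))) - (0ℤ + 0ℤ)
          lemma = solve-∀

      private
        Ψ : ℤ → ℤ → ℤ
        Ψ a b = ψ₁₂ a b + (ψ₁₃ a b + ψ₂₃ a b)

        f₁₂ f₁₃ f₂₃ : Fin n → Fin n → ℤ
        f₁₂ u v = ψ₁₂ (y u) (y v)
        f₁₃ u v = ψ₁₃ (y u) (y v)
        f₂₃ u v = ψ₂₃ (y u) (y v)

        marginals : R₃ (λ u v w → f₁₂ u v * ι (T u v w) + (f₁₃ u w * ι (T u v w) + f₂₃ v w * ι (T u v w))) ≡ offDiag (λ u v → Ψ (y u) (y v))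
        marginals = begin
          R₃ (λ u v w → f₁₂ u v * ι (T u v w) + (f₁₃ u w * ι (T u v w) + f₂₃ v w * ι (T u v w)))
            ≡⟨ R₃-+ (λ u v w → f₁₂ u v * ι (T u v w)) (λ u v w → f₁₃ u w * ι (T u v w) + f₂₃ v w * ι (T u v w)) ⟩
          R₃ (λ u v w → f₁₂ u v * ι (T u v w)) + R₃ (λ u v w → f₁₃ u w * ι (T u v w) + f₂₃ v w * ι (T u v w))
            ≡⟨ cong₂ _+_ (marginal₁₂ f₁₂) (trans (R₃-+ (λ u v w → f₁₃ u w * ι (T u v w)) (λ u v w → f₂₃ v w * ι (T u v w)))
                 (cong₂ _+_ (marginal₁₃ f₁₃) (marginal₂₃ f₂₃))) ⟩
          offDiag f₁₂ + (offDiag f₁₃ + offDiag f₂₃)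
            ≡⟨ cong (_+_ (offDiag f₁₂)) (sym (offDiag-+ f₁₃ f₂₃)) ⟩
          offDiag f₁₂ + offDiag (λ u v → f₁₃ u v + f₂₃ u v)
            ≡⟨ sym (offDiag-+ f₁₂ (λ u v → f₁₃ u v + f₂₃ u v)) ⟩
          offDiag (λ u v → Ψ (y u) (y v)) ∎
          where open ≡-Reasoning

        R-Ψ : ∀ a → R (λ v → Ψ a (y v)) ≡ (+ 4 * D * (N * N * N) * k + + 2 * Δ * Z) + + 4 * D * (N * N) * k * a + + 2 * Δ * k * (a * a)
        R-Ψ a = trans (R-cong λ {v} _ → expand N D Δ a (y v))
          (trans (R-quad (+ 4 * D * (N * N * N) + + 4 * D * (N * N) * a + + 2 * Δ * (a * a)) (+ 8 * D * (N * N) + + 12 * D * N * a) (+ 2 * Δ)) (regroup N D Δ k Z a))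
          where
          expand : ∀ N D Δ a b → (+ 4 * D * (N * N * N) + + 4 * D * (N * N) * (a + b) + + 4 * D * N * (a * b) + + 2 * Δ * (a * a + b * b))
              + ((+ 4 * D * (N * N) * b + + 4 * D * N * (a * b)) + + 4 * D * N * (a * b)) ≡
            (+ 4 * D * (N * N * N) + + 4 * D * (N * N) * a + + 2 * Δ * (a * a)) + (+ 8 * D * (N * N) + + 12 * D * N * a) * b + + 2 * Δ * (b * b)
          expand = solve-∀
          regroup : ∀ N D Δ k Z a → (+ 4 * D * (N * N * N) + + 4 * D * (N * N) * a + + 2 * Δ * (a * a)) * k + + 2 * Δ * Z ≡
            (+ 4 * D * (N * N * N) * k + + 2 * Δ * Z) + + 4 * D * (N * N) * k * a + + 2 * Δ * k * (a * a)
          regroup = solve-∀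

        RR-Ψ : R (λ u → R (λ v → Ψ (y u) (y v))) ≡ (+ 4 * D * (N * N * N) * k + + 2 * Δ * Z) * k + + 2 * Δ * k * Z
        RR-Ψ = trans (R-cong λ {u} _ → R-Ψ (y u)) (R-quad (+ 4 * D * (N * N * N) * k + + 2 * Δ * Z) (+ 4 * D * (N * N) * k) (+ 2 * Δ * k))

        R-Ψ-diag : R (λ u → Ψ (y u) (y u)) ≡ + 4 * D * (N * N * N) * k + (+ 12 * D * N + + 4 * Δ) * Z
        R-Ψ-diag = trans (R-cong λ {u} _ → expand N D Δ (y u)) (R-quad (+ 4 * D * (N * N * N)) (+ 12 * D * (N * N)) (+ 12 * D * N + + 4 * Δ))
          where
          expand : ∀ N D Δ a → (+ 4 * D * (N * N * N) + + 4 * D * (N * N) * (a + a) + + 4 * D * N * (a * a) + + 2 * Δ * (a * a + a * a))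
              + ((+ 4 * D * (N * N) * a + + 4 * D * N * (a * a)) + + 4 * D * N * (a * a)) ≡
            + 4 * D * (N * N * N) + + 12 * D * (N * N) * a + (+ 12 * D * N + + 4 * Δ) * (a * a)
          expand = solve-∀

      -- The products `ab`, `ac`, `bc` are summed over distinct classes; as the deviations sum to
      -- zero, each gives `-Z`, whence `-12DN`. The term `4Δ(k - 1)` is the price of absorbing
      -- `abc`. For `Δ` small against `DN/k` imbalance therefore loses triples.
      T-total-bound : + 4 * D * (k * k * k) * T-total ≤ + 4 * D * (N * N * N) * (k * k - k) + (+ 4 * Δ * (k - 1ℤ) - + 12 * D * N) * Z
      T-total-bound = begin
        + 4 * D * (k * k * k) * T-total
          ≡⟨ trans (cong (+ 4 * D * (k * k * k) *_) T-total-R₃) (sym (R₃-* (+ 4 * D * (k * k * k)) (λ u v w → size u * (size v * (size w * ι (T u v w)))))) ⟩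
        R₃ (λ u v w → + 4 * D * (k * k * k) * (size u * (size v * (size w * ι (T u v w)))))
          ≤⟨ R₃-mono (λ {u} {v} {w} _ _ pw → pointwise u v w pw) ⟩
        R₃ (λ u v w → f₁₂ u v * ι (T u v w) + (f₁₃ u w * ι (T u v w) + f₂₃ v w * ι (T u v w)))
          ≡⟨ marginals ⟩
        offDiag (λ u v → Ψ (y u) (y v))
          ≡⟨ offDiag-diag (λ u v → Ψ (y u) (y v)) (λ u s → cong (Ψ (y u)) (y-invariant s)) ⟩
        R (λ u → R (λ v → Ψ (y u) (y v))) - R (λ u → Ψ (y u) (y u))
          ≡⟨ cong₂ _-_ RR-Ψ R-Ψ-diag ⟩
        ((+ 4 * D * (N * N * N) * k + + 2 * Δ * Z) * k + + 2 * Δ * k * Z) - (+ 4 * D * (N * N * N) * k + (+ 12 * D * N + + 4 * Δ) * Z)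
          ≡⟨ final N D Δ k Z ⟩
        + 4 * D * (N * N * N) * (k * k - k) + (+ 4 * Δ * (k - 1ℤ) - + 12 * D * N) * Z ∎
        where
        open ≤-Reasoning
        pointwise : ∀ u v w → p w ≡ true → + 4 * D * (k * k * k) * (size u * (size v * (size w * ι (T u v w))))
          ≤ f₁₂ u v * ι (T u v w) + (f₁₃ u w * ι (T u v w) + f₂₃ v w * ι (T u v w))
        pointwise u v w pw = subst₂ _≤_ (lemma (ι (T u v w)) (+ 4 * D * (k * k * k)) (size u) (size v) (size w))
            (lemma′ (ι (T u v w)) (ψ₁₂ (y u) (y v)) (ψ₁₃ (y u) (y w)) (ψ₂₃ (y v) (y w)))
            (0≤ι (T u v w) ⊗ product-bound {size u} {size v} {size w} (spread-lo pw) (spread-hi pw))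
          where
          lemma : ∀ t c a b d → t * (c * (a * (b * d))) ≡ c * (a * (b * (d * t)))
          lemma = solve-∀
          lemma′ : ∀ t a b d → t * (a + (b + d)) ≡ a * t + (b * t + d * t)
          lemma′ = solve-∀
        final : ∀ N D Δ k Z → ((+ 4 * D * (N * N * N) * k + + 2 * Δ * Z) * k + + 2 * Δ * k * Z) - (+ 4 * D * (N * N * N) * k + (+ 12 * D * N + + 4 * Δ) * Z) ≡
          + 4 * D * (N * N * N) * (k * k - k) + (+ 4 * Δ * (k - 1ℤ) - + 12 * D * N) * Z
        final = solve-∀

      Z-nonNeg : 0ℤ ≤ Z
      Z-nonNeg = ∑-nonNeg λ u → *-nonNeg (0≤ι (rep u)) (sq-nonNeg (y u))

  -- Edges lost to missing pairs and to pairs of small codegree.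

  module BlockEdges {n : ℕ} (B : BlockStructure n) where

   open Blocks B

   module EdgeCount
     (e : Fin n → Fin n → Fin n → Bool) (g low : Fin n → Fin n → Bool) (M c δ : ℤ)
     (0≤M : 0ℤ ≤ M) (0≤δ : 0ℤ ≤ δ) (16δ≤c : + 16 * δ ≤ c)
     (e-swap₂₃ : ∀ {u v w} → e u v w ≡ true → e u w v ≡ true)
     (e⇒g      : ∀ {u v w} → e u v w ≡ true → g u v ≡ true)
     (g-p      : ∀ {u v} → g u v ≡ true → p u ≡ true × p v ≡ true)
     (g⇒≁      : ∀ {u v} → g u v ≡ true → sim u v ≡ false)
     (low⇒g    : ∀ {u v} → low u v ≡ true → g u v ≡ true)
     (low-light : ∀ {u v} → low u v ≡ true → + 2 * (M * # (e u v)) ≤ c)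
     (cover    : ∀ {u v w} → e u v w ≡ true → low u v ≡ false → T u v w ≡ true)
     (size-lo  : ∀ {u} → p u ≡ true → c - + 2 * δ ≤ M * # (sim u))
     (gap-small : ∀ {u} → p u ≡ true → M * # (λ v → (p v ∧ not (sim u v)) ∧ not (g u v)) ≤ + 3 * δ)
     (low-small : ∀ {u} → p u ≡ true → M * # (low u) ≤ δ)
     where

     -- A `gap` pair carries no edge and a `low` pair at most half of the typical codegree. Both are
     -- removed from the block triples as `light`, and the edges on `low` pairs are added back
     -- separately.
     cross gap light : Fin n → Fin n → Bool
     cross u v = p u ∧ (p v ∧ not (sim u v))
     gap u v = cross u v ∧ not (g u v)
     light u v = gap u v ∨ low u v

     E G μ o : ℤ
     E = ∑₃ λ u v w → ι (e u v w)
     G = ∑₂ λ u v → ι (g u v)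
     μ = ∑₂ λ u v → ι (gap u v)
     o = ∑₂ λ u v → ι (low u v)

     private
       0≤μ : 0ℤ ≤ μ
       0≤μ = ∑₂-nonNeg λ u v → 0≤ι (gap u v)

       0≤o : 0ℤ ≤ o
       0≤o = ∑₂-nonNeg λ u v → 0≤ι (low u v)

       light-sum : ∀ u v → ι (light u v) ≡ ι (gap u v) + ι (low u v)
       light-sum u v with low u v in l
       ... | false = trans (cong ι (∨-identityʳ _)) (sym (+-identityʳ _))
       ... | true rewrite low⇒g l | ∧-zeroʳ (cross u v) = refl

       ∑light : ∑₂ (λ u v → ι (light u v)) ≡ μ + o
       ∑light = trans (∑₂-cong light-sum) (∑₂-+ (λ u v → ι (gap u v)) (λ u v → ι (low u v)))

       light-p : ∀ {u v} → light u v ≡ true → p u ≡ true × p v ≡ true × sim u v ≡ false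
       light-p {u} {v} h with gap u v in q | h
       ... | true  | _ = let pu , r = ∩-elim (p u) (proj₁ (∩-elim (cross u v) q)) ; pv , s = ∩-elim (p v) r in pu , pv , not-elim s
       ... | false | l = let gv = low⇒g l ; pu , pv = g-p gv in pu , pv , g⇒≁ gv

       light-degree : ∀ {u} → p u ≡ true → M * ∑ (λ v → ι (light u v)) ≤ + 4 * δ
       light-degree {u} pu = begin
         M * ∑ (λ v → ι (light u v)) ≡⟨ cong (M *_) (trans (∑-cong (light-sum u)) (∑-+ (λ v → ι (gap u v)) (λ v → ι (low u v)))) ⟩
         M * (# (gap u) + # (low u)) ≡⟨ *-distribˡ-+ M (# (gap u)) (# (low u)) ⟩
         M * # (gap u) + M * # (low u) ≤⟨ ≤-trans (≤-reflexive (cong (λ x → M * x) (∑-cong gap-p))) (gap-small pu) ⊕ low-small pu ⟩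
         + 3 * δ + δ ≡⟨ lemma δ ⟩
         + 4 * δ                           ∎
         where
         open ≤-Reasoning
         gap-p : ∀ v → ι (gap u v) ≡ ι ((p v ∧ not (sim u v)) ∧ not (g u v))
         gap-p v rewrite pu = refl
         lemma : ∀ δ → + 3 * δ + δ ≡ + 4 * δ
         lemma = solve-∀

       T-degree : ∀ {u v} → p u ≡ true → p v ≡ true → sim u v ≡ false → c - + 2 * δ ≤ M * # (T u v)
       T-degree pu pv s = let w , t = T-full pu pv s in ≤-trans (size-lo (T-p t)) (0≤M ⊗ #-mono (λ z r → T-resp r t))

       l : Fin n → Fin n → ℤ
       l u v = ι (light u v)

       t : Fin n → Fin n → Fin n → ℤ
       t u v w = ι (T u v w)

       -- Only the two pairs at `u` are tested. Removing a light pair from two positions already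
       -- gains `2c/M` per ordered pair, more than the `3c/2M` required, and it leaves a single
       -- correction `C` in the inclusion-exclusion.
       heavyT : Fin n → Fin n → Fin n → ℤ
       heavyT u v w = t u v w * ((1ℤ - l u v) * (1ℤ - l u w))

       complement : ∀ b → 0ℤ ≤ 1ℤ - ι b
       complement true  = ≤-refl
       complement false = 0≤+

       split-pointwise : ∀ e t m m′ l l′ → (e ≡ true → l ≡ false → l′ ≡ false → t ≡ true × m ≡ false × m′ ≡ false) →
         ι e ≤ ι t * ((1ℤ - ι m) * (1ℤ - ι m′)) + (ι e * ι l + ι e * ι l′)
       split-pointwise e t m m′ l l′ h with *-nonNeg (0≤ι t) (*-nonNeg (complement m) (complement m′))
       split-pointwise false t m m′ l     l′    h | X = +-nonNeg X (+-nonNeg (≤-reflexive (sym (*-zeroˡ (ι l)))) (≤-reflexive (sym (*-zeroˡ (ι l′)))))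
       split-pointwise true  t m m′ true  l′    h | X = +-mono-≤ X (+-mono-≤ {1ℤ} {1ℤ} {0ℤ} ≤-refl (*-nonNeg {1ℤ} 0≤+ (0≤ι l′)))
       split-pointwise true  t m m′ false true  h | X = +-mono-≤ {0ℤ} {_} {1ℤ} X ≤-refl
       split-pointwise true  t m m′ false false h | X with h refl refl refl
       ... | refl , refl , refl = ≤-refl

       -- If neither pair at `u` is low, then both are adjacent and not low, hence not light, and
       -- `cover` makes the edge a block triple. Every other edge is charged to a low pair at `u`.
       split : ∀ u v w → ι (e u v w) ≤ heavyT u v w + (ι (e u v w) * ι (low u v) + ι (e u v w) * ι (low u w))
       split u v w = split-pointwise (e u v w) (T u v w) (light u v) (light u w) (low u v) (low u w)
         λ h l₁ l₂ → cover h l₁ , heavy-pair (e⇒g h) l₁ , heavy-pair (e⇒g (e-swap₂₃ h)) l₂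
         where
         heavy-pair : ∀ {u v} → g u v ≡ true → low u v ≡ false → light u v ≡ false
         heavy-pair {u} {v} gv lv rewrite gv | lv | ∧-zeroʳ (cross u v) = refl

       ∑low : ∑₃ (λ u v w → ι (e u v w) * ι (low u v)) ≡ ∑₂ (λ u v → # (e u v) * ι (low u v))
       ∑low = ∑₂-cong λ u v → ∑-*ʳ (ι (low u v)) (λ w → ι (e u v w))

       ∑low′ : ∑₃ (λ u v w → ι (e u v w) * ι (low u w)) ≡ ∑₂ (λ u v → # (e u v) * ι (low u v))
       ∑low′ = ∑-cong λ u → trans (∑-swap (λ v w → ι (e u v w) * ι (low u w)))
         (∑-cong λ w → trans (∑-*ʳ (ι (low u w)) (λ v → ι (e u v w))) (cong (_* ι (low u w)) (∑-cong λ v → ι-cong e-swap₂₃ e-swap₂₃)))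

       L : ℤ
       L = ∑₂ λ u v → # (e u v) * ι (low u v)

       E-split : E ≤ ∑₃ heavyT + (L + L)
       E-split = ≤-trans (∑₃-mono split) (≤-reflexive (trans
         (∑₃-+ heavyT (λ u v w → ι (e u v w) * ι (low u v) + ι (e u v w) * ι (low u w)))
         (cong (_+_ (∑₃ heavyT)) (trans (∑₃-+ (λ u v w → ι (e u v w) * ι (low u v)) (λ u v w → ι (e u v w) * ι (low u w)))
           (cong₂ _+_ ∑low ∑low′)))))

       L-bound : + 2 * M * L ≤ c * o
       L-bound = subst₂ _≤_ (∑₂-* (+ 2 * M) (λ u v → # (e u v) * ι (low u v))) (∑₂-* c (λ u v → ι (low u v))) (∑₂-mono pointwise)
         where
         pointwise : ∀ u v → + 2 * M * (# (e u v) * ι (low u v)) ≤ c * ι (low u v)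
         pointwise u v with low u v in l
         ... | true  = subst₂ _≤_ (lemma M (# (e u v))) (sym (*-identityʳ c)) (low-light l)
           where
           lemma : ∀ M x → + 2 * (M * x) ≡ + 2 * M * (x * 1ℤ)
           lemma = solve-∀
         ... | false = ≤-reflexive (lemma M c (# (e u v)))
           where
           lemma : ∀ M c x → + 2 * M * (x * 0ℤ) ≡ c * 0ℤ
           lemma = solve-∀

       A C : ℤ
       A = ∑₂ λ u v → l u v * # (T u v)
       C = ∑₃ λ u v w → l u v * (t u v w * l u w)

       ∑Tl : ∑₃ (λ u v w → l u v * t u v w) ≡ A
       ∑Tl = ∑₂-cong λ u v → ∑-* (l u v) (t u v)

       ∑Tl′ : ∑₃ (λ u v w → l u w * t u v w) ≡ A
       ∑Tl′ = ∑-cong λ u → trans (∑-swap (λ v w → l u w * t u v w))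
         (∑-cong λ w → trans (∑-* (l u w) (λ v → t u v w)) (cong (l u w *_) (∑-cong λ v → ι-cong T-swap₂₃ T-swap₂₃)))

       ∑heavyT : ∑₃ heavyT + (A + A) ≡ T-total + C
       ∑heavyT = begin
         ∑₃ heavyT + (A + A)
           ≡⟨ cong (_+_ (∑₃ heavyT)) (sym (trans (∑₃-+ (λ u v w → l u v * t u v w) (λ u v w → l u w * t u v w)) (cong₂ _+_ ∑Tl ∑Tl′))) ⟩
         ∑₃ heavyT + ∑₃ (λ u v w → l u v * t u v w + l u w * t u v w)
           ≡⟨ sym (∑₃-+ heavyT (λ u v w → l u v * t u v w + l u w * t u v w)) ⟩
         ∑₃ (λ u v w → heavyT u v w + (l u v * t u v w + l u w * t u v w))
           ≡⟨ ∑₃-cong (λ u v w → lemma (t u v w) (l u v) (l u w)) ⟩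
         ∑₃ (λ u v w → t u v w + l u v * (t u v w * l u w))
           ≡⟨ ∑₃-+ t (λ u v w → l u v * (t u v w * l u w)) ⟩
         T-total + C ∎
         where
         open ≡-Reasoning
         lemma : ∀ t a b → t * ((1ℤ - a) * (1ℤ - b)) + (a * t + b * t) ≡ t + a * (t * b)
         lemma = solve-∀

       A-bound : (c - + 2 * δ) * (μ + o) ≤ M * A
       A-bound = subst₂ _≤_ (trans (∑₂-* (c - + 2 * δ) l) (cong ((c - + 2 * δ) *_) ∑light)) (∑₂-* M (λ u v → l u v * # (T u v))) (∑₂-mono pointwise)
         where
         pointwise : ∀ u v → (c - + 2 * δ) * l u v ≤ M * (l u v * # (T u v))
         pointwise u v with light u v in h
         ... | true  = let pu , pv , s = light-p h in subst₂ _≤_ (sym (*-identityʳ _)) (cong (M *_) (sym (*-identityˡ _))) (T-degree pu pv s)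
         ... | false = ≤-reflexive (lemma c δ M (# (T u v)))
           where
           lemma : ∀ c δ M x → (c - + 2 * δ) * 0ℤ ≡ M * (0ℤ * x)
           lemma = solve-∀

       -- Triples with both pairs at `u` light are of second order: `light-degree` allows few light
       -- pairs at one vertex, so each light pair is in few such triples.
       C-bound : M * C ≤ + 4 * δ * (μ + o)
       C-bound = subst₂ _≤_ (∑₂-* M (λ u v → ∑ λ w → l u v * (t u v w * l u w))) (trans (∑₂-* (+ 4 * δ) l) (cong (+ 4 * δ *_) ∑light)) (∑₂-mono pointwise)
         where
         pointwise : ∀ u v → M * ∑ (λ w → l u v * (t u v w * l u w)) ≤ + 4 * δ * l u v
         pointwise u v with light u v in h
         ... | true  = let pu , _ = light-p h in ≤-trans (0≤M ⊗ ∑-mono (λ w → drop (T u v w) (light u w)))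
                 (≤-trans (light-degree pu) (≤-reflexive (sym (*-identityʳ _))))
           where
           drop : ∀ a b → 1ℤ * (ι a * ι b) ≤ ι b
           drop true  true  = ≤-refl
           drop true  false = ≤-refl
           drop false true  = 0≤+
           drop false false = ≤-refl
         ... | false = ≤-reflexive (trans (cong (M *_) (∑-zeros λ w → *-zeroˡ (t u v w * l u w))) (trans (*-zeroʳ M) (sym (*-zeroʳ (+ 4 * δ)))))

     -- A missing pair is charged `4c` and a low one `4c - 2c`, since a low pair still carries half
     -- of its edges; the errors are at most `16δ ≤ c` for each. What remains is `3c` for every
     -- missing pair, exactly the rate of exchange with shadow pairs.
     edge-bound : + 2 * M * E ≤ + 2 * M * T-total - + 3 * c * μ
     edge-bound = combine E (∑₃ heavyT) L A C T-total μ o E-split L-bound ∑heavyT A-bound C-bound 0≤μ 0≤o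
       where
       combine : ∀ E X L A C T μ o → E ≤ X + (L + L) → + 2 * M * L ≤ c * o → X + (A + A) ≡ T + C →
         (c - + 2 * δ) * (μ + o) ≤ M * A → M * C ≤ + 4 * δ * (μ + o) → 0ℤ ≤ μ → 0ℤ ≤ o → + 2 * M * E ≤ + 2 * M * T - + 3 * c * μ
       combine E X L A C T μ o h₁ h₂ h₃ h₄ h₅ 0≤μ 0≤o = ≤-from
         (_⊗_ {+ 2 * M} (*-nonNeg {+ 2} 0≤+ 0≤M) (h₁ ⊕ ≤-reflexive h₃) ⊕ _⊗_ {+ 2} 0≤+ h₂ ⊕ _⊗_ {+ 4} 0≤+ h₄ ⊕ _⊗_ {+ 2} 0≤+ h₅
           ⊕ (0≤μ ⊗ 16δ≤c) ⊕ (0≤o ⊗ 16δ≤c) ⊕ (0≤o ⊗ c≥0))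
         (lemma M c δ E X L A C T μ o)
         where
         c≥0 : 0ℤ ≤ c
         c≥0 = ≤-trans (*-nonNeg {+ 16} 0≤+ 0≤δ) 16δ≤c
         lemma : ∀ M c δ E X L A C T μ o → + 2 * M * T - + 3 * c * μ - + 2 * M * E ≡
           + 2 * M * (X + (L + L) + (T + C)) + + 2 * (c * o) + + 4 * (M * A) + + 2 * (+ 4 * δ * (μ + o)) + μ * c + o * c + o * c
             - (+ 2 * M * (E + (X + (A + A))) + + 2 * (+ 2 * M * L) + + 4 * ((c - + 2 * δ) * (μ + o)) + + 2 * (M * C) + μ * (+ 16 * δ) + o * (+ 16 * δ) + o * 0ℤ)
         lemma = solve-∀

     -- Used in `good-bound` to eliminate in-class pairs and missing pairs together in favour of
     -- shadow pairs.
     pair-count : # p * # p ≡ ∑ size + (μ + G)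
     pair-count = begin
       # p * # p ≡⟨ sym (trans (∑-cong λ u → ∑-* (ι (p u)) (λ v → ι (p v))) (∑-*ʳ (# p) (λ u → ι (p u)))) ⟩
       ∑₂ (λ u v → ι (p u) * ι (p v)) ≡⟨ ∑₂-cong pointwise ⟩
       ∑₂ (λ u v → ι (sim u v) + (ι (gap u v) + ι (g u v))) ≡⟨ ∑₂-+ (λ u v → ι (sim u v)) (λ u v → ι (gap u v) + ι (g u v)) ⟩
       ∑ size + ∑₂ (λ u v → ι (gap u v) + ι (g u v)) ≡⟨ cong (_+_ (∑ size)) (∑₂-+ (λ u v → ι (gap u v)) (λ u v → ι (g u v))) ⟩
       ∑ size + (μ + G)                                              ∎
       where
       open ≡-Reasoning
       bools : ∀ a b s g → (s ≡ true → a ≡ true) → (s ≡ true → b ≡ true) → (g ≡ true → a ≡ true × b ≡ true) → (g ≡ true → s ≡ false) →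
         ι a * ι b ≡ ι s + (ι ((a ∧ (b ∧ not s)) ∧ not g) + ι g)
       bools false b     true  g     h₁ h₂ h₃ h₄ = true≢false (h₁ refl) refl
       bools true  false true  g     h₁ h₂ h₃ h₄ = true≢false (h₂ refl) refl
       bools true  true  true  true  h₁ h₂ h₃ h₄ = true≢false refl (h₄ refl)
       bools true  true  true  false h₁ h₂ h₃ h₄ = refl
       bools false b     false true  h₁ h₂ h₃ h₄ = true≢false (proj₁ (h₃ refl)) refl
       bools false b     false false h₁ h₂ h₃ h₄ = *-zeroˡ (ι b)
       bools true  false false true  h₁ h₂ h₃ h₄ = true≢false (proj₂ (h₃ refl)) refl
       bools true  false false false h₁ h₂ h₃ h₄ = refl
       bools true  true  false true  h₁ h₂ h₃ h₄ = refl
       bools true  true  false false h₁ h₂ h₃ h₄ = refl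
       pointwise : ∀ u v → ι (p u) * ι (p v) ≡ ι (sim u v) + (ι (gap u v) + ι (g u v))
       pointwise u v = bools (p u) (p v) (sim u v) (g u v) sim-p (λ s → sim-p (sim-sym s)) g-p g⇒≁

  -- Cancellative triple systems and regular vertices.

  infixl 6 _⊕<_
  _⊕<_ : ∀ {a b c d} → a < b → c ≤ d → a + c < b + d
  _⊕<_ = +-mono-<-≤

  -- The edges (e) and the shadow (g) of a cancellative 3-graph on Fin n; indep is cancellativity.
  record TripleSystem (n : ℕ) : Set where
    field
      e      : Fin n → Fin n → Fin n → Bool
      g      : Fin n → Fin n → Bool
      e-swap : ∀ {u v w} → e u v w ≡ true → e v u w ≡ true
      e-rot  : ∀ {u v w} → e u v w ≡ true → e v w u ≡ true
      g-sym  : ∀ {u v} → g u v ≡ true → g v u ≡ true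
      e⇒g    : ∀ {u v w} → e u v w ≡ true → g u v ≡ true
      indep  : ∀ {u v w w′} → e u v w ≡ true → e u v w′ ≡ true → g w w′ ≡ false

    e-swap₂₃ : ∀ {u v w} → e u v w ≡ true → e u w v ≡ true
    e-swap₂₃ h = e-swap (e-rot (e-rot h))

  module Pairs {n : ℕ} (H : TripleSystem n) (M c δ : ℤ) (0<M : 0ℤ < M) where

    open TripleSystem H public
    open Measure {n} M 0<M public

    non : Fin n → Fin n → Bool
    non u = ∁ (g u)

    off : Fin n → Fin n → Bool
    off u v = g u v ∧ does (∥ e u v ∥ <? c - δ)

  -- Sizes are scaled by M, and c stands for M n / k, so that ∥ P ∥ ≤ c + δ reads |P| ≤ n/k + δ/M.
  -- S is the set of exceptional vertices.
  record Regularity {n : ℕ} (H : TripleSystem n) : Set where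
    field
      M c δ : ℤ
      0<M   : 0ℤ < M
      0<δ   : 0ℤ < δ
    open Pairs H M c δ 0<M public
    field
      100δ≤c    : + 100 * δ ≤ c
      3c≤Mn     : + 3 * c ≤ M * + n
      S         : Fin n → Bool
      size-lo   : ∀ {u} → S u ≡ false → c - δ ≤ ∥ non u ∥
      size-hi   : ∀ {u} → S u ≡ false → ∥ non u ∥ ≤ c + δ
      off-small : ∀ {u} → S u ≡ false → ∥ off u ∥ ≤ δ
      S-small   : ∥ S ∥ ≤ δ

  -- Classes and blocks of a regular triple system.

  module Structure {n : ℕ} {H : TripleSystem n} (Reg : Regularity H) where

    open Regularity Reg public

    private
      0≤δ : 0ℤ ≤ δ
      0≤δ = <⇒≤ 0<δ

    heavy : ∀ {u v} → g u v ≡ true → off u v ≡ false → c - δ ≤ ∥ e u v ∥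
    heavy gt of rewrite gt = ≮⇒≥ (from-false (_ <? _) of)

    nbhd⊆non : ∀ {u v w} → e u v w ≡ true → e u v ⊆ non w
    nbhd⊆non h z h′ = not-intro (indep h h′)

    bad₁ : Fin n → Fin n → Bool
    bad₁ u = S ∪ off u

    bad₁-small : ∀ {u} → S u ≡ false → ∥ bad₁ u ∥ ≤ + 2 * δ
    bad₁-small {u} Su = ≤-trans (∥∥-∪ S (off u)) (≤-from (S-small ⊕ off-small Su) (lemma δ (∥ S ∥ + ∥ off u ∥)))
      where
      lemma : ∀ δ x → + 2 * δ - x ≡ δ + δ - x
      lemma = solve-∀

    bad₂ : Fin n → Fin n → Fin n → Bool
    bad₂ u v = bad₁ u ∪ off v

    bad₂-small : ∀ {u v} → S u ≡ false → S v ≡ false → ∥ bad₂ u v ∥ ≤ + 3 * δ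
    bad₂-small {u} {v} Su Sv = ≤-trans (∥∥-∪ (bad₁ u) (off v)) (≤-from (bad₁-small Su ⊕ off-small Sv) (lemma δ (∥ bad₁ u ∥ + ∥ off v ∥)))
      where
      lemma : ∀ δ x → + 3 * δ - x ≡ + 2 * δ + δ - x
      lemma = solve-∀

    bad₁-elim : ∀ {u z} → bad₁ u z ≡ false → S z ≡ false × off u z ≡ false
    bad₁-elim {u} {z} = ∪-elim (S z)

    bad₂-elim : ∀ {u v z} → bad₂ u v z ≡ false → S z ≡ false × off u z ≡ false × off v z ≡ false
    bad₂-elim {u} {v} {z} h with ∪-elim (bad₁ u z) h
    ... | h₁ , h₂ with bad₁-elim {u} h₁
    ... | h₃ , h₄ = h₃ , h₄ , h₂

    degree-lo : ∀ {u} → S u ≡ false → + 2 * c - δ ≤ ∥ g u ∥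
    degree-lo {u} Su = lemma₁ (∥ g u ∥) (∥ non u ∥) (M * + n) (∥∥-∁ (g u)) (size-hi Su) 3c≤Mn
      where
      lemma₀ : ∀ c δ d a → d - (+ 2 * c - δ) ≡ c + δ + (d + a) - (a + + 3 * c)
      lemma₀ = solve-∀
      lemma₁ : ∀ d a m → d + a ≡ m → a ≤ c + δ → + 3 * c ≤ m → + 2 * c - δ ≤ d
      lemma₁ d a _ refl h₁ h₂ = ≤-from (h₁ ⊕ h₂) (lemma₀ c δ d a)

    private
      margin : ∀ k → {_ : k ≤ + 100} → k * δ ≤ c
      margin k {k≤100} = ≤-trans (*-monoʳ-≤-nonNeg δ {{nonNegative 0≤δ}} k≤100) 100δ≤c

      small<degree : ∀ {b x} → b ≤ + 2 * δ → + 2 * c - δ ≤ x → b < x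
      small<degree {b} {x} h₁ h₂ = <-from (0<δ ⊕< (h₁ ⊕ h₂ ⊕ margin (+ 100) {≤-refl} ⊕ margin (+ 1) {+≤+ (ℕ.s≤s ℕ.z≤n)} ⊕ 97δ)) (lemma c δ b x)
        where
        97δ : 0ℤ ≤ + 97 * δ
        97δ = *-nonNeg {+ 97} 0≤+ 0≤δ
        lemma : ∀ c δ b x → x - b ≡ δ + (+ 2 * δ + x + c + c + + 97 * δ) - (0ℤ + (b + (+ 2 * c - δ) + + 100 * δ + + 1 * δ + 0ℤ))
        lemma = solve-∀

      small<heavy : ∀ {b x} → b ≤ + 3 * δ → c - δ ≤ x → b < x
      small<heavy {b} {x} h₁ h₂ = <-from (0<δ ⊕< (h₁ ⊕ h₂ ⊕ 100δ≤c ⊕ *-nonNeg {+ 95} 0≤+ 0≤δ)) (lemma c δ b x)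
        where
        lemma : ∀ c δ b x → x - b ≡ δ + (+ 3 * δ + x + c + + 95 * δ) - (0ℤ + (b + (c - δ) + + 100 * δ + 0ℤ))
        lemma = solve-∀

      widen : ∀ {b} → b ≤ + 2 * δ → b ≤ + 3 * δ
      widen {b} h = ≤-from (h ⊕ 0≤δ) (lemma δ b)
        where
        lemma : ∀ δ b → + 3 * δ - b ≡ + 2 * δ + δ - (b + 0ℤ)
        lemma = solve-∀

    opaque

      -- Supplies a set `N(uv)` that nearly fills `non w`. Unlike `non w`, it is known to lie in
      -- `non z` for every one of its own members `z`, and this makes comparisons between
      -- non-neighbourhoods possible.
      anchor : ∀ {w} → S w ≡ false → ∃₂ λ u v → e u v w ≡ true × c - δ ≤ ∥ e u v ∥
      anchor {w} Sw =
        let u , gwu , bu = pick₁ {g w} {bad₁ w} (small<degree (bad₁-small Sw) (degree-lo Sw))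
            Su , ou = bad₁-elim {w} bu
            v , ewuv , bv = pick₁ {e w u} {bad₁ u} (small<heavy (widen (bad₁-small Su)) (heavy gwu ou))
            Sv , ov = bad₁-elim {u} bv
            euvw = e-rot ewuv
        in u , v , euvw , heavy (e⇒g euvw) ov

    opaque

      -- The threshold one half is a convenient point in a gap: `overlap-lo` raises any overlap of
      -- `c/2` to almost all of `c`, and transitivity follows from this jump.
      sim : Fin n → Fin n → Bool
      sim u v = does (c ≤? + 2 * ∥ non u ∩ non v ∥)

      sim-intro : ∀ {u v} → c ≤ + 2 * ∥ non u ∩ non v ∥ → sim u v ≡ true
      sim-intro {u} {v} = does-true (c ≤? + 2 * ∥ non u ∩ non v ∥)

      sim-elim : ∀ {u v} → sim u v ≡ true → c ≤ + 2 * ∥ non u ∩ non v ∥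
      sim-elim {u} {v} = from-true (c ≤? + 2 * ∥ non u ∩ non v ∥)

    near : ∀ {u v w z} → c ≤ + 2 * ∥ e u v ∥ → e u v w ≡ true → e u v z ≡ true → sim w z ≡ true
    near {u} {v} {w} {z} big h h′ = sim-intro
      (≤-trans big (_⊗_ {+ 2} 0≤+ (∥∥-mono (λ i t → ∩-intro (nbhd⊆non h i t) (nbhd⊆non h′ i t)))))

    private
      heavy⇒half : ∀ {x} → c - δ ≤ x → c ≤ + 2 * x
      heavy⇒half {x} h = ≤-from (h ⊕ h ⊕ 100δ≤c ⊕ *-nonNeg {+ 98} 0≤+ 0≤δ) (lemma c δ x)
        where
        lemma : ∀ c δ x → + 2 * x - c ≡ x + x + c + + 98 * δ - ((c - δ) + (c - δ) + + 100 * δ + 0ℤ)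
        lemma = solve-∀

    -- The anchors of `w` and `w′` nearly fill two sets that overlap in half, so they share a vertex
    -- `z` outside `S`. Both anchors then lie in `non z`, which has barely room for one of them, so
    -- they nearly coincide.
    overlap-lo : ∀ {w w′} → S w ≡ false → S w′ ≡ false → sim w w′ ≡ true → c - + 3 * δ ≤ ∥ non w ∩ non w′ ∥
    overlap-lo {w} {w′} Sw Sw′ s =
      let u , v , h , big = anchor Sw
          u′ , v′ , h′ , big′ = anchor Sw′
          z , (hz , hz′) , Sz = pick₂ {e u v} {e u′ v′} {non w} {non w′} {S} (nbhd⊆non h) (nbhd⊆non h′)
            (room (size-hi Sw) (size-hi Sw′) S-small big big′ (sim-elim s))
      in enough big big′ (size-hi Sz) (intersect {e u v} {e u′ v′} {non z} (nbhd⊆non hz) (nbhd⊆non hz′))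
           (∥∥-mono {e u v ∩ e u′ v′} {non w ∩ non w′}
             (λ i t → let t₁ , t₂ = ∩-elim (e u v i) t in ∩-intro (nbhd⊆non h i t₁) (nbhd⊆non h′ i t₂)))
      where
      room : ∀ {a a′ b x x′ i} → a ≤ c + δ → a′ ≤ c + δ → b ≤ δ → c - δ ≤ x → c - δ ≤ x′ → c ≤ + 2 * i → a + a′ + b < x + x′ + i
      room {a} {a′} {b} {x} {x′} {i} h₁ h₂ h₃ h₄ h₅ h₆ = *-cancelˡ-<-nonNeg (+ 2)
        (<-from (0<δ ⊕< (_⊗_ {+ 2} 0≤+ (h₁ ⊕ h₂ ⊕ h₃ ⊕ h₄ ⊕ h₅) ⊕ h₆ ⊕ 100δ≤c ⊕ *-nonNeg {+ 89} 0≤+ 0≤δ)) (lemma c δ a a′ b x x′ i))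
        where
        lemma : ∀ c δ a a′ b x x′ i → + 2 * (x + x′ + i) - + 2 * (a + a′ + b) ≡
          δ + (+ 2 * ((c + δ) + (c + δ) + δ + x + x′) + + 2 * i + c + + 89 * δ)
            - (0ℤ + (+ 2 * (a + a′ + b + (c - δ) + (c - δ)) + c + + 100 * δ + 0ℤ))
        lemma = solve-∀
      enough : ∀ {x x′ a i j} → c - δ ≤ x → c - δ ≤ x′ → a ≤ c + δ → x + x′ ≤ a + i → i ≤ j → c - + 3 * δ ≤ j
      enough {x} {x′} {a} {i} {j} h₁ h₂ h₃ h₄ h₅ = ≤-from (h₁ ⊕ h₂ ⊕ h₃ ⊕ h₄ ⊕ h₅) (lemma c δ x x′ a i j)
        where
        lemma : ∀ c δ x x′ a i j → j - (c - + 3 * δ) ≡ x + x′ + (c + δ) + (a + i) + j - ((c - δ) + (c - δ) + a + (x + x′) + i)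
        lemma = solve-∀

    sim-refl : ∀ {w} → S w ≡ false → sim w w ≡ true
    sim-refl {w} Sw = sim-intro (heavy⇒half (≤-trans (size-lo Sw) (∥∥-mono {non w} {non w ∩ non w} (λ i t → ∩-intro t t))))

    sim-sym : ∀ {u v} → sim u v ≡ true → sim v u ≡ true
    sim-sym {u} {v} s = sim-intro (≤-trans (sim-elim s)
      (_⊗_ {+ 2} 0≤+ (∥∥-mono {non u ∩ non v} {non v ∩ non u} (λ i t → let t₁ , t₂ = ∩-elim (non u i) t in ∩-intro t₂ t₁))))

    sim-trans : ∀ {u v w} → S u ≡ false → S v ≡ false → S w ≡ false → sim u v ≡ true → sim v w ≡ true → sim u w ≡ true
    sim-trans {u} {v} {w} Su Sv Sw s s′ = sim-intro
      (half (overlap-lo Su Sv s) (overlap-lo Sv Sw s′) (size-hi Sv)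
        (intersect {non u ∩ non v} {non v ∩ non w} {non v} (λ i t → proj₂ (∩-elim (non u i) t)) (λ i t → proj₁ (∩-elim (non v i) t)))
        (∥∥-mono {(non u ∩ non v) ∩ (non v ∩ non w)} {non u ∩ non w}
          (λ i t → let t₁ , t₂ = ∩-elim (non u i ∧ non v i) t in ∩-intro (proj₁ (∩-elim (non u i) t₁)) (proj₂ (∩-elim (non v i) t₂)))))
      where
      half : ∀ {x x′ a i j} → c - + 3 * δ ≤ x → c - + 3 * δ ≤ x′ → a ≤ c + δ → x + x′ ≤ a + i → i ≤ j → c ≤ + 2 * j
      half {x} {x′} {a} {i} {j} h₁ h₂ h₃ h₄ h₅ =
        ≤-from (_⊗_ {+ 2} 0≤+ (h₁ ⊕ h₂ ⊕ h₃ ⊕ h₄ ⊕ h₅) ⊕ 100δ≤c ⊕ *-nonNeg {+ 86} 0≤+ 0≤δ) (lemma c δ x x′ a i j)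
        where
        lemma : ∀ c δ x x′ a i j → + 2 * j - c ≡
          + 2 * (x + x′ + (c + δ) + (a + i) + j) + c + + 86 * δ
            - (+ 2 * ((c - + 3 * δ) + (c - + 3 * δ) + a + (x + x′) + i) + + 100 * δ + 0ℤ)
        lemma = solve-∀

    -- An edge w w′ inside a class would make the two link neighbourhoods X = N(u w) and X′ = N(u w′)
    -- of a common neighbour u disjoint; but both nearly coincide with N(u w″) for a suitable w″ of the class.
    sim⇒nonadjacent : ∀ {w w′} → S w ≡ false → S w′ ≡ false → sim w w′ ≡ true → g w w′ ≡ false
    sim⇒nonadjacent {w} {w′} Sw Sw′ s = step₁
      (pick₂ {g w} {g w′} {λ _ → true} {λ _ → true} {bad₂ w w′} (λ _ _ → refl) (λ _ _ → refl)
        (common {d = ∥ g w ∥} {d′ = ∥ g w′ ∥} (bad₂-small Sw Sw′) (trans (∥∥-∁ (g w)) (sym full)) (trans (∥∥-∁ (g w′)) (sym full))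
          (size-hi Sw) (size-hi Sw′) (≤-trans 3c≤Mn (≤-reflexive (sym full)))))
      where
      full : ∥ (λ _ → true) ∥ ≡ M * + n
      full = trans (∥∥-def (λ _ → true)) (cong (M *_) (trans (∑-const n 1ℤ) (*-identityʳ (+ n))))
      common : ∀ {b t d d′ a a′} → b ≤ + 3 * δ → d + a ≡ t → d′ + a′ ≡ t → a ≤ c + δ → a′ ≤ c + δ → + 3 * c ≤ t → t + t + b < d + d′ + t
      common {b} {_} {d} {d′} {a} {a′} h₁ refl eq h₂ h₃ h₄ =
        <-from (0<δ ⊕< (h₁ ⊕ h₂ ⊕ h₃ ⊕ h₄ ⊕ ≤-reflexive (sym eq) ⊕ 100δ≤c ⊕ *-nonNeg {+ 94} 0≤+ 0≤δ)) (lemma c δ d d′ a a′ b)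
        where
        lemma : ∀ c δ d d′ a a′ b → d + d′ + (d + a) - ((d + a) + (d + a) + b) ≡
          δ + (+ 3 * δ + (c + δ) + (c + δ) + (d + a) + (d′ + a′) + c + + 94 * δ)
            - (0ℤ + (b + a + a′ + + 3 * c + (d + a) + + 100 * δ + 0ℤ))
        lemma = solve-∀
      room : ∀ {a a′ b x x′ i} → a ≤ c + δ → a′ ≤ c + δ → b ≤ δ → c - δ ≤ x → c - δ ≤ x′ → c - + 3 * δ ≤ i → a + a′ + b < x + x′ + i
      room {a} {a′} {b} {x} {x′} {i} h₁ h₂ h₃ h₄ h₅ h₆ =
        <-from (0<δ ⊕< (h₁ ⊕ h₂ ⊕ h₃ ⊕ h₄ ⊕ h₅ ⊕ h₆ ⊕ 100δ≤c ⊕ *-nonNeg {+ 91} 0≤+ 0≤δ)) (lemma c δ a a′ b x x′ i)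
        where
        lemma : ∀ c δ a a′ b x x′ i → x + x′ + i - (a + a′ + b) ≡
          δ + ((c + δ) + (c + δ) + δ + x + x′ + i + c + + 91 * δ)
            - (0ℤ + (a + a′ + b + (c - δ) + (c - δ) + (c - + 3 * δ) + + 100 * δ + 0ℤ))
        lemma = solve-∀
      room′ : ∀ {a a′ x x′ y} → a ≤ c + δ → a′ ≤ c + δ → c - δ ≤ x → c - δ ≤ x′ → c - δ ≤ y → a + a′ < x + x′ + y
      room′ {a} {a′} {x} {x′} {y} h₁ h₂ h₃ h₄ h₅ =
        <-from (0<δ ⊕< (h₁ ⊕ h₂ ⊕ h₃ ⊕ h₄ ⊕ h₅ ⊕ 100δ≤c ⊕ *-nonNeg {+ 94} 0≤+ 0≤δ)) (lemma c δ a a′ x x′ y)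
        where
        lemma : ∀ c δ a a′ x x′ y → x + x′ + y - (a + a′) ≡
          δ + ((c + δ) + (c + δ) + x + x′ + y + c + + 94 * δ)
            - (0ℤ + (a + a′ + (c - δ) + (c - δ) + (c - δ) + + 100 * δ + 0ℤ))
        lemma = solve-∀

      module Link {u} (Su : S u ≡ false) (X : c - δ ≤ ∥ e w u ∥) (X′ : c - δ ≤ ∥ e w′ u ∥) where

        step₄ : ∀ {z z′ w″} → S z ≡ false → S z′ ≡ false → e w u z ≡ true → e w′ u z′ ≡ true →
                e u z w″ ≡ true → e u z′ w″ ≡ true → off u w″ ≡ false → g w w′ ≡ false
        step₄ {z} {z′} {w″} Sz Sz′ hz hz′ h h′ o =
          -- `N(u w″)` lies in `non z` and in `non z′`, as do `N(w u)` and `N(w′ u)` respectively.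
          -- Three nearly full sets force `N(w u)` and `N(w′ u)` to meet, and the common `q` gives
          -- edges `u q w` and `u q w′`.
          let q , hq , hq′ = pick₃ {e w u} {e w′ u} {e u w″} {non z} {non z′}
                (nbhd⊆non hz) (nbhd⊆non (e-swap₂₃ h)) (nbhd⊆non hz′) (nbhd⊆non (e-swap₂₃ h′))
                (room′ (size-hi Sz) (size-hi Sz′) X X′ (heavy (e⇒g (e-swap₂₃ h)) o))
          in indep (e-rot hq) (e-rot hq′)

        step₃ : ∀ {z z′} → e w u z ≡ true → e w′ u z′ ≡ true → bad₁ u z ≡ false → bad₁ u z′ ≡ false → g w w′ ≡ false
        step₃ {z} {z′} hz hz′ bz bz′ =
          let Sz , oz = bad₁-elim {u} bz
              Sz′ , oz′ = bad₁-elim {u} bz′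
              -- `N(u z)` contains `w` and `N(u z′)` contains `w′`, so they nearly fill `non w` and
              -- `non w′`, which overlap almost entirely by `overlap-lo`.
              w″ , (h , h′) , o = pick₂ {e u z} {e u z′} {non w} {non w′} {off u} (nbhd⊆non (e-rot hz)) (nbhd⊆non (e-rot hz′))
                (room (size-hi Sw) (size-hi Sw′) (off-small Su) (heavy (e⇒g (e-rot hz)) oz) (heavy (e⇒g (e-rot hz′)) oz′)
                  (overlap-lo Sw Sw′ s))
          in step₄ Sz Sz′ hz hz′ h h′ o

        step₂ : g w w′ ≡ false
        step₂ =
          let z , hz , bz = pick₁ {e w u} {bad₁ u} (small<heavy (widen (bad₁-small Su)) X)
              z′ , hz′ , bz′ = pick₁ {e w′ u} {bad₁ u} (small<heavy (widen (bad₁-small Su)) X′)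
          in step₃ hz hz′ bz bz′

      step₁ : (∃ λ u → (g w u ≡ true × g w′ u ≡ true) × bad₂ w w′ u ≡ false) → g w w′ ≡ false
      step₁ (u , (gwu , gw′u) , bu) =
        let Su , ou , ou′ = bad₂-elim {w} {w′} bu in Link.step₂ Su (heavy gwu ou) (heavy gw′u ou′)

    cls : Fin n → Fin n → Bool
    cls w z = not (S z) ∧ sim w z

    cls⊆non : ∀ {w} → S w ≡ false → cls w ⊆ non w
    cls⊆non {w} Sw z h = let t , s = ∩-elim (not (S z)) h in not-intro (sim⇒nonadjacent Sw (not-elim t) s)

    cls-hi : ∀ {w} → S w ≡ false → ∥ cls w ∥ ≤ c + δ
    cls-hi {w} Sw = ≤-trans (∥∥-mono (cls⊆non Sw)) (size-hi Sw)

    -- All members of an anchor of `w` are similar to `w` by `near`, so up to `S` the class contains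
    -- a whole anchor.
    cls-lo : ∀ {w} → S w ≡ false → c - + 2 * δ ≤ ∥ cls w ∥
    cls-lo {w} Sw =
      let u , v , h , big = anchor Sw
      in trim big S-small (≤-trans (∥∥-mono {e u v} {cls w ∪ S} (inside h big)) (∥∥-∪ (cls w) S))
      where
      inside : ∀ {u v} → e u v w ≡ true → c - δ ≤ ∥ e u v ∥ → e u v ⊆ (cls w ∪ S)
      inside h big z hz with S z
      ... | true  = refl
      ... | false = trans (∨-identityʳ _) (near (heavy⇒half big) h hz)
      trim : ∀ {x b y} → c - δ ≤ x → b ≤ δ → x ≤ y + b → c - + 2 * δ ≤ y
      trim {x} {b} {y} h₁ h₂ h₃ = ≤-from (h₁ ⊕ h₂ ⊕ h₃) (lemma c δ x b y)
        where
        lemma : ∀ c δ x b y → y - (c - + 2 * δ) ≡ x + δ + (y + b) - ((c - δ) + b + x)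
        lemma = solve-∀

    miss : Fin n → Fin n → Bool
    miss w z = (not (S z) ∧ not (sim w z)) ∧ non w z

    -- The class of `w` already occupies nearly all of `non w`, which leaves little room for
    -- non-neighbours in other classes.
    miss-small : ∀ {w} → S w ≡ false → ∥ miss w ∥ ≤ + 3 * δ
    miss-small {w} Sw = remainder (cls-lo Sw) (size-hi Sw) disjoint
      where
      contained : (cls w ∪ miss w) ⊆ non w
      contained z h with S z in Sz | sim w z in s | h
      ... | false | true  | _  = not-intro (sim⇒nonadjacent Sw Sz s)
      ... | false | false | h′ = h′
      disjoint : ∥ cls w ∥ + ∥ miss w ∥ ≤ ∥ non w ∥
      disjoint = ≤-trans (∥∥-disjoint (cls w) (miss w) (λ z → apart (S z) (sim w z) (non w z)))
        (∥∥-mono contained)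
        where
        apart : ∀ s t r → (not s ∧ t) ≡ true → ((not s ∧ not t) ∧ r) ≡ false
        apart false true r _ = refl
      remainder : ∀ {x y a} → c - + 2 * δ ≤ x → a ≤ c + δ → x + y ≤ a → y ≤ + 3 * δ
      remainder {x} {y} {a} h₁ h₂ h₃ = ≤-from (h₁ ⊕ h₂ ⊕ h₃) (lemma c δ x y a)
        where
        lemma : ∀ c δ x y a → + 3 * δ - y ≡ x + (c + δ) + a - ((c - + 2 * δ) + a + (x + y))
        lemma = solve-∀

    GoodEdge : Fin n → Fin n → Fin n → Set
    GoodEdge u v w = (S u ≡ false × S v ≡ false × S w ≡ false) × e u v w ≡ true ×
      c - δ ≤ ∥ e u v ∥ × c - δ ≤ ∥ e u w ∥ × c - δ ≤ ∥ e v w ∥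

    -- One edge with three heavy pairs is taken as a witness for a triple of classes. Heaviness of
    -- all pairs keeps the notion symmetric and lets `Block-linear` compare witnesses with different
    -- representatives.
    Block : Fin n → Fin n → Fin n → Set
    Block u v w = ∃ λ u′ → ∃ λ v′ → ∃ λ w′ → GoodEdge u′ v′ w′ × sim u u′ ≡ true × sim v v′ ≡ true × sim w w′ ≡ true

    block? : ∀ u v w → Dec (Block u v w)
    block? u v w = any? λ u′ → any? λ v′ → any? λ w′ →
      ((S u′ Bool.≟ false ×-dec S v′ Bool.≟ false ×-dec S w′ Bool.≟ false) ×-dec e u′ v′ w′ Bool.≟ true ×-dec
        c - δ ≤? ∥ e u′ v′ ∥ ×-dec c - δ ≤? ∥ e u′ w′ ∥ ×-dec c - δ ≤? ∥ e v′ w′ ∥) ×-dec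
      sim u u′ Bool.≟ true ×-dec sim v v′ Bool.≟ true ×-dec sim w w′ Bool.≟ true

    opaque

      block : Fin n → Fin n → Fin n → Bool
      block u v w = does (block? u v w)

      block-intro : ∀ {u v w} → Block u v w → block u v w ≡ true
      block-intro {u} {v} {w} = does-true (block? u v w)

      block-elim : ∀ {u v w} → block u v w ≡ true → Block u v w
      block-elim {u} {v} {w} = from-true (block? u v w)

    heavy-swap : ∀ {u v} → c - δ ≤ ∥ e u v ∥ → c - δ ≤ ∥ e v u ∥
    heavy-swap {u} {v} h = ≤-trans h (∥∥-mono {e u v} {e v u} (λ _ → e-swap))

    Block-swap : ∀ {u v w} → Block u v w → Block v u w
    Block-swap (u′ , v′ , w′ , ((Su , Sv , Sw) , h , h₁ , h₂ , h₃) , s , t , r) =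
      v′ , u′ , w′ , ((Sv , Su , Sw) , e-swap h , heavy-swap h₁ , h₃ , h₂) , t , s , r

    Block-swap₂₃ : ∀ {u v w} → Block u v w → Block u w v
    Block-swap₂₃ (u′ , v′ , w′ , ((Su , Sv , Sw) , h , h₁ , h₂ , h₃) , s , t , r) =
      u′ , w′ , v′ , ((Su , Sw , Sv) , e-swap₂₃ h , h₂ , h₁ , heavy-swap h₃) , s , r , t

    Block-resp : ∀ {u v w w₁} → S w ≡ false → S w₁ ≡ false → sim w w₁ ≡ true → Block u v w → Block u v w₁
    Block-resp {u} {v} {w} {w₁} Sw Sw₁ s₁ (u′ , v′ , w′ , ((Su , Sv , Sw′) , h) , s , t , r) =
      u′ , v′ , w′ , ((Su , Sv , Sw′) , h) , s , t , sim-trans Sw₁ Sw Sw′ (sim-sym s₁) r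

    Block⇒≁ : ∀ {u v w} → S u ≡ false → S v ≡ false → Block u v w → sim u v ≡ false
    Block⇒≁ Su Sv (u′ , v′ , w′ , ((Su′ , Sv′ , Sw′) , h , _) , s , t , r) = ≢true λ uv →
      true≢false (e⇒g h) (sim⇒nonadjacent Su′ Sv′ (sim-trans Su′ Su Sv′ (sim-sym s) (sim-trans Su Sv Sv′ uv t)))

    -- The edge itself may have light pairs, so it is moved within the classes. First `w` is
    -- replaced by `w′` in `N(uv)` with `u w′` heavy, then `v` by `v′` in `N(u w′)` with the other
    -- pairs heavy. By `near`, two members of a set `N(..)` of at least half the typical size are
    -- similar, so no class changes.
    Block-extend : ∀ {u v w} → S u ≡ false → S v ≡ false → S w ≡ false → e u v w ≡ true → c ≤ + 2 * ∥ e u v ∥ → Block u v w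
    Block-extend {u} {v} {w} Su Sv Sw h big =
      let w′ , hw′ , bw′ = pick₁ {e u v} {bad₂ u v} (small<half (bad₂-small Su Sv) big)
          Sw′ , ouw′ , ovw′ = bad₂-elim {u} {v} bw′
      in second hw′ Sw′ (heavy (e⇒g (e-swap₂₃ hw′)) ouw′)
      where
      small<half : ∀ {b x} → b ≤ + 3 * δ → c ≤ + 2 * x → b < x
      small<half {b} {x} h₁ h₂ = *-cancelˡ-<-nonNeg (+ 2)
        (<-from (0<δ ⊕< (_⊗_ {+ 2} 0≤+ h₁ ⊕ h₂ ⊕ 100δ≤c ⊕ *-nonNeg {+ 93} 0≤+ 0≤δ)) (lemma c δ b x))
        where
        lemma : ∀ c δ b x → + 2 * x - + 2 * b ≡ δ + (+ 2 * (+ 3 * δ) + + 2 * x + c + + 93 * δ) - (0ℤ + (+ 2 * b + c + + 100 * δ + 0ℤ))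
        lemma = solve-∀
      second : ∀ {w′} → e u v w′ ≡ true → S w′ ≡ false → c - δ ≤ ∥ e u w′ ∥ → Block u v w
      second {w′} hw′ Sw′ uw′ =
        let v′ , hv′ , bv′ = pick₁ {e u w′} {bad₂ u w′} (small<heavy (bad₂-small Su Sw′) uw′)
            Sv′ , ouv′ , ow′v′ = bad₂-elim {u} {w′} bv′
        in u , v′ , w′ , ((Su , Sv′ , Sw′) , e-swap₂₃ hv′ , heavy (e⇒g (e-swap₂₃ hv′)) ouv′ , uw′ ,
               heavy-swap (heavy (e⇒g (e-rot hv′)) ow′v′)) ,
             sim-refl Su , near (heavy⇒half uw′) (e-swap₂₃ hw′) hv′ , near big h hw′

    opaque

      -- The class of `v` is too large to be covered by the vertices missed by `u` or joined to it
      -- by a thin pair, so some `v′` in it forms a heavy pair with `u`. Any regular third vertex of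
      -- an edge on that pair gives the block.
      Block-full : ∀ {u v} → S u ≡ false → S v ≡ false → sim u v ≡ false → ∃ λ w → S w ≡ false × Block u v w
      Block-full {u} {v} Su Sv s =
        let v′ , hv′ , bv′ = pick₁ {cls v} {off u ∪ miss u} (small<cls
              (≤-trans (∥∥-∪ (off u) (miss u)) (off-small Su ⊕ miss-small Su)) (cls-lo Sv))
            Sv′ , vv′ = ∩-elim (not (S v′)) hv′
            o , m = ∪-elim (off u v′) bv′
        in first (not-elim Sv′) vv′ o m
        where
        small<cls : ∀ {b x} → b ≤ δ + + 3 * δ → c - + 2 * δ ≤ x → b < x
        small<cls {b} {x} h₁ h₂ = <-from (0<δ ⊕< (h₁ ⊕ h₂ ⊕ 100δ≤c ⊕ *-nonNeg {+ 93} 0≤+ 0≤δ)) (lemma c δ b x)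
          where
          lemma : ∀ c δ b x → x - b ≡ δ + (δ + + 3 * δ + x + c + + 93 * δ) - (0ℤ + (b + (c - + 2 * δ) + + 100 * δ + 0ℤ))
          lemma = solve-∀
        first : ∀ {v′} → S v′ ≡ false → sim v v′ ≡ true → off u v′ ≡ false → miss u v′ ≡ false → ∃ λ w → S w ≡ false × Block u v w
        first {v′} Sv′ vv′ o m =
          let w , hw , bw = pick₁ {e u v′} {bad₁ u} (small<heavy (widen (bad₁-small Su)) uv′)
              Sw , _ = bad₁-elim {u} bw
          in w , Sw , Block-swap₂₃ (Block-resp Sv′ Sv (sim-sym vv′) (Block-swap₂₃ (Block-extend Su Sv′ Sw hw (heavy⇒half uv′))))
          where
          uv≁ : sim u v′ ≡ false
          uv≁ = ≢true λ t → true≢false (sim-trans Su Sv′ Sv t (sim-sym vv′)) s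
          adjacent : g u v′ ≡ true
          adjacent = ≢false λ t → true≢false (∩-intro (∩-intro (not-intro Sv′) (not-intro uv≁)) (not-intro t)) m
          uv′ : c - δ ≤ ∥ e u v′ ∥
          uv′ = heavy adjacent o

    -- Two transfers. `N(u₁x₁)` and `N(u₂x₂)` nearly fill `non v₁` and `non v₂`, hence share some
    -- `y`. Then `N(x₁y)` and `N(x₂y)` nearly fill `non u₁` and `non u₂`, hence share some `q` with
    -- `y q` heavy. Now `x₁` and `x₂` both belong to `N(yq)`, and `near` applies.
    Block-linear : ∀ {u v w₁ w₂} → S u ≡ false → S v ≡ false → S w₁ ≡ false → S w₂ ≡ false →
                   Block u v w₁ → Block u v w₂ → sim w₁ w₂ ≡ true
    Block-linear {u} {v} Su Sv Sw₁ Sw₂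
      (u₁ , v₁ , x₁ , ((Su₁ , Sv₁ , Sx₁) , h₁ , _ , u₁x₁ , _) , uu₁ , vv₁ , wx₁)
      (u₂ , v₂ , x₂ , ((Su₂ , Sv₂ , Sx₂) , h₂ , _ , u₂x₂ , _) , uu₂ , vv₂ , wx₂) =
      let y , (hy₁ , hy₂) , by = pick₂ {e u₁ x₁} {e u₂ x₂} {non v₁} {non v₂} {bad₂ x₁ x₂}
            (nbhd⊆non (e-swap₂₃ h₁)) (nbhd⊆non (e-swap₂₃ h₂))
            (room (size-hi Sv₁) (size-hi Sv₂) (bad₂-small Sx₁ Sx₂) u₁x₁ u₂x₂ (overlap-lo Sv₁ Sv₂ v₁v₂))
          Sy , o₁ , o₂ = bad₂-elim {x₁} {x₂} by
      in sim-trans Sw₁ Sx₁ Sw₂ wx₁ (sim-trans Sx₁ Sx₂ Sw₂ (middle Sy hy₁ hy₂ o₁ o₂) (sim-sym wx₂))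
      where
      u₁u₂ = sim-trans Su₁ Su Su₂ (sim-sym uu₁) uu₂
      v₁v₂ = sim-trans Sv₁ Sv Sv₂ (sim-sym vv₁) vv₂
      room : ∀ {a a′ b x x′ i} → a ≤ c + δ → a′ ≤ c + δ → b ≤ + 3 * δ → c - δ ≤ x → c - δ ≤ x′ → c - + 3 * δ ≤ i → a + a′ + b < x + x′ + i
      room {a} {a′} {b} {x} {x′} {i} h₁ h₂ h₃ h₄ h₅ h₆ =
        <-from (0<δ ⊕< (h₁ ⊕ h₂ ⊕ h₃ ⊕ h₄ ⊕ h₅ ⊕ h₆ ⊕ 100δ≤c ⊕ *-nonNeg {+ 89} 0≤+ 0≤δ)) (lemma c δ a a′ b x x′ i)
        where
        lemma : ∀ c δ a a′ b x x′ i → x + x′ + i - (a + a′ + b) ≡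
          δ + ((c + δ) + (c + δ) + + 3 * δ + x + x′ + i + c + + 89 * δ)
            - (0ℤ + (a + a′ + b + (c - δ) + (c - δ) + (c - + 3 * δ) + + 100 * δ + 0ℤ))
        lemma = solve-∀
      room′ : ∀ {b} → b ≤ δ → b ≤ + 3 * δ
      room′ {b} h = ≤-from (h ⊕ *-nonNeg {+ 2} 0≤+ 0≤δ) (lemma δ b)
        where
        lemma : ∀ δ b → + 3 * δ - b ≡ δ + + 2 * δ - (b + 0ℤ)
        lemma = solve-∀
      middle : ∀ {y} → S y ≡ false → e u₁ x₁ y ≡ true → e u₂ x₂ y ≡ true → off x₁ y ≡ false → off x₂ y ≡ false → sim x₁ x₂ ≡ true
      middle {y} Sy hy₁ hy₂ o₁ o₂ =
        let q , (hq₁ , hq₂) , o = pick₂ {e x₁ y} {e x₂ y} {non u₁} {non u₂} {off y} (nbhd⊆non (e-rot hy₁))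
              (nbhd⊆non (e-rot hy₂))
              (room (size-hi Su₁) (size-hi Su₂) (room′ (off-small Sy)) (heavy (e⇒g (e-rot hy₁)) o₁) (heavy (e⇒g (e-rot hy₂)) o₂) (overlap-lo Su₁ Su₂ u₁u₂))
        in near (heavy⇒half (heavy (e⇒g (e-rot hq₁)) o)) (e-rot hq₁) (e-rot hq₂)

  -- The block structure and the edge count on the regular vertices.

  module Assembly {n : ℕ} {H : TripleSystem n} (Reg : Regularity H) where

    open Structure Reg

    good : Fin n → Bool
    good = ∁ S

    private
      goodˢ : ∀ {u} → good u ≡ true → S u ≡ false
      goodˢ = not-elim

      unfold₂ : ∀ {a b x} → a ∧ (b ∧ x) ≡ true → a ≡ true × b ≡ true × x ≡ true
      unfold₂ {true} {true} h = refl , refl , h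

      unfold₃ : ∀ {a b d x} → a ∧ (b ∧ (d ∧ x)) ≡ true → a ≡ true × b ≡ true × d ≡ true × x ≡ true
      unfold₃ {true} {true} {true} h = refl , refl , refl , h

      fold₂ : ∀ {a b x} → a ≡ true → b ≡ true → x ≡ true → a ∧ (b ∧ x) ≡ true
      fold₂ refl refl refl = refl

      fold₃ : ∀ {a b d x} → a ≡ true → b ≡ true → d ≡ true → x ≡ true → a ∧ (b ∧ (d ∧ x)) ≡ true
      fold₃ refl refl refl refl = refl

    -- `lowᵍ` uses the threshold `c/2` rather than the `c - δ` of `off`: codegree `c/2` is enough
    -- for `Block-extend`, and pairs below it lose so many edges that they need no precise count.
    simᵍ gᵍ lowᵍ : Fin n → Fin n → Bool
    simᵍ u v = good u ∧ (good v ∧ sim u v)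
    gᵍ u v = good u ∧ (good v ∧ g u v)
    lowᵍ u v = gᵍ u v ∧ does (+ 2 * ∥ e u v ∥ <? c)

    eᵍ Tᵍ : Fin n → Fin n → Fin n → Bool
    eᵍ u v w = good u ∧ (good v ∧ (good w ∧ e u v w))
    Tᵍ u v w = good u ∧ (good v ∧ (good w ∧ block u v w))

    private
      T-elim : ∀ {u v w} → Tᵍ u v w ≡ true → good u ≡ true × good v ≡ true × good w ≡ true × Block u v w
      T-elim {u} {v} {w} t with unfold₃ {good u} {good v} {good w} t
      ... | gu , gv , gw , b = gu , gv , gw , block-elim b

      T-intro : ∀ {u v w} → good u ≡ true → good v ≡ true → good w ≡ true → Block u v w → Tᵍ u v w ≡ true
      T-intro {u} {v} {w} gu gv gw b = fold₃ gu gv gw (block-intro b)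

      sim-elimᵍ : ∀ {u v} → simᵍ u v ≡ true → good u ≡ true × good v ≡ true × sim u v ≡ true
      sim-elimᵍ {u} {v} = unfold₂ {good u} {good v}

      simᵍ-false : ∀ {u v} → good u ≡ true → good v ≡ true → simᵍ u v ≡ false → sim u v ≡ false
      simᵍ-false {u} {v} gu gv h rewrite gu | gv = h

    private
      simᵍ-sym : ∀ {u v} → simᵍ u v ≡ true → simᵍ v u ≡ true
      simᵍ-sym {u} {v} s with sim-elimᵍ {u} {v} s
      ... | gu , gv , t = fold₂ gv gu (sim-sym t)

      simᵍ-trans : ∀ {u v w} → simᵍ u v ≡ true → simᵍ v w ≡ true → simᵍ u w ≡ true
      simᵍ-trans {u} {v} {w} s s′ with sim-elimᵍ {u} {v} s | sim-elimᵍ {v} {w} s′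
      ... | gu , gv , t | _ , gw , t′ = fold₂ gu gw (sim-trans (goodˢ gu) (goodˢ gv) (goodˢ gw) t t′)

      T-swap : ∀ {u v w} → Tᵍ u v w ≡ true → Tᵍ v u w ≡ true
      T-swap {u} {v} {w} t with T-elim {u} {v} {w} t
      ... | gu , gv , gw , b = T-intro gv gu gw (Block-swap b)

      T-swap₂₃ : ∀ {u v w} → Tᵍ u v w ≡ true → Tᵍ u w v ≡ true
      T-swap₂₃ {u} {v} {w} t with T-elim {u} {v} {w} t
      ... | gu , gv , gw , b = T-intro gu gw gv (Block-swap₂₃ b)

      T-resp : ∀ {u v w w′} → simᵍ w w′ ≡ true → Tᵍ u v w ≡ true → Tᵍ u v w′ ≡ true
      T-resp {u} {v} {w} {w′} s t with T-elim {u} {v} {w} t | sim-elimᵍ {w} {w′} s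
      ... | gu , gv , gw , b | _ , gw′ , s′ = T-intro gu gv gw′ (Block-resp (goodˢ gw) (goodˢ gw′) s′ b)

      T⇒≁ : ∀ {u v w} → Tᵍ u v w ≡ true → simᵍ u v ≡ false
      T⇒≁ {u} {v} {w} t with T-elim {u} {v} {w} t
      ... | gu , gv , _ , b = ≢true λ s → true≢false (proj₂ (proj₂ (sim-elimᵍ {u} {v} s))) (Block⇒≁ (goodˢ gu) (goodˢ gv) b)

      T-linear : ∀ {u v w w′} → Tᵍ u v w ≡ true → Tᵍ u v w′ ≡ true → simᵍ w w′ ≡ true
      T-linear {u} {v} {w} {w′} t t′ with T-elim {u} {v} {w} t | T-elim {u} {v} {w′} t′
      ... | gu , gv , gw , b | _ , _ , gw′ , b′ = fold₂ gw gw′ (Block-linear (goodˢ gu) (goodˢ gv) (goodˢ gw) (goodˢ gw′) b b′)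

      T-full : ∀ {u v} → good u ≡ true → good v ≡ true → simᵍ u v ≡ false → ∃ λ w → Tᵍ u v w ≡ true
      T-full {u} {v} gu gv s with Block-full (goodˢ gu) (goodˢ gv) (simᵍ-false gu gv s)
      ... | w , Sw , b = w , T-intro gu gv (not-intro Sw) b

    blocks : BlockStructure n
    blocks = record
      { p = good
      ; sim = simᵍ
      ; sim-p = λ {u} {v} s → proj₁ (sim-elimᵍ {u} {v} s)
      ; sim-refl = λ gu → fold₂ gu gu (sim-refl (goodˢ gu))
      ; sim-sym = simᵍ-sym
      ; sim-trans = simᵍ-trans
      ; T = Tᵍ
      ; T-p = λ {u} {v} {w} t → proj₁ (proj₂ (proj₂ (T-elim {u} {v} {w} t)))
      ; T-swap = T-swap
      ; T-swap₂₃ = T-swap₂₃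
      ; T-resp = T-resp
      ; T⇒≁ = T⇒≁
      ; T-linear = T-linear
      ; T-full = T-full
      }

    open Blocks blocks using (size; rep; R; R-mono; R-*; R-constant; R-sizes≡#p; T-total; module Balance)

    size≡ : ∀ {u} → good u ≡ true → ∥ cls u ∥ ≡ M * size u
    size≡ {u} gu = trans (∥∥-def (cls u)) (cong (M *_) (∑-cong λ v → cong (λ b → ι (b ∧ (good v ∧ sim u v))) (sym gu)))

    size-bounds : ∀ {u} → good u ≡ true → c - + 2 * δ ≤ M * size u × M * size u ≤ c + δ
    size-bounds gu = ≤-trans (cls-lo (goodˢ gu)) (≤-reflexive (size≡ gu)) , ≤-trans (≤-reflexive (sym (size≡ gu))) (cls-hi (goodˢ gu))

    private
      0≤δ : 0ℤ ≤ δ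
      0≤δ = <⇒≤ 0<δ

      16δ≤c : + 16 * δ ≤ c
      16δ≤c = ≤-from (100δ≤c ⊕ *-nonNeg {+ 84} 0≤+ 0≤δ) (lemma c δ)
        where
        lemma : ∀ c δ → c - + 16 * δ ≡ c + + 84 * δ - (+ 100 * δ + 0ℤ)
        lemma = solve-∀

      low-elim : ∀ {u v} → lowᵍ u v ≡ true → gᵍ u v ≡ true × + 2 * ∥ e u v ∥ < c
      low-elim {u} {v} h with ∩-elim (gᵍ u v) h
      ... | h₁ , h₂ = h₁ , from-true (_ <? c) h₂

      g-elimᵍ : ∀ {u v} → gᵍ u v ≡ true → good u ≡ true × good v ≡ true × g u v ≡ true
      g-elimᵍ {u} {v} = unfold₂ {good u} {good v}

      e-elimᵍ : ∀ {u v w} → eᵍ u v w ≡ true → good u ≡ true × good v ≡ true × good w ≡ true × e u v w ≡ true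
      e-elimᵍ {u} {v} {w} = unfold₃ {good u} {good v} {good w}

      low⊆off : ∀ u → lowᵍ u ⊆ off u
      low⊆off u v h =
        let gv , lt = low-elim h ; _ , _ , gv′ = g-elimᵍ gv
        in ∩-intro gv′ (does-true (_ <? _) (light (∥ e u v ∥) lt))
        where
        light : ∀ x → + 2 * x < c → x < c - δ
        light x lt = *-cancelˡ-<-nonNeg (+ 2) (<-from (lt ⊕< (16δ≤c ⊕ *-nonNeg {+ 14} 0≤+ 0≤δ)) (lemma c δ x))
          where
          lemma : ∀ c δ x → + 2 * (c - δ) - + 2 * x ≡ c + (c + + 14 * δ) - (+ 2 * x + (+ 16 * δ + 0ℤ))
          lemma = solve-∀

      low-light : ∀ {u v} → lowᵍ u v ≡ true → + 2 * (M * # (eᵍ u v)) ≤ c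
      low-light {u} {v} h = ≤-trans (_⊗_ {+ 2} 0≤+ (≤-trans (≤-reflexive (sym (∥∥-def (eᵍ u v))))
          (∥∥-mono {eᵍ u v} {e u v} (λ w t → let _ , _ , _ , t′ = e-elimᵍ t in t′))))
        (<⇒≤ (proj₂ (low-elim h)))

      coverᵍ : ∀ {u v w} → eᵍ u v w ≡ true → lowᵍ u v ≡ false → Tᵍ u v w ≡ true
      coverᵍ {u} {v} {w} h l =
        let gu , gv , gw , t = e-elimᵍ h
        in T-intro gu gv gw (Block-extend (goodˢ gu) (goodˢ gv) (goodˢ gw) t
             (≮⇒≥ λ lt → true≢false (∩-intro (fold₂ gu gv (e⇒g t)) (does-true (_ <? c) lt)) l))

      gap-smallᵍ : ∀ {u} → good u ≡ true → M * # (λ v → (good v ∧ not (simᵍ u v)) ∧ not (gᵍ u v)) ≤ + 3 * δ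
      gap-smallᵍ {u} gu = ≤-trans (≤-trans (≤-reflexive (sym (∥∥-def _))) (∥∥-mono {Q = miss u} contained)) (miss-small (goodˢ gu))
        where
        contained : (λ v → (good v ∧ not (simᵍ u v)) ∧ not (gᵍ u v)) ⊆ miss u
        contained v h rewrite gu with S v | h
        ... | false | h′ = h′

      low-smallᵍ : ∀ {u} → good u ≡ true → M * # (lowᵍ u) ≤ δ
      low-smallᵍ {u} gu = ≤-trans (≤-trans (≤-reflexive (sym (∥∥-def (lowᵍ u)))) (∥∥-mono (low⊆off u))) (off-small (goodˢ gu))

      e-swapᵍ : ∀ {u v w} → eᵍ u v w ≡ true → eᵍ u w v ≡ true
      e-swapᵍ {u} {v} {w} h = let gu , gv , gw , t = e-elimᵍ {u} {v} {w} h in fold₃ gu gw gv (e-swap₂₃ t)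

      e⇒gᵍ : ∀ {u v w} → eᵍ u v w ≡ true → gᵍ u v ≡ true
      e⇒gᵍ {u} {v} {w} h = let gu , gv , _ , t = e-elimᵍ {u} {v} {w} h in fold₂ gu gv (e⇒g t)

      g-goodᵍ : ∀ {u v} → gᵍ u v ≡ true → good u ≡ true × good v ≡ true
      g-goodᵍ {u} {v} h = let gu , gv , _ = g-elimᵍ {u} {v} h in gu , gv

      g⇒≁ᵍ : ∀ {u v} → gᵍ u v ≡ true → simᵍ u v ≡ false
      g⇒≁ᵍ {u} {v} h = let gu , gv , t = g-elimᵍ {u} {v} h
                       in ≢true λ s → true≢false t (sim⇒nonadjacent (goodˢ gu) (goodˢ gv) (proj₂ (proj₂ (sim-elimᵍ {u} {v} s))))

      low⇒gᵍ : ∀ {u v} → lowᵍ u v ≡ true → gᵍ u v ≡ true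
      low⇒gᵍ {u} {v} h = proj₁ (low-elim {u} {v} h)

      size-loᵍ : ∀ {u} → good u ≡ true → c - + 2 * δ ≤ M * # (simᵍ u)
      size-loᵍ gu = proj₁ (size-bounds gu)

    open BlockEdges.EdgeCount blocks eᵍ gᵍ lowᵍ M c δ (<⇒≤ 0<M) 0≤δ 16δ≤c
      e-swapᵍ e⇒gᵍ g-goodᵍ g⇒≁ᵍ low⇒gᵍ low-light coverᵍ size-loᵍ gap-smallᵍ low-smallᵍ
      public using (E; G; μ; edge-bound; pair-count)

    module WithClasses (k L : ℤ) (2≤k : + 2 ≤ k) (0<L : 0ℤ < L) (M≡kL : M ≡ k * L) (c≡Ln : c ≡ L * + n) (δ≡n : δ ≡ + n) (8kδ≤c : + 8 * k * δ ≤ c) where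

      N : ℤ
      N = # good

      private
        b : ℤ
        b = # S

        m : ℤ
        m = # rep

        N+b≡n : N + b ≡ + n
        N+b≡n = trans (+-comm N b) (#-∁ S)

        0≤L : 0ℤ ≤ L
        0≤L = <⇒≤ 0<L

        kLb≤δ : k * L * b ≤ δ
        kLb≤δ = ≤-trans (≤-reflexive (trans (cong (_* b) (sym M≡kL)) (sym (∥∥-def S)))) S-small

        Lb≤δ : L * b ≤ δ
        Lb≤δ = ≤-trans (≤-from (*-nonNeg 0≤L (0≤# S) ⊕ (*-nonNeg 0≤L (0≤# S) ⊗ 2≤k)) (lemma k L b)) kLb≤δ
          where
          lemma : ∀ k L b → k * L * b - L * b ≡ L * b + L * b * k - (0ℤ + L * b * + 2)
          lemma = solve-∀

        MN-upper : M * N ≤ (c + δ) * m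
        MN-upper = subst₂ _≤_ (trans (R-* M size) (cong (M *_) R-sizes≡#p)) (R-constant (c + δ)) (R-mono λ gu → proj₂ (size-bounds gu))

        MN-lower : (c - + 2 * δ) * m ≤ M * N
        MN-lower = subst₂ _≤_ (R-constant (c - + 2 * δ)) (trans (R-* M size) (cong (M *_) R-sizes≡#p)) (R-mono λ gu → proj₁ (size-bounds gu))

        LN : L * N ≡ c - L * b
        LN = trans (lemma L N b) (cong (λ x → x - L * b) (trans (cong (L *_) N+b≡n) (sym c≡Ln)))
          where
          lemma : ∀ L N b → L * N ≡ L * (N + b) - L * b
          lemma = solve-∀

        MN : M * N ≡ k * c - k * L * b
        MN = trans (trans (cong (_* N) M≡kL) (*-assoc k L N)) (trans (cong (k *_) LN) (lemma k L c b))
          where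
          lemma : ∀ k L c b → k * (c - L * b) ≡ k * c - k * L * b
          lemma = solve-∀

        0≤k : 0ℤ ≤ k
        0≤k = ≤-trans (0≤+ {2}) 2≤k

        0≤kLb : 0ℤ ≤ k * L * b
        0≤kLb = *-nonNeg (*-nonNeg 0≤k 0≤L) (0≤# S)

        -- More than `k` classes of scaled size at least `c - 2δ` would exceed the scaled total,
        -- which is at most `kc`; conversely fewer than `k` classes of scaled size at most `c + δ`
        -- could not cover the regular vertices. `8kδ ≤ c` keeps the error of `k` classes together
        -- below one class.
        m≤k : m ≤ k
        m≤k = ≮⇒≥ λ k<m → ≤-absurd (≤-trans (c-2δ≥0 ⊗ <⇒1+≤ k<m) (≤-trans MN-lower (≤-reflexive MN))) contra
          where
          c-2δ≥0 : 0ℤ ≤ c - + 2 * δ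
          c-2δ≥0 = ≤-from (16δ≤c ⊕ *-nonNeg {+ 14} 0≤+ 0≤δ) (lemma c δ)
            where
            lemma : ∀ c δ → c - + 2 * δ - 0ℤ ≡ c + + 14 * δ - (+ 16 * δ + 0ℤ)
            lemma = solve-∀
          contra : k * c - k * L * b < (c - + 2 * δ) * (1ℤ + k)
          contra = <-from (0<δ ⊕< (8kδ≤c ⊕ _⊗_ {+ 6} 0≤+ (0≤δ ⊗ 2≤k) ⊕ 0≤kLb ⊕ *-nonNeg {+ 9} 0≤+ 0≤δ)) (lemma k L b c δ)
            where
            lemma : ∀ k L b c δ → (c - + 2 * δ) * (1ℤ + k) - (k * c - k * L * b) ≡
              δ + (c + + 6 * (δ * k) + k * L * b + + 9 * δ) - (0ℤ + (+ 8 * k * δ + + 6 * (δ * + 2) + 0ℤ + 0ℤ))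
            lemma = solve-∀

        k≤m : k ≤ m
        k≤m = ≮⇒≥ λ m<k → ≤-absurd (≤-trans (≤-reflexive (sym MN)) MN-upper) (contra m (<⇒1+≤ m<k))
          where
          0≤c+δ : 0ℤ ≤ c + δ
          0≤c+δ = +-nonNeg (≤-trans (*-nonNeg {+ 16} 0≤+ 0≤δ) 16δ≤c) 0≤δ
          contra : ∀ m → 1ℤ + m ≤ k → (c + δ) * m < k * c - k * L * b
          contra m h = <-from (0<δ ⊕< ((0≤c+δ ⊗ h) ⊕ kLb≤δ ⊕ 8kδ≤c ⊕ _⊗_ {+ 7} 0≤+ (0≤δ ⊗ 2≤k) ⊕ *-nonNeg {+ 13} 0≤+ 0≤δ)) (lemma k L b c δ m)
            where
            lemma : ∀ k L b c δ m → (k * c - k * L * b) - (c + δ) * m ≡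
              δ + ((c + δ) * k + δ + c + + 7 * (δ * k) + + 13 * δ) - (0ℤ + ((c + δ) * (1ℤ + m) + k * L * b + + 8 * k * δ + + 7 * (δ * + 2) + 0ℤ))
            lemma = solve-∀

        spread : ∀ x → L * (k * x - N) ≡ M * x - c + L * b
        spread x = trans (lemma k L x N) (trans (cong₂ (λ M′ y → M′ * x - y) (sym M≡kL) LN) (lemma′ M x c (L * b)))
          where
          lemma : ∀ k L x N → L * (k * x - N) ≡ k * L * x - L * N
          lemma = solve-∀
          lemma′ : ∀ M x c y → M * x - (c - y) ≡ M * x - c + y
          lemma′ = solve-∀

        spread-lo : ∀ {u} → good u ≡ true → - (+ 2 * δ) ≤ L * (k * size u - N)
        spread-lo {u} gu = ≤-trans (≤-from (proj₁ (size-bounds gu) ⊕ *-nonNeg 0≤L (0≤# S)) (lemma c δ (M * size u) (L * b))) (≤-reflexive (sym (spread (size u))))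
          where
          lemma : ∀ c δ x y → x - c + y - (- (+ 2 * δ)) ≡ x + y - ((c - + 2 * δ) + 0ℤ)
          lemma = solve-∀

        spread-hi : ∀ {u} → good u ≡ true → L * (k * size u - N) ≤ + 2 * δ
        spread-hi {u} gu = ≤-trans (≤-reflexive (spread (size u))) (≤-from (proj₂ (size-bounds gu) ⊕ Lb≤δ) (lemma c δ (M * size u) (L * b)))
          where
          lemma : ∀ c δ x y → + 2 * δ - (x - c + y) ≡ c + δ + δ - (x + y)
          lemma = solve-∀

      open Balance k N L (+ 2 * δ) (≤-antisym m≤k k≤m) refl spread-lo spread-hi using (Z; Z≡; Z-nonNeg; T-total-bound)

      -- `E` is six times the number of edges and `G` twice the number of shadow pairs among the
      -- regular vertices, so this has slope `N/2k` in the shadow pairs. The balanced Steiner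
      -- blow-up gives equality.
      good-bound : + 2 * (k * k) * E ≤ + 3 * (k * N * G) - (k - 1ℤ) * (N * N * N)
      good-bound = combine E T-total μ G (∑ size) Z edge′ T-total-bound coefficient Z-nonNeg Z≡ pair-count (*-nonNeg (0≤# S) 0≤μ)
        where
        0≤μ : 0ℤ ≤ μ
        0≤μ = ∑₂-nonNeg λ u v → 0≤ι _
        edge′ : + 2 * (k * L) * E ≤ + 2 * (k * L) * T-total - + 3 * (L * (N + b)) * μ
        edge′ = subst₂ (λ M′ c′ → + 2 * M′ * E ≤ + 2 * M′ * T-total - + 3 * c′ * μ) M≡kL (trans c≡Ln (cong (L *_) (sym N+b≡n))) edge-bound
        -- Half of the available `-12LN` is given up. With `-6LN` a pair inside a class costs `3kN`,
        -- the same as a missing pair, so only the sum of the two counts matters, and this is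
        -- `N * N - G`.
        coefficient : + 4 * (+ 2 * δ) * (k - 1ℤ) - + 12 * L * N ≤ - (+ 6 * L * N)
        coefficient = ≤-from (8kδ≤c ⊕ _⊗_ {+ 5} 0≤+ 16δ≤c ⊕ _⊗_ {+ 6} 0≤+ Lb≤δ ⊕ *-nonNeg {+ 82} 0≤+ 0≤δ ⊕ _⊗_ {+ 6} 0≤+ (≤-reflexive (sym LN))) (lemma k L N b c δ)
          where
          lemma : ∀ k L N b c δ → - (+ 6 * L * N) - (+ 4 * (+ 2 * δ) * (k - 1ℤ) - + 12 * L * N) ≡
              c + + 5 * c + + 6 * δ + + 82 * δ + + 6 * (L * N) - (+ 8 * k * δ + + 5 * (+ 16 * δ) + + 6 * (L * b) + 0ℤ + + 6 * (c - L * b))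
          lemma = solve-∀
        0<k : 0ℤ < k
        0<k = <-≤-trans (+<+ (ℕ.s≤s ℕ.z≤n)) 2≤k
        combine : ∀ E T μ G s Z →
          + 2 * (k * L) * E ≤ + 2 * (k * L) * T - + 3 * (L * (N + b)) * μ →
          + 4 * L * (k * k * k) * T ≤ + 4 * L * (N * N * N) * (k * k - k) + (+ 4 * (+ 2 * δ) * (k - 1ℤ) - + 12 * L * N) * Z →
          + 4 * (+ 2 * δ) * (k - 1ℤ) - + 12 * L * N ≤ - (+ 6 * L * N) → 0ℤ ≤ Z → Z ≡ k * (k * s - N * N) → N * N ≡ s + (μ + G) → 0ℤ ≤ b * μ →
          + 2 * (k * k) * E ≤ + 3 * (k * N * G) - (k - 1ℤ) * (N * N * N)
        -- The term in `b * μ` arises because `edge-bound` charges missing pairs at the rate of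
        -- `n = N + b`, while `N` suffices here.
        combine E T μ G s _ h₁ h₂ h₃ 0≤Z refl h₅ 0≤bμ = ≤-from ((0≤k ⊗ e′) ⊕ t′ ⊕ _⊗_ {+ 3 * k} (*-nonNeg {+ 3} 0≤+ 0≤k) 0≤bμ ⊕ _⊗_ {+ 3 * k * N} (*-nonNeg (*-nonNeg {+ 3} 0≤+ 0≤k) (0≤# good)) (≤-reflexive h₅))
            (final k N b E T μ G s)
          where
          e′ : + 2 * k * E ≤ + 2 * k * T - + 3 * (N + b) * μ
          e′ = *-cancelˡ-≤ 0<L (≤-from h₁ (lemma k L N b E T μ))
            where
            lemma : ∀ k L N b E T μ → L * (+ 2 * k * T - + 3 * (N + b) * μ) - L * (+ 2 * k * E) ≡
              + 2 * (k * L) * T - + 3 * (L * (N + b)) * μ - + 2 * (k * L) * E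
            lemma = solve-∀
          t′ : + 2 * (k * k) * T ≤ + 2 * (N * N * N) * (k - 1ℤ) - + 3 * N * (k * s - N * N)
          t′ = *-cancelˡ-≤ (*-pos {+ 2} (+<+ (ℕ.s≤s ℕ.z≤n)) (*-pos 0<L 0<k)) (≤-from (h₂ ⊕ (0≤Z ⊗ h₃)) (lemma k L N δ T s))
            where
            lemma : ∀ k L N δ T s → + 2 * (L * k) * (+ 2 * (N * N * N) * (k - 1ℤ) - + 3 * N * (k * s - N * N)) - + 2 * (L * k) * (+ 2 * (k * k) * T) ≡
              + 4 * L * (N * N * N) * (k * k - k) + (+ 4 * (+ 2 * δ) * (k - 1ℤ) - + 12 * L * N) * (k * (k * s - N * N)) + k * (k * s - N * N) * (- (+ 6 * L * N))
                - (+ 4 * L * (k * k * k) * T + k * (k * s - N * N) * (+ 4 * (+ 2 * δ) * (k - 1ℤ) - + 12 * L * N))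
            lemma = solve-∀
          final : ∀ k N b E T μ G s → + 3 * (k * N * G) - (k - 1ℤ) * (N * N * N) - + 2 * (k * k) * E ≡
            k * (+ 2 * k * T - + 3 * (N + b) * μ) + (+ 2 * (N * N * N) * (k - 1ℤ) - + 3 * N * (k * s - N * N)) + + 3 * k * (b * μ) + + 3 * k * N * (s + (μ + G))
              - (k * (+ 2 * k * E) + + 2 * (k * k) * T + + 3 * k * 0ℤ + + 3 * k * N * (N * N))
          final = solve-∀

  -- Integral reciprocals, the link inequality and second moments.

  module Shares (n : ℕ) where

    F : ℤ
    F = + (n !)

    private
      quotient : ℕ → ℕ
      -- An arbitrary default: `share` is evaluated through `share-spec` only from 1 on, and
      -- codegree 0 is treated separately.
      quotient zero    = 0
      quotient (suc m) = (n !) ℕ./ suc m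

    opaque

      share : ℤ → ℤ
      share x = + quotient ∣ x ∣

      share-nonNeg : ∀ x → 0ℤ ≤ share x
      share-nonNeg x = 0≤+

      share-spec : ∀ {x} → 1ℤ ≤ x → x ≤ + n → x * share x ≡ F
      share-spec {+ suc m} _ (+≤+ m<n) = trans (sym (pos-* (suc m) _)) (cong +_ (ℕ.m*[n/m]≡n (ℕ.∣-trans (ℕ.m∣m*n (m !)) (ℕ.m≤n⇒m!∣n! m<n))))
      share-spec {+ zero} (+≤+ ()) _

    0<F : 0ℤ < F
    0<F = +<+ (ℕ.1≤n! n)

    -- This is `x/y + y/x ≥ 2` times `n!`. The two summands have product `F * F`, so
    -- `(2F)² - (sum)²` is minus the square of their difference.
    AM-GM : ∀ {x y} → 1ℤ ≤ x → x ≤ + n → 1ℤ ≤ y → y ≤ + n → + 2 * F ≤ x * share y + y * share x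
    AM-GM {x} {y} 1≤x x≤n 1≤y y≤n = ≮⇒≥ λ lt → ≤-absurd
      (≤-from (sq-nonNeg (x * share y - y * share x)) (trans (lemma F (x * share y) (y * share x)) (cong (λ z → (x * share y - y * share x) * (x * share y - y * share x) + z) product)))
      (*-pos (i<j⇒0<j-i lt) (<-≤-trans 0<F (≤-from (*-nonNeg (0≤ 1≤x) (share-nonNeg y) ⊕ *-nonNeg (0≤ 1≤y) (share-nonNeg x) ⊕ <⇒≤ 0<F) (lemma₃ F (x * share y) (y * share x)))))
      where
      0≤ : ∀ {x} → 1ℤ ≤ x → 0ℤ ≤ x
      0≤ = ≤-trans 0≤+
      i<j⇒0<j-i : ∀ {i j} → i < j → 0ℤ < j - i
      i<j⇒0<j-i {i} {j} lt = <-from lt (lemma₀ i j)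
        where
        lemma₀ : ∀ i j → j - i - 0ℤ ≡ j - i
        lemma₀ = solve-∀
      product : + 4 * ((x * share y) * (y * share x) - F * F) ≡ - 0ℤ
      product = trans (lemma₂ x y (share x) (share y) F) (trans (cong₂ (λ p q → + 4 * (p * q - F * F)) (share-spec 1≤x x≤n) (share-spec 1≤y y≤n)) (lemma₁ F))
        where
        lemma₂ : ∀ x y a b F → + 4 * ((x * b) * (y * a) - F * F) ≡ + 4 * ((x * a) * (y * b) - F * F)
        lemma₂ = solve-∀
        lemma₁ : ∀ F → + 4 * (F * F - F * F) ≡ - 0ℤ
        lemma₁ = solve-∀
      lemma : ∀ F A B → 0ℤ - (+ 2 * F - (A + B)) * (+ 2 * F + (A + B)) ≡ (A - B) * (A - B) + + 4 * (A * B - F * F)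
      lemma = solve-∀
      lemma₃ : ∀ F A B → + 2 * F + (A + B) - F ≡ A + B + F - (0ℤ + 0ℤ + 0ℤ)
      lemma₃ = solve-∀

  module Moments {n : ℕ} (H : TripleSystem n) where

    open TripleSystem H
    open Shares n

    codeg : Fin n → Fin n → ℤ
    codeg u v = # (e u v)

    nonDeg deg : Fin n → ℤ
    nonDeg v = # (∁ (g v))
    deg v = # (g v)

    ιe-swap₂₃ : ∀ u v w → ι (e u v w) ≡ ι (e u w v)
    ιe-swap₂₃ u v w = ι-cong e-swap₂₃ e-swap₂₃

    codeg≤nonDeg : ∀ {u v w} → e u v w ≡ true → codeg u v ≤ nonDeg w
    codeg≤nonDeg h = #-mono λ z h′ → not-intro (indep h h′)

    1≤codeg : ∀ {u v w} → e u v w ≡ true → 1ℤ ≤ codeg u v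
    1≤codeg {u} {v} {w} h = ≤-trans (≤-reflexive (sym (#-unique (λ z → does (z Fin.≟ w)) w (does-true (w Fin.≟ w) refl) (λ j → from-true (j Fin.≟ w)))))
      (#-mono λ z eq → trans (cong (e u v) (from-true (z Fin.≟ w) eq)) h)

    -- In the link of u every edge v w satisfies codeg u v ≤ nonDeg w and codeg u w ≤ nonDeg v. Summing
    -- nonDeg w / codeg u w + nonDeg v / codeg u v ≥ 2 over the link gives the claim; n! clears the denominators.
    link-bound : ∀ u → ∑ (λ v → codeg u v) ≤ ∑ (λ v → ι (g u v) * nonDeg v)
    link-bound u = *-cancelˡ-≤ (*-pos {+ 2} (+<+ (ℕ.s≤s ℕ.z≤n)) 0<F) (begin
      + 2 * F * ∑ (λ v → codeg u v) ≡⟨ sym (trans (∑-cong λ v → ∑-* (+ 2 * F) (λ w → ι (e u v w))) (∑-* (+ 2 * F) (λ v → codeg u v))) ⟩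
      ∑₂ (λ v w → + 2 * F * ι (e u v w)) ≤⟨ ∑₂-mono pointwise ⟩
      ∑₂ (λ v w → ι (e u v w) * s w + ι (e u v w) * s v) ≡⟨ ∑₂-+ (λ v w → ι (e u v w) * s w) (λ v w → ι (e u v w) * s v) ⟩
      ∑₂ (λ v w → ι (e u v w) * s w) + ∑₂ (λ v w → ι (e u v w) * s v)
                                                                   ≡⟨ cong₂ _+_ (trans (∑-swap (λ v w → ι (e u v w) * s w)) (∑-cong λ w → trans (∑-*ʳ (s w) (λ v → ι (e u v w))) (cong (_* s w) (∑-cong λ v → ιe-swap₂₃ u v w))))
                                                                                (∑-cong λ v → ∑-*ʳ (s v) (λ w → ι (e u v w))) ⟩
      ∑ (λ v → codeg u v * s v) + ∑ (λ v → codeg u v * s v) ≤⟨ ∑-mono bounded ⊕ ∑-mono bounded ⟩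
      ∑ (λ v → F * (ι (g u v) * nonDeg v)) + ∑ (λ v → F * (ι (g u v) * nonDeg v))
                                                                   ≡⟨ cong₂ _+_ (∑-* F (λ v → ι (g u v) * nonDeg v)) (∑-* F (λ v → ι (g u v) * nonDeg v)) ⟩
      F * Q + F * Q ≡⟨ double F Q ⟩
      + 2 * F * Q ∎)
      where
      open ≤-Reasoning
      Q : ℤ
      Q = ∑ λ v → ι (g u v) * nonDeg v
      s : Fin n → ℤ
      s v = nonDeg v * share (codeg u v)
      double : ∀ F Q → F * Q + F * Q ≡ + 2 * F * Q
      double = solve-∀
      pointwise : ∀ v w → + 2 * F * ι (e u v w) ≤ ι (e u v w) * s w + ι (e u v w) * s v
      pointwise v w with e u v w in h
      ... | false = ≤-reflexive (lemma F (s w) (s v))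
        where
        lemma : ∀ F a b → + 2 * F * 0ℤ ≡ 0ℤ * a + 0ℤ * b
        lemma = solve-∀
      ... | true = subst₂ _≤_ (sym (*-identityʳ (+ 2 * F))) (cong₂ _+_ (sym (*-identityˡ (s w))) (sym (*-identityˡ (s v))))
          (≤-trans (AM-GM (1≤codeg h) (#≤n (e u v)) (1≤codeg (e-swap₂₃ h)) (#≤n (e u w)))
            (*-monoʳ-≤-nonNeg (share (codeg u w)) {{nonNegative (share-nonNeg _)}} (codeg≤nonDeg h)
              ⊕ *-monoʳ-≤-nonNeg (share (codeg u v)) {{nonNegative (share-nonNeg _)}} (codeg≤nonDeg (e-swap₂₃ h))))
      bounded : ∀ v → codeg u v * s v ≤ F * (ι (g u v) * nonDeg v)
      bounded v with g u v in gv
      ... | false = ≤-reflexive (trans (cong (_* s v) (∑-zeros λ w → cong ι (≢true λ h → true≢false (e⇒g h) gv))) (lemma (s v) F (nonDeg v)))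
        where
        lemma : ∀ a F b → 0ℤ * a ≡ F * (0ℤ * b)
        lemma = solve-∀
      ... | true with 1ℤ ≤? codeg u v
      ...   | yes 1≤d = ≤-reflexive (trans (lemma (codeg u v) (nonDeg v) (share (codeg u v))) (trans (cong (_* nonDeg v) (share-spec 1≤d (#≤n (e u v)))) (cong (F *_) (sym (*-identityˡ (nonDeg v))))))
        where
        lemma : ∀ d a i → d * (a * i) ≡ d * i * a
        lemma = solve-∀
      ...   | no ¬1≤d = ≤-trans (≤-reflexive (trans (cong (_* s v) (≤-antisym (≮⇒≥ λ lt → ¬1≤d (<⇒1+≤ lt)) (0≤# (e u v)))) (*-zeroˡ (s v))))
                (*-nonNeg (<⇒≤ 0<F) (*-nonNeg {1ℤ} 0≤+ (0≤# (∁ (g v)))))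

    E₆ G₂ : ℤ
    E₆ = ∑₃ λ u v w → ι (e u v w)
    G₂ = ∑₂ λ u v → ι (g u v)

    deg+nonDeg : ∀ v → deg v + nonDeg v ≡ + n
    deg+nonDeg v = #-∁ (g v)

    ιg-sym : ∀ u v → ι (g u v) ≡ ι (g v u)
    ιg-sym u v = ι-cong g-sym g-sym

    column : ∀ (φ : Fin n → ℤ) → ∑₂ (λ u v → ι (g u v) * φ v) ≡ ∑ (λ v → deg v * φ v)
    column φ = trans (∑-swap (λ u v → ι (g u v) * φ v)) (∑-cong λ v → trans (∑-*ʳ (φ v) (λ u → ι (g u v))) (cong (_* φ v) (∑-cong λ u → ιg-sym u v)))

    E₆≤ : E₆ ≤ ∑ λ v → deg v * nonDeg v
    E₆≤ = ≤-trans (∑-mono link-bound) (≤-reflexive (column nonDeg))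

    ∑-lin : ∀ a b c (φ ψ : Fin n → ℤ) → ∑ (λ v → a + b * φ v + c * ψ v) ≡ + n * a + b * ∑ φ + c * ∑ ψ
    ∑-lin a b c φ ψ = trans (∑-+ (λ v → a + b * φ v) (λ v → c * ψ v)) (cong₂ _+_ (trans (∑-+ (λ _ → a) (λ v → b * φ v)) (cong₂ _+_ (∑-const n a) (∑-* b φ))) (∑-* c ψ))

    ∑₂-lin : ∀ a b c (φ ψ χ : Fin n → Fin n → ℤ) → ∑₂ (λ u v → a * φ u v + b * ψ u v + c * χ u v) ≡ a * ∑₂ φ + b * ∑₂ ψ + c * ∑₂ χ
    ∑₂-lin a b c φ ψ χ = trans (∑₂-+ (λ u v → a * φ u v + b * ψ u v) (λ u v → c * χ u v))
      (cong₂ _+_ (trans (∑₂-+ (λ u v → a * φ u v) (λ u v → b * ψ u v)) (cong₂ _+_ (∑₂-* a φ) (∑₂-* b ψ))) (∑₂-* c χ))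

    module Deviations (k : ℤ) where

      ν : ℤ
      ν = + n

      α : Fin n → ℤ
      α v = k * nonDeg v - ν

      β : Fin n → Fin n → ℤ
      β u v = k * codeg u v - ν

      -- In the notation of the theorem η = ε (k - 1) n², and Y is 12 k² times the excess of |H| over
      -- the bound without its ε^(3/2) term.
      η V W : ℤ
      η = (k - 1ℤ) * (ν * ν) - k * G₂
      V = ∑ λ v → α v * α v
      W = ∑₂ λ u v → ι (g u v) * (β u v * β u v)

      Y : ℤ
      Y = + 2 * (k * k) * E₆ - + 2 * (k - 1ℤ) * (ν * ν * ν) + + 3 * (η * ν)

      0≤V : 0ℤ ≤ V
      0≤V = ∑-nonNeg λ v → sq-nonNeg (α v)

      ∑α≡η : ∑ α ≡ η
      ∑α≡η = trans (∑-cong λ v → pointwise v) (trans (∑-lin ((k - 1ℤ) * ν) (- k) 0ℤ deg deg) (lemma k ν G₂))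
        where
        pointwise : ∀ v → α v ≡ (k - 1ℤ) * ν + (- k) * deg v + 0ℤ * deg v
        pointwise v = subst (λ x → k * nonDeg v - x ≡ (k - 1ℤ) * x + (- k) * deg v + 0ℤ * deg v) (deg+nonDeg v) (lemma′ k (deg v) (nonDeg v))
          where
          lemma′ : ∀ k d a → k * a - (d + a) ≡ (k - 1ℤ) * (d + a) + (- k) * d + 0ℤ * d
          lemma′ = solve-∀
        lemma : ∀ k ν G → ν * ((k - 1ℤ) * ν) + (- k) * G + 0ℤ * G ≡ (k - 1ℤ) * (ν * ν) - k * G
        lemma = solve-∀

      -- Since `k nonDeg = ν + α` and `k deg = (k - 1)ν - α`, each product is quadratic in `α` with
      -- leading coefficient -1. This concavity is the source of `-V`.
      first-moment : k * k * ∑ (λ v → deg v * nonDeg v) ≡ ν * ((k - 1ℤ) * (ν * ν)) + (k - + 2) * ν * η + (- 1ℤ) * V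
      first-moment = trans (sym (∑-* (k * k) (λ v → deg v * nonDeg v))) (trans (∑-cong pointwise)
        (trans (∑-lin ((k - 1ℤ) * (ν * ν)) ((k - + 2) * ν) (- 1ℤ) α (λ v → α v * α v)) (cong (λ x → ν * ((k - 1ℤ) * (ν * ν)) + (k - + 2) * ν * x + (- 1ℤ) * V) ∑α≡η)))
        where
        pointwise : ∀ v → k * k * (deg v * nonDeg v) ≡ (k - 1ℤ) * (ν * ν) + (k - + 2) * ν * α v + (- 1ℤ) * (α v * α v)
        pointwise v = subst (λ x → k * k * (deg v * nonDeg v) ≡ (k - 1ℤ) * (x * x) + (k - + 2) * x * (k * nonDeg v - x) + (- 1ℤ) * ((k * nonDeg v - x) * (k * nonDeg v - x)))
          (deg+nonDeg v) (lemma k (deg v) (nonDeg v))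
          where
          lemma : ∀ k d a → k * k * (d * a) ≡ (k - 1ℤ) * ((d + a) * (d + a)) + (k - + 2) * (d + a) * (k * a - (d + a)) + (- 1ℤ) * ((k * a - (d + a)) * (k * a - (d + a)))
          lemma = solve-∀

      -- The upper bound on `E₆` falls by `V/k²` below its value for constant `nonDeg`, while
      -- `0 < Y` keeps `E₆` within `O(ην)` of the extremal value. So `V` has to fit into the
      -- difference.
      V-bound : 0ℤ ≤ η → 0ℤ < Y → V ≤ k * ν * η
      V-bound 0≤η 0<Y = *-cancelˡ-≤ {+ 2} (+<+ (ℕ.s≤s ℕ.z≤n))
        (≤-from (<⇒≤ 0<Y ⊕ _⊗_ {+ 2} 0≤+ (_⊗_ {k * k} (sq-nonNeg k) E₆≤) ⊕ _⊗_ {+ 2} 0≤+ (≤-reflexive first-moment) ⊕ *-nonNeg 0≤η (0≤+ {n}))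
          (lemma k ν η E₆ (∑ λ v → deg v * nonDeg v) V))
        where
        lemma : ∀ k ν η E Q V → + 2 * (k * ν * η) - + 2 * V ≡
          (+ 2 * (k * k) * E - + 2 * (k - 1ℤ) * (ν * ν * ν) + + 3 * (η * ν)) + + 2 * (k * k * Q) + + 2 * (ν * ((k - 1ℤ) * (ν * ν)) + (k - + 2) * ν * η + (- 1ℤ) * V) + η * ν
            - (0ℤ + + 2 * (k * k * E) + + 2 * (k * k * Q) + 0ℤ)
        lemma = solve-∀

      private
        D₂ DA P X : ℤ
        D₂ = ∑₂ λ u v → codeg u v * codeg u v
        DA = ∑₂ λ u v → codeg u v * nonDeg v
        P  = ∑₂ λ u v → ι (g u v) * α v
        X  = ∑₂ λ u v → ι (g u v) * (β u v * α v)

        codeg-g : ∀ u v → g u v ≡ false → codeg u v ≡ 0ℤ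
        codeg-g u v gv = ∑-zeros λ w → cong ι (≢true λ h → true≢false (e⇒g h) gv)

        -- `codeg u v ≤ nonDeg w` is summed over all edges: the left side groups by the pair `u v`,
        -- the right by the pair `u w`.
        D₂≤DA : D₂ ≤ DA
        D₂≤DA = subst₂ _≤_ (∑₂-cong λ u v → ∑-*ʳ (codeg u v) (λ w → ι (e u v w)))
            (∑-cong λ u → trans (∑-swap (λ v w → ι (e u v w) * nonDeg w)) (∑-cong λ w → trans (∑-*ʳ (nonDeg w) (λ v → ι (e u v w))) (cong (_* nonDeg w) (∑-cong λ v → ιe-swap₂₃ u v w))))
            (∑₃-mono pointwise)
          where
          pointwise : ∀ u v w → ι (e u v w) * codeg u v ≤ ι (e u v w) * nonDeg w
          pointwise u v w with e u v w in h
          ... | true  = _⊗_ {1ℤ} 0≤+ (codeg≤nonDeg h)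
          ... | false = ≤-reflexive (trans (*-zeroˡ (codeg u v)) (sym (*-zeroˡ (nonDeg w))))

        W≡ : W ≡ k * k * D₂ + (- (+ 2 * k * ν)) * E₆ + ν * ν * G₂
        W≡ = trans (∑₂-cong pointwise) (∑₂-lin (k * k) (- (+ 2 * k * ν)) (ν * ν) (λ u v → codeg u v * codeg u v) codeg (λ u v → ι (g u v)))
          where
          pointwise : ∀ u v → ι (g u v) * (β u v * β u v) ≡ k * k * (codeg u v * codeg u v) + (- (+ 2 * k * ν)) * codeg u v + ν * ν * ι (g u v)
          pointwise u v with g u v in gv
          ... | true  = lemma k ν (codeg u v)
            where
            lemma : ∀ k ν d → 1ℤ * ((k * d - ν) * (k * d - ν)) ≡ k * k * (d * d) + (- (+ 2 * k * ν)) * d + ν * ν * 1ℤ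
            lemma = solve-∀
          ... | false = trans (cong (λ d → 0ℤ * ((k * d - ν) * (k * d - ν))) (codeg-g u v gv)) (trans (lemma k ν) (cong (λ d → k * k * (d * d) + (- (+ 2 * k * ν)) * d + ν * ν * 0ℤ) (sym (codeg-g u v gv))))
            where
            lemma : ∀ k ν → 0ℤ * ((k * 0ℤ - ν) * (k * 0ℤ - ν)) ≡ k * k * (0ℤ * 0ℤ) + (- (+ 2 * k * ν)) * 0ℤ + ν * ν * 0ℤ
            lemma = solve-∀

        DA≡ : k * k * DA ≡ 1ℤ * X + ν * P + k * ν * E₆
        DA≡ = trans (sym (∑₂-* (k * k) (λ u v → codeg u v * nonDeg v))) (trans (∑₂-cong pointwise) (∑₂-lin 1ℤ ν (k * ν) (λ u v → ι (g u v) * (β u v * α v)) (λ u v → ι (g u v) * α v) codeg))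
          where
          pointwise : ∀ u v → k * k * (codeg u v * nonDeg v) ≡ 1ℤ * (ι (g u v) * (β u v * α v)) + ν * (ι (g u v) * α v) + k * ν * codeg u v
          pointwise u v with g u v in gv
          ... | true  = lemma k ν (codeg u v) (nonDeg v)
            where
            lemma : ∀ k ν d a → k * k * (d * a) ≡ 1ℤ * (1ℤ * ((k * d - ν) * (k * a - ν))) + ν * (1ℤ * (k * a - ν)) + k * ν * d
            lemma = solve-∀
          ... | false = trans (cong (λ d → k * k * (d * nonDeg v)) (codeg-g u v gv)) (trans (lemma k ν (nonDeg v) (β u v))
              (cong (λ d → 1ℤ * (0ℤ * (β u v * α v)) + ν * (0ℤ * α v) + k * ν * d) (sym (codeg-g u v gv))))
            where
            lemma : ∀ k ν a b → k * k * (0ℤ * a) ≡ 1ℤ * (0ℤ * (b * (k * a - ν))) + ν * (0ℤ * (k * a - ν)) + k * ν * 0ℤ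
            lemma = solve-∀

        2X≤ : + 2 * X ≤ W + ν * V
        2X≤ = ≤-trans (subst₂ _≤_ (∑₂-* (+ 2) (λ u v → ι (g u v) * (β u v * α v))) (∑₂-+ (λ u v → ι (g u v) * (β u v * β u v)) (λ u v → ι (g u v) * (α v * α v))) (∑₂-mono pointwise))
          (≤-refl {W} ⊕ ≤-trans (≤-reflexive (column (λ v → α v * α v))) (≤-trans (∑-mono λ v → *-monoʳ-≤-nonNeg (α v * α v) {{nonNegative (sq-nonNeg (α v))}} (#≤n (g v))) (≤-reflexive (∑-* ν (λ v → α v * α v)))))
          where
          pointwise : ∀ u v → + 2 * (ι (g u v) * (β u v * α v)) ≤ ι (g u v) * (β u v * β u v) + ι (g u v) * (α v * α v)
          pointwise u v = ≤-from (*-nonNeg (0≤ι (g u v)) (sq-nonNeg (β u v - α v))) (lemma (ι (g u v)) (β u v) (α v))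
            where
            lemma : ∀ i b a → i * (b * b) + i * (a * a) - + 2 * (i * (b * a)) ≡ i * ((b - a) * (b - a)) - 0ℤ
            lemma = solve-∀

        kP≡ : k * P ≡ ν * 0ℤ + (k - 1ℤ) * ν * η + (- 1ℤ) * V
        kP≡ = trans (cong (k *_) (column α)) (trans (sym (∑-* k (λ v → deg v * α v))) (trans (∑-cong pointwise)
          (trans (∑-lin 0ℤ ((k - 1ℤ) * ν) (- 1ℤ) α (λ v → α v * α v)) (cong (λ x → ν * 0ℤ + (k - 1ℤ) * ν * x + (- 1ℤ) * V) ∑α≡η))))
          where
          pointwise : ∀ v → k * (deg v * α v) ≡ 0ℤ + (k - 1ℤ) * ν * α v + (- 1ℤ) * (α v * α v)
          pointwise v = subst (λ x → k * (deg v * (k * nonDeg v - x)) ≡ 0ℤ + (k - 1ℤ) * x * (k * nonDeg v - x) + (- 1ℤ) * ((k * nonDeg v - x) * (k * nonDeg v - x)))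
            (deg+nonDeg v) (lemma k (deg v) (nonDeg v))
            where
            lemma : ∀ k d a → k * (d * (k * a - (d + a))) ≡ 0ℤ + (k - 1ℤ) * (d + a) * (k * a - (d + a)) + (- 1ℤ) * ((k * a - (d + a)) * (k * a - (d + a)))
            lemma = solve-∀

      -- In terms of deviations `D₂≤DA` bounds `W` by the mixed sum `X` and terms that are `O(ν²η)`,
      -- because `0 < Y` bounds `E₆` from below and `kP≡` controls `P`. By `2X≤` the mixed sum
      -- returns only half of `W`, which is subtracted.
      W-bound : 0ℤ < k → 0ℤ ≤ η → 0ℤ < Y → W ≤ (k + + 2) * (ν * ν) * η
      W-bound 0<k 0≤η 0<Y = *-cancelˡ-≤ 0<k (≤-from
        (_⊗_ {k} 0≤k (≤-reflexive W≡ ⊕ ≤-reflexive W≡ ⊕ _⊗_ {+ 2 * (k * k)} (*-nonNeg {+ 2} 0≤+ (sq-nonNeg k)) D₂≤DA ⊕ _⊗_ {+ 2} 0≤+ (≤-reflexive DA≡) ⊕ 2X≤)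
          ⊕ _⊗_ {+ 2 * ν} 0≤2ν (≤-reflexive kP≡) ⊕ (0≤+ {n} ⊗ <⇒≤ 0<Y) ⊕ (*-nonNeg 0≤k (0≤+ {n}) ⊗ V-bound 0≤η 0<Y) ⊕ *-nonNeg 0≤2ν 0≤V ⊕ *-nonNeg (*-nonNeg {ν} {ν} 0≤+ 0≤+) 0≤η)
        (lemma k ν W D₂ DA E₆ G₂ X P V))
        where
        0≤k : 0ℤ ≤ k
        0≤k = <⇒≤ 0<k
        0≤2ν : 0ℤ ≤ + 2 * ν
        0≤2ν = *-nonNeg {+ 2} 0≤+ (0≤+ {n})
        lemma : ∀ k ν W D A E G X P V →
          k * ((k + + 2) * (ν * ν) * ((k - 1ℤ) * (ν * ν) - k * G)) - k * W ≡
          k * ((k * k * D + (- (+ 2 * k * ν)) * E + ν * ν * G) + (k * k * D + (- (+ 2 * k * ν)) * E + ν * ν * G) + + 2 * (k * k) * A + + 2 * (1ℤ * X + ν * P + k * ν * E) + (W + ν * V))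
            + + 2 * ν * (ν * 0ℤ + (k - 1ℤ) * ν * ((k - 1ℤ) * (ν * ν) - k * G) + (- 1ℤ) * V)
            + ν * (+ 2 * (k * k) * E - + 2 * (k - 1ℤ) * (ν * ν * ν) + + 3 * (((k - 1ℤ) * (ν * ν) - k * G) * ν))
            + k * ν * (k * ν * ((k - 1ℤ) * (ν * ν) - k * G))
            + + 2 * ν * V + ν * ν * ((k - 1ℤ) * (ν * ν) - k * G)
            - (k * (W + W + + 2 * (k * k) * D + + 2 * (k * k * A) + + 2 * X) + + 2 * ν * (k * P) + ν * 0ℤ + k * ν * V + 0ℤ + 0ℤ)
        lemma = solve-∀

  -- Explicit constants and elementary inequalities.

  module Constants (k : ℤ) where

    -- `C₁` adds the Markov bounds for the two kinds of exceptional vertices; `C₂` is what makes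
    -- them fewer than the tolerance `n/M`; `C₃` comes from squaring the three terms of `Y-upper`,
    -- with the outer 3 from `(x + y + z)² ≤ 3(x² + y² + z²)`.
    L M C₁ C₂ C₃ : ℤ
    L = + 100 * k
    M = k * L
    C₁ = L * L * k + M * (L * L) * (k + + 2)
    C₂ = M * C₁
    C₃ = + 3 * (+ 36 * (k * k * k) * (C₁ * C₁) + + 81 * (k * k) * ((C₁ * C₁) * (C₁ * C₁)) + + 9 * (C₁ * C₁))

    module ConstantBounds (0<k : 0ℤ < k) where

      0≤k : 0ℤ ≤ k
      0≤k = <⇒≤ 0<k

      0<L : 0ℤ < L
      0<L = *-pos {+ 100} (+<+ (ℕ.s≤s ℕ.z≤n)) 0<k

      0<M : 0ℤ < M
      0<M = *-pos 0<k 0<L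

      0<C₁ : 0ℤ < C₁
      0<C₁ = +-mono-<-≤ {0ℤ} (*-pos (*-pos 0<L 0<L) 0<k) (*-nonNeg (*-nonNeg (<⇒≤ 0<M) (sq-nonNeg L)) (+-nonNeg 0≤k (0≤+ {2})))

      0<C₂ : 0ℤ < C₂
      0<C₂ = *-pos 0<M 0<C₁

      0<C₃ : 0ℤ < C₃
      0<C₃ = *-pos {+ 3} (+<+ (ℕ.s≤s ℕ.z≤n)) (+-mono-≤-< {0ℤ} (+-nonNeg (*-nonNeg (*-nonNeg {+ 36} 0≤+ (*-nonNeg (sq-nonNeg k) 0≤k)) (sq-nonNeg C₁))
        (*-nonNeg (*-nonNeg {+ 81} 0≤+ (sq-nonNeg k)) (sq-nonNeg (C₁ * C₁)))) (*-pos {+ 9} (+<+ (ℕ.s≤s ℕ.z≤n)) (*-pos 0<C₁ 0<C₁)))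

  sq-mono : ∀ {x y} → 0ℤ ≤ x → x ≤ y → x * x ≤ y * y
  sq-mono {x} {y} 0≤x x≤y = ≤-trans (0≤x ⊗ x≤y) (*-monoʳ-≤-nonNeg y {{nonNegative (≤-trans 0≤x x≤y)}} x≤y)

  sq-cancel : ∀ {x y} → 0ℤ ≤ y → x * x ≤ y * y → x ≤ y
  sq-cancel {x} {y} 0≤y h = ≮⇒≥ λ y<x → ≤-absurd h (strict y<x)
    where
    strict : y < x → y * y < x * x
    strict y<x = <-from (*-pos (0<x-y y<x) (<-≤-trans (≤-<-trans 0≤y y<x) (≤-from 0≤y (lemma₁ x y)))) (lemma x y)
      where
      0<x-y : y < x → 0ℤ < x - y
      0<x-y lt = <-from lt (lemma₂ x y)
        where
        lemma₂ : ∀ x y → x - y - 0ℤ ≡ x - y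
        lemma₂ = solve-∀
      lemma₁ : ∀ x y → x + y - x ≡ y - 0ℤ
      lemma₁ = solve-∀
      lemma : ∀ x y → x * x - y * y ≡ (x - y) * (x + y) - 0ℤ
      lemma = solve-∀

  cauchy-schwarz : ∀ {n} (f : Fin n → ℤ) → ∑ f * ∑ f ≤ + n * ∑ (λ i → f i * f i)
  cauchy-schwarz {n} f = *-cancelˡ-≤ {+ 2} (+<+ (ℕ.s≤s ℕ.z≤n)) (≤-from squares (lemma (+ n) (∑ f) (∑ (λ i → f i * f i))))
    where
    q : Fin n → ℤ
    q i = f i * f i
    squares : 0ℤ ≤ + n * ∑ q + (- + 2) * (∑ f * ∑ f) + + n * ∑ q
    squares = ≤-trans (∑₂-nonNeg λ i j → sq-nonNeg (f i - f j)) (≤-reflexive (trans (∑₂-cong λ i j → expand (f i) (f j))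
      (trans (∑₂-+ (λ i j → q i + (- + 2) * (f i * f j)) (λ i j → q j))
        (cong₂ _+_ (trans (∑₂-+ (λ i j → q i) (λ i j → (- + 2) * (f i * f j)))
          (cong₂ _+_ (trans (∑-cong λ i → ∑-const n (q i)) (∑-* (+ n) q))
                     (trans (∑₂-* (- + 2) (λ i j → f i * f j)) (cong ((- + 2) *_) (trans (∑-cong λ i → ∑-* (f i) f) (∑-*ʳ (∑ f) f))))))
          (∑-const n (∑ q))))))
      where
      expand : ∀ a b → (a - b) * (a - b) ≡ a * a + (- + 2) * (a * b) + b * b
      expand = solve-∀
    lemma : ∀ n s q → + 2 * (n * q) - + 2 * (s * s) ≡ n * q + (- + 2) * (s * s) + n * q - 0ℤ
    lemma = solve-∀

  ≤∣_∣ : ∀ x → x ≤ + ∣ x ∣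
  ≤∣ + m ∣ = ≤-refl
  ≤∣ -[1+ m ] ∣ = -≤+

  ∣∣-sq : ∀ x → + ∣ x ∣ * + ∣ x ∣ ≡ x * x
  ∣∣-sq (+ m) = refl
  ∣∣-sq -[1+ m ] = refl

  -- The excess of a dense system and the cost of its exceptional vertices.

  module Stability {n : ℕ} (H : TripleSystem n) (k : ℤ) where

    open TripleSystem H
    open Moments H
    open Deviations k
    open Constants k

    module Dense (3≤k : + 3 ≤ k) (0<ν : 0ℤ < ν) (0≤η : 0ℤ ≤ η) (small : C₂ * η ≤ ν * ν) (0<Y : 0ℤ < Y) where

      0<k : 0ℤ < k
      0<k = <-≤-trans (+<+ (ℕ.s≤s ℕ.z≤n)) 3≤k

      open ConstantBounds 0<k

      0≤ν : 0ℤ ≤ ν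
      0≤ν = <⇒≤ 0<ν

      0≤L : 0ℤ ≤ L
      0≤L = <⇒≤ 0<L

      0≤M : 0ℤ ≤ M
      0≤M = <⇒≤ 0<M

      open Pairs H M (L * ν) ν 0<M using (∥_∥; ∥∥-def; ∥∥-∪; non; off)

      -- In unscaled terms: `nonDeg v` differs from `n/k` by more than `n/M`, respectively `v` lies
      -- in more than `n/M` shadow pairs whose codegree is below `n/k - n/M`.
      dev-large few : Fin n → Bool
      dev-large v = does (ν * ν <? (L * α v) * (L * α v))
      few v = does (ν <? ∥ off v ∥)

      S : Fin n → Bool
      S = dev-large ∪ few

      b : ℤ
      b = # S

      dev-count : ν * # dev-large ≤ L * L * k * η
      dev-count = *-cancelˡ-≤ 0<ν (≤-trans (subst₂ _≤_ (trans (∑-* (ν * ν) (λ v → ι (dev-large v))) (*-assoc ν ν (# dev-large))) (∑-* (L * L) (λ v → α v * α v)) (∑-mono pointwise))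
        (≤-trans (_⊗_ {L * L} (sq-nonNeg L) (V-bound 0≤η 0<Y)) (≤-reflexive (lemma L k ν η))))
        where
        lemma : ∀ L k ν η → L * L * (k * ν * η) ≡ ν * (L * L * k * η)
        lemma = solve-∀
        lemma₂ : ∀ L a → L * a * (L * a) ≡ L * L * (a * a)
        lemma₂ = solve-∀
        pointwise : ∀ v → ν * ν * ι (dev-large v) ≤ L * L * (α v * α v)
        pointwise v with dev-large v in d
        ... | true  = ≤-trans (≤-reflexive (*-identityʳ (ν * ν))) (≤-trans (<⇒≤ (from-true (ν * ν <? (L * α v) * (L * α v)) d)) (≤-reflexive (lemma₂ L (α v))))
        ... | false = ≤-trans (≤-reflexive (*-zeroʳ (ν * ν))) (*-nonNeg (sq-nonNeg L) (sq-nonNeg (α v)))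

      off-total : ν * ν * ∑₂ (λ u v → ι (off u v)) ≤ L * L * ((k + + 2) * (ν * ν) * η)
      off-total = ≤-trans (subst₂ _≤_ (∑₂-* (ν * ν) (λ u v → ι (off u v))) (∑₂-* (L * L) (λ u v → ι (g u v) * (β u v * β u v))) (∑₂-mono pointwise))
        (_⊗_ {L * L} (sq-nonNeg L) (W-bound 0<k 0≤η 0<Y))
        where
        pointwise : ∀ u v → ν * ν * ι (off u v) ≤ L * L * (ι (g u v) * (β u v * β u v))
        pointwise u v with g u v
        ... | false = ≤-reflexive (lemma ν L (β u v))
          where
          lemma : ∀ ν L b → ν * ν * 0ℤ ≡ L * L * (0ℤ * (b * b))
          lemma = solve-∀
        ... | true with ∥ e u v ∥ <? L * ν - ν
        ...   | no _   = ≤-trans (≤-reflexive (*-zeroʳ (ν * ν))) (*-nonNeg (sq-nonNeg L) (*-nonNeg {1ℤ} 0≤+ (sq-nonNeg (β u v))))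
        ...   | yes lt = ≤-trans (≤-reflexive (*-identityʳ (ν * ν))) (≤-trans (sq-mono 0≤ν (<⇒≤ (small-codeg (subst (_< L * ν - ν) (∥∥-def (e u v)) lt)))) (≤-reflexive (lemma L (β u v))))
          where
          lemma : ∀ L b → - (L * b) * - (L * b) ≡ L * L * (1ℤ * (b * b))
          lemma = solve-∀
          small-codeg : k * L * codeg u v < L * ν - ν → ν < - (L * β u v)
          small-codeg lt = <-from lt (lemma₂ k L ν (codeg u v))
            where
            lemma₂ : ∀ k L ν d → - (L * (k * d - ν)) - ν ≡ L * ν - ν - k * L * d
            lemma₂ = solve-∀

      -- Markov twice: `W-bound` limits the number of thin pairs in total, and every vertex counted
      -- here is in many of them.
      few-count : ν * # few ≤ M * (L * L) * (k + + 2) * η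
      few-count = *-cancelˡ-≤ (*-pos 0<ν 0<ν) (≤-trans (_⊗_ {ν * ν} (sq-nonNeg ν) markov)
        (≤-trans (≤-reflexive (lemma₁ ν M (∑₂ (λ u v → ι (off u v))))) (≤-trans (0≤M ⊗ off-total) (≤-reflexive (lemma₂ ν M L k η)))))
        where
        lemma₁ : ∀ ν M x → ν * ν * (M * x) ≡ M * (ν * ν * x)
        lemma₁ = solve-∀
        lemma₂ : ∀ ν M L k η → M * (L * L * ((k + + 2) * (ν * ν) * η)) ≡ ν * ν * (M * (L * L) * (k + + 2) * η)
        lemma₂ = solve-∀
        markov : ν * # few ≤ M * ∑₂ (λ u v → ι (off u v))
        markov = subst₂ _≤_ (∑-* ν (λ u → ι (few u))) (∑-* M (λ u → # (off u))) (∑-mono pointwise)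
          where
          pointwise : ∀ u → ν * ι (few u) ≤ M * # (off u)
          pointwise u with few u in f
          ... | true  = ≤-trans (≤-reflexive (*-identityʳ ν)) (≤-trans (<⇒≤ (from-true (ν <? ∥ off u ∥) f)) (≤-reflexive (∥∥-def (off u))))
          ... | false = ≤-trans (≤-reflexive (*-zeroʳ ν)) (*-nonNeg 0≤M (0≤# (off u)))

      νb≤ : ν * b ≤ C₁ * η
      νb≤ = ≤-trans (0≤ν ⊗ ∑-mono λ v → ∪-pointwise (dev-large v) (few v)) (≤-trans (≤-reflexive (trans (cong (ν *_) (∑-+ (λ v → ι (dev-large v)) (λ v → ι (few v)))) (*-distribˡ-+ ν (# dev-large) (# few))))
        (≤-trans (dev-count ⊕ few-count) (≤-reflexive (sym (*-distribʳ-+ η (L * L * k) (M * (L * L) * (k + + 2)))))))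

      private
        S-elim : ∀ {v} → S v ≡ false → dev-large v ≡ false × few v ≡ false
        S-elim {v} = ∪-elim (dev-large v)

        Lα-sq : ∀ {v} → S v ≡ false → (L * α v) * (L * α v) ≤ ν * ν
        Lα-sq {v} Sv = ≮⇒≥ (from-false (ν * ν <? (L * α v) * (L * α v)) (proj₁ (S-elim {v} Sv)))

        ∥non∥ : ∀ v → ∥ non v ∥ ≡ k * L * nonDeg v
        ∥non∥ v = ∥∥-def (non v)

      regularity : Regularity H
      regularity = record
        { M = M
        ; c = L * ν
        ; δ = ν
        ; 0<M = 0<M
        ; 0<δ = 0<ν
        ; 100δ≤c = ≤-from (_⊗_ {+ 100 * ν} (*-nonNeg {+ 100} 0≤+ 0≤ν) 3≤k ⊕ *-nonNeg {+ 200} 0≤+ 0≤ν) (lemma₁ k ν)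
        ; 3c≤Mn = ≤-from (_⊗_ {L * ν} (*-nonNeg 0≤L 0≤ν) 3≤k) (lemma₂ k L ν)
        ; S = S
        ; size-lo = λ {v} Sv → ≤-trans (≤-from (sq-cancel {x = - (L * α v)} 0≤ν (≤-trans (≤-reflexive (neg-sq (L * α v))) (Lα-sq {v} Sv))) (lemma₃ k L ν (nonDeg v))) (≤-reflexive (sym (∥non∥ v)))
        ; size-hi = λ {v} Sv → ≤-trans (≤-reflexive (∥non∥ v)) (≤-from (sq-cancel {L * α v} 0≤ν (Lα-sq {v} Sv)) (lemma₄ k L ν (nonDeg v)))
        ; off-small = λ {v} Sv → ≮⇒≥ (from-false (ν <? ∥ off v ∥) (proj₂ (S-elim {v} Sv)))
        -- The only use of `small`: with `νb≤` it turns an `O(εn)` exceptional set into one below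
        -- the fixed tolerance.
        ; S-small = ≤-trans (≤-reflexive (∥∥-def S)) (*-cancelˡ-≤ 0<ν (≤-trans (≤-reflexive (lemma₅ ν M b)) (≤-trans (0≤M ⊗ νb≤) (≤-trans (≤-reflexive (sym (*-assoc M C₁ η))) small))))
        }
        where
        neg-sq : ∀ x → - x * - x ≡ x * x
        neg-sq = solve-∀
        lemma₁ : ∀ k ν → + 100 * k * ν - + 100 * ν ≡ + 100 * ν * k + + 200 * ν - (+ 100 * ν * + 3 + 0ℤ)
        lemma₁ = solve-∀
        lemma₂ : ∀ k L ν → k * L * ν - + 3 * (L * ν) ≡ L * ν * k - L * ν * + 3
        lemma₂ = solve-∀
        lemma₃ : ∀ k L ν a → k * L * a - (L * ν - ν) ≡ ν - - (L * (k * a - ν))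
        lemma₃ = solve-∀
        lemma₄ : ∀ k L ν a → L * ν + ν - k * L * a ≡ ν - L * (k * a - ν)
        lemma₄ = solve-∀
        lemma₅ : ∀ ν M b → ν * (M * b) ≡ M * (ν * b)
        lemma₅ = solve-∀

      module A = Assembly regularity

      8kδ≤c : + 8 * k * ν ≤ L * ν
      8kδ≤c = ≤-from (*-nonNeg (*-nonNeg {+ 92} 0≤+ 0≤k) 0≤ν) (lemma k ν)
        where
        lemma : ∀ k ν → + 100 * k * ν - + 8 * k * ν ≡ + 92 * k * ν - 0ℤ
        lemma = solve-∀

      2≤k : + 2 ≤ k
      2≤k = ≤-trans (+≤+ (ℕ.s≤s (ℕ.s≤s ℕ.z≤n))) 3≤k

      open A.WithClasses k L 2≤k 0<L refl refl refl 8kδ≤c using (N; good-bound)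

      Λ D A₁ : ℤ
      Λ = ∑ λ u → ι (S u) * ∑ (codeg u)
      D = ∑ λ u → ι (S u) * deg u
      A₁ = ∑ λ v → + ∣ α v ∣

      N+b : N + b ≡ ν
      N+b = trans (+-comm N b) (#-∁ S)

      E₆-split : E₆ ≤ A.E + (Λ + Λ + Λ)
      E₆-split = ≤-trans (∑₃-mono λ u v w → pointwise (S u) (S v) (S w) (e u v w)) (≤-reflexive (trans
        (∑₃-+ (λ u v w → ι (A.eᵍ u v w)) (λ u v w → ι (S u) * ι (e u v w) + ι (S v) * ι (e u v w) + ι (S w) * ι (e u v w)))
        (cong (_+_ A.E) (trans (∑₃-+ (λ u v w → ι (S u) * ι (e u v w) + ι (S v) * ι (e u v w)) (λ u v w → ι (S w) * ι (e u v w)))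
          (cong₂ _+_ (trans (∑₃-+ (λ u v w → ι (S u) * ι (e u v w)) (λ u v w → ι (S v) * ι (e u v w))) (cong₂ _+_ first second)) third)))))
        where
        pointwise : ∀ s t r x → ι x ≤ ι (not s ∧ (not t ∧ (not r ∧ x))) + (ι s * ι x + ι t * ι x + ι r * ι x)
        pointwise false false false true  = ≤-refl
        pointwise false false true  true  = ≤-refl
        pointwise false true  false true  = ≤-refl
        pointwise false true  true  true  = +≤+ (ℕ.s≤s ℕ.z≤n)
        pointwise true  false false true  = ≤-refl
        pointwise true  false true  true  = +≤+ (ℕ.s≤s ℕ.z≤n)
        pointwise true  true  false true  = +≤+ (ℕ.s≤s ℕ.z≤n)
        pointwise true  true  true  true  = +≤+ (ℕ.s≤s ℕ.z≤n)
        pointwise s t r false = +-nonNeg (0≤ι (not s ∧ (not t ∧ (not r ∧ false)))) (+-nonNeg (+-nonNeg (*-nonNeg (0≤ι s) (0≤ι false)) (*-nonNeg (0≤ι t) (0≤ι false))) (*-nonNeg (0≤ι r) (0≤ι false)))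
        first : ∑₃ (λ u v w → ι (S u) * ι (e u v w)) ≡ Λ
        first = ∑-cong λ u → ∑₂-* (ι (S u)) (λ v w → ι (e u v w))
        second : ∑₃ (λ u v w → ι (S v) * ι (e u v w)) ≡ Λ
        second = trans (∑-swap (λ u v → ∑ λ w → ι (S v) * ι (e u v w))) (trans (∑₃-cong λ v u w → cong (ι (S v) *_) (ι-cong e-swap e-swap)) first)
        third : ∑₃ (λ u v w → ι (S w) * ι (e u v w)) ≡ Λ
        third = trans (∑-cong λ u → ∑-swap (λ v w → ι (S w) * ι (e u v w))) (trans (∑₃-cong λ u w v → cong (ι (S w) *_) (ιe-swap₂₃ u v w)) second)

      D≤ : D ≤ b * ν
      D≤ = ≤-trans (∑-mono λ u → 0≤ι (S u) ⊗ #≤n (g u)) (≤-reflexive (∑-*ʳ ν (λ u → ι (S u))))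

      -- In the link inequality at `u` each neighbour contributes `n/k` up to its own deviation. The
      -- part `ν * deg u` is the exact rate at which the shadow pairs at `u` pay for its edges, so
      -- only `A₁` is lost per exceptional vertex.
      Λ≤ : k * Λ ≤ ν * D + b * A₁
      Λ≤ = subst₂ _≤_ (∑-* k (λ u → ι (S u) * ∑ (codeg u)))
          (trans (∑-+ (λ u → ν * (ι (S u) * deg u)) (λ u → ι (S u) * A₁)) (cong₂ _+_ (∑-* ν (λ u → ι (S u) * deg u)) (∑-*ʳ A₁ (λ u → ι (S u)))))
          (∑-mono pointwise)
        where
        link : ∀ u → k * ∑ (codeg u) ≤ ν * deg u + A₁
        link u = ≤-trans (0≤k ⊗ link-bound u) (≤-trans (subst₂ _≤_ (∑-* k (λ v → ι (g u v) * nonDeg v))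
            (trans (∑-+ (λ v → ν * ι (g u v)) (λ v → + ∣ α v ∣)) (cong (_+ A₁) (∑-* ν (λ v → ι (g u v))))) (∑-mono each)) ≤-refl)
          where
          each : ∀ v → k * (ι (g u v) * nonDeg v) ≤ ν * ι (g u v) + + ∣ α v ∣
          each v with g u v
          ... | true  = ≤-from ≤∣ α v ∣ (lemma k ν (nonDeg v) (+ ∣ α v ∣))
            where
            lemma : ∀ k ν a x → ν * 1ℤ + x - k * (1ℤ * a) ≡ x - (k * a - ν)
            lemma = solve-∀
          ... | false = ≤-from (0≤+ {∣ α v ∣}) (lemma k ν (nonDeg v) (+ ∣ α v ∣))
            where
            lemma : ∀ k ν a x → ν * 0ℤ + x - k * (0ℤ * a) ≡ x - 0ℤ
            lemma = solve-∀
        pointwise : ∀ u → k * (ι (S u) * ∑ (codeg u)) ≤ ν * (ι (S u) * deg u) + ι (S u) * A₁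
        pointwise u = ≤-from (0≤ι (S u) ⊗ link u) (lemma k ν (ι (S u)) (∑ (codeg u)) (deg u) A₁)
          where
          lemma : ∀ k ν s x d a → ν * (s * d) + s * a - k * (s * x) ≡ s * (ν * d + a) - s * (k * x)
          lemma = solve-∀

      private
        rows : ∑₂ (λ u v → ι (S u) * ι (g u v)) ≡ D
        rows = ∑-cong λ u → ∑-* (ι (S u)) (λ v → ι (g u v))

        columns : ∑₂ (λ u v → ι (S v) * ι (g u v)) ≡ D
        columns = trans (∑-swap (λ u v → ι (S v) * ι (g u v))) (trans (∑₂-cong λ v u → cong (ι (S v) *_) (ιg-sym u v)) rows)

        S×S : ∑₂ (λ u v → ι (S u) * ι (S v)) ≡ b * b
        S×S = trans (∑-cong λ u → ∑-* (ι (S u)) (λ v → ι (S v))) (∑-*ʳ b (λ u → ι (S u)))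

        regroup : ∑₂ (λ u v → ι (A.gᵍ u v) + (ι (S u) * ι (g u v) + ι (S v) * ι (g u v))) ≡ A.G + (D + D)
        regroup = trans (∑₂-+ (λ u v → ι (A.gᵍ u v)) (λ u v → ι (S u) * ι (g u v) + ι (S v) * ι (g u v)))
          (cong (_+_ A.G) (trans (∑₂-+ (λ u v → ι (S u) * ι (g u v)) (λ u v → ι (S v) * ι (g u v))) (cong₂ _+_ rows columns)))

      G₂-upper : G₂ ≤ A.G + (D + D)
      G₂-upper = ≤-trans (∑₂-mono λ u v → pointwise (S u) (S v) (g u v)) (≤-reflexive regroup)
        where
        pointwise : ∀ s t x → ι x ≤ ι (not s ∧ (not t ∧ x)) + (ι s * ι x + ι t * ι x)
        pointwise false false true  = ≤-refl
        pointwise false true  true  = ≤-refl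
        pointwise true  false true  = ≤-refl
        pointwise true  true  true  = +≤+ (ℕ.s≤s ℕ.z≤n)
        pointwise s t false = +-nonNeg (0≤ι (not s ∧ (not t ∧ false))) (+-nonNeg (*-nonNeg (0≤ι s) (0≤ι false)) (*-nonNeg (0≤ι t) (0≤ι false)))

      -- Pairs inside `S` are counted twice in `D + D`, hence `b * b`. Both directions are needed:
      -- `good-bound` holds `G` with coefficient `3kN = 3kν - 3kb`, and the two parts have opposite
      -- signs.
      G₂-lower : A.G + (D + D) ≤ G₂ + b * b
      G₂-lower = ≤-trans (≤-reflexive (sym regroup)) (≤-trans (∑₂-mono λ u v → pointwise (S u) (S v) (g u v))
        (≤-reflexive (trans (∑₂-+ (λ u v → ι (g u v)) (λ u v → ι (S u) * ι (S v))) (cong (_+_ G₂) S×S))))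
        where
        pointwise : ∀ s t x → ι (not s ∧ (not t ∧ x)) + (ι s * ι x + ι t * ι x) ≤ ι x + ι s * ι t
        pointwise false false true  = ≤-refl
        pointwise false true  true  = ≤-refl
        pointwise true  false true  = ≤-refl
        pointwise true  true  true  = ≤-refl
        pointwise false false false = ≤-refl
        pointwise false true  false = ≤-refl
        pointwise true  false false = ≤-refl
        pointwise true  true  false = 0≤+

      A₁-sq : A₁ * A₁ ≤ ν * V
      A₁-sq = ≤-trans (cauchy-schwarz (λ v → + ∣ α v ∣)) (≤-reflexive (cong (ν *_) (∑-cong λ v → ∣∣-sq (α v))))

      -- All terms of first order in ε cancel. With `b = O(εn)` and `A₁ = O(ε^(1/2) n²)` the first
      -- term is of order ε^(3/2) n³, and the other two are of order ε² n³.
      Y-upper : Y ≤ + 6 * k * b * A₁ + + 9 * k * ν * (b * b) + + 3 * b * η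
      Y-upper = combine ν E₆ A.E Λ D A₁ A.G G₂ (sym N+b) E₆-split Λ≤ G₂-upper G₂-lower D≤ good-bound
        where
        combine : ∀ ν E₆ E Λ D A₁ G G₂ → ν ≡ N + b → E₆ ≤ E + (Λ + Λ + Λ) → k * Λ ≤ ν * D + b * A₁ →
          G₂ ≤ G + (D + D) → G + (D + D) ≤ G₂ + b * b → D ≤ b * ν → + 2 * (k * k) * E ≤ + 3 * (k * N * G) - (k - 1ℤ) * (N * N * N) →
          + 2 * (k * k) * E₆ - + 2 * (k - 1ℤ) * (ν * ν * ν) + + 3 * (((k - 1ℤ) * (ν * ν) - k * G₂) * ν) ≤
          + 6 * k * b * A₁ + + 9 * k * ν * (b * b) + + 3 * b * ((k - 1ℤ) * (ν * ν) - k * G₂)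
        combine _ E₆ E Λ D A₁ G G₂ refl h₁ h₂ h₃ h₄ h₅ h₆ = ≤-from
          (_⊗_ {+ 2 * (k * k)} (*-nonNeg {+ 2} 0≤+ (sq-nonNeg k)) h₁ ⊕ _⊗_ {+ 6 * k} (*-nonNeg {+ 6} 0≤+ 0≤k) h₂ ⊕ _⊗_ {+ 3 * k * b} (*-nonNeg (*-nonNeg {+ 3} 0≤+ 0≤k) 0≤b) h₃
            ⊕ _⊗_ {+ 3 * k * (N + b)} (*-nonNeg (*-nonNeg {+ 3} 0≤+ 0≤k) (+-nonNeg 0≤N 0≤b)) h₄ ⊕ _⊗_ {+ 6 * k * b} (*-nonNeg (*-nonNeg {+ 6} 0≤+ 0≤k) 0≤b) h₅ ⊕ h₆
            ⊕ *-nonNeg (*-nonNeg (i≤j⇒0≤j-i 1≤k) (sq-nonNeg b)) (+-nonNeg 0≤N (*-nonNeg {+ 2} 0≤+ (+-nonNeg 0≤N 0≤b))))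
          (lemma k N b E₆ E Λ D A₁ G G₂)
          where
          0≤b : 0ℤ ≤ b
          0≤b = 0≤# S
          0≤N : 0ℤ ≤ N
          0≤N = 0≤# A.good
          1≤k : 1ℤ ≤ k
          1≤k = ≤-trans (+≤+ (ℕ.s≤s ℕ.z≤n)) 3≤k
          lemma : ∀ k N b E₆ E Λ D A₁ G G₂ →
            + 6 * k * b * A₁ + + 9 * k * (N + b) * (b * b) + + 3 * b * ((k - 1ℤ) * ((N + b) * (N + b)) - k * G₂)
              - (+ 2 * (k * k) * E₆ - + 2 * (k - 1ℤ) * ((N + b) * (N + b) * (N + b)) + + 3 * (((k - 1ℤ) * ((N + b) * (N + b)) - k * G₂) * (N + b))) ≡
            + 2 * (k * k) * (E + (Λ + Λ + Λ)) + + 6 * k * ((N + b) * D + b * A₁) + + 3 * k * b * (G + (D + D)) + + 3 * k * (N + b) * (G₂ + b * b) + + 6 * k * b * (b * (N + b))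
              + (+ 3 * (k * N * G) - (k - 1ℤ) * (N * N * N)) + (k - 1ℤ) * (b * b) * (N + + 2 * (N + b))
              - (+ 2 * (k * k) * E₆ + + 6 * k * (k * Λ) + + 3 * k * b * G₂ + + 3 * k * (N + b) * (G + (D + D)) + + 6 * k * b * D + + 2 * (k * k) * E + 0ℤ)
          lemma = solve-∀

      private
        η≤ν² : η ≤ ν * ν
        η≤ν² = ≤-trans (≤-trans (≤-reflexive (sym (*-identityˡ η))) (*-monoʳ-≤-nonNeg η {{nonNegative 0≤η}} (<⇒1+≤ 0<C₂))) small

        νb-sq : (ν * b) * (ν * b) ≤ (C₁ * η) * (C₁ * η)
        νb-sq = sq-mono (*-nonNeg 0≤ν (0≤# S)) νb≤

        -- One factor `η` is given up against `ν²`, so that the terms of order ε² can be written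
        -- with the same `η³` as the main one.
        b-sq : b * b ≤ C₁ * C₁ * η
        b-sq = *-cancelˡ-≤ (*-pos 0<ν 0<ν) (≤-from (νb-sq ⊕ (*-nonNeg (sq-nonNeg C₁) 0≤η ⊗ η≤ν²)) (lemma ν b C₁ η))
          where
          lemma : ∀ ν b C η → ν * ν * (C * C * η) - ν * ν * (b * b) ≡ (C * η) * (C * η) + C * C * η * (ν * ν) - ((ν * b) * (ν * b) + C * C * η * η)
          lemma = solve-∀

      -- Every square is reduced to `η³`: the first term through Cauchy-Schwarz, `V-bound` and
      -- `νb≤`, the second through `νb≤` and `b-sq`, the third through `b-sq`.
      Y-sq : Y * Y ≤ C₃ * (η * η * η)
      Y-sq = ≤-trans (sq-mono (<⇒≤ 0<Y) Y-upper) (combine b A₁ V η C₁ A₁-sq (V-bound 0≤η 0<Y) νb-sq b-sq 0≤η)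
        where
        combine : ∀ b A V η C → A * A ≤ ν * V → V ≤ k * ν * η → (ν * b) * (ν * b) ≤ (C * η) * (C * η) → b * b ≤ C * C * η → 0ℤ ≤ η →
          (+ 6 * k * b * A + + 9 * k * ν * (b * b) + + 3 * b * η) * (+ 6 * k * b * A + + 9 * k * ν * (b * b) + + 3 * b * η) ≤
          + 3 * (+ 36 * (k * k * k) * (C * C) + + 81 * (k * k) * ((C * C) * (C * C)) + + 9 * (C * C)) * (η * η * η)
        combine b A V η C h₁ h₂ h₃ h₄ 0≤η = ≤-trans (three x y z) (≤-from
          (_⊗_ {+ 108 * (k * k) * (b * b)} (*-nonNeg (*-nonNeg {+ 108} 0≤+ (sq-nonNeg k)) (sq-nonNeg b)) h₁
            ⊕ _⊗_ {+ 108 * (k * k) * (b * b) * ν} (*-nonNeg (*-nonNeg (*-nonNeg {+ 108} 0≤+ (sq-nonNeg k)) (sq-nonNeg b)) 0≤ν) h₂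
            ⊕ _⊗_ {+ 108 * (k * k) * k * η} (*-nonNeg (*-nonNeg (*-nonNeg {+ 108} 0≤+ (sq-nonNeg k)) 0≤k) 0≤η) h₃
            ⊕ _⊗_ {+ 243 * (k * k) * (b * b)} (*-nonNeg (*-nonNeg {+ 243} 0≤+ (sq-nonNeg k)) (sq-nonNeg b)) h₃
            ⊕ _⊗_ {+ 243 * (k * k) * ((C * η) * (C * η))} (*-nonNeg (*-nonNeg {+ 243} 0≤+ (sq-nonNeg k)) (sq-nonNeg (C * η))) h₄
            ⊕ _⊗_ {+ 27 * (η * η)} (*-nonNeg {+ 27} 0≤+ (sq-nonNeg η)) h₄)
          (lemma k ν b A V η C))
          where
          x y z : ℤ
          x = + 6 * k * b * A
          y = + 9 * k * ν * (b * b)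
          z = + 3 * b * η
          three : ∀ x y z → (x + y + z) * (x + y + z) ≤ + 3 * (x * x + y * y + z * z)
          three x y z = ≤-from (sq-nonNeg (x - y) ⊕ sq-nonNeg (y - z) ⊕ sq-nonNeg (x - z)) (lemma₀ x y z)
            where
            lemma₀ : ∀ x y z → + 3 * (x * x + y * y + z * z) - (x + y + z) * (x + y + z) ≡
              (x - y) * (x - y) + (y - z) * (y - z) + (x - z) * (x - z) - (0ℤ + 0ℤ + 0ℤ)
            lemma₀ = solve-∀
          lemma : ∀ k ν b A V η C →
            + 3 * (+ 36 * (k * k * k) * (C * C) + + 81 * (k * k) * ((C * C) * (C * C)) + + 9 * (C * C)) * (η * η * η)
              - + 3 * (+ 6 * k * b * A * (+ 6 * k * b * A) + + 9 * k * ν * (b * b) * (+ 9 * k * ν * (b * b)) + + 3 * b * η * (+ 3 * b * η)) ≡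
            + 108 * (k * k) * (b * b) * (ν * V) + + 108 * (k * k) * (b * b) * ν * (k * ν * η) + + 108 * (k * k) * k * η * ((C * η) * (C * η))
              + + 243 * (k * k) * (b * b) * ((C * η) * (C * η)) + + 243 * (k * k) * ((C * η) * (C * η)) * (C * C * η) + + 27 * (η * η) * (C * C * η)
              - (+ 108 * (k * k) * (b * b) * (A * A) + + 108 * (k * k) * (b * b) * ν * V + + 108 * (k * k) * k * η * ((ν * b) * (ν * b))
                + + 243 * (k * k) * (b * b) * ((ν * b) * (ν * b)) + + 243 * (k * k) * ((C * η) * (C * η)) * (b * b) + + 27 * (η * η) * (b * b))
          lemma = solve-∀

-- From families of subsets to sums over ordered tuples.

module Shadows where

  open Combinatorics
  open import Defs
  open import Data.Bool using (Bool; true; false; _∧_)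
  open import Data.Bool.Properties using (T-≡)
  open import Data.Bool.ListAction using (any)
  open import Data.Fin using (Fin; zero; suc)
  open import Data.Fin.Subset using (Subset; ⊥; ⁅_⁆; inside; outside) renaming (_∪_ to _∪ˢ_; _⊆_ to _⊆ˢ_; _∈_ to _∈ˢ_; _∉_ to _∉ˢ_; ∣_∣ to ∣_∣ˢ; _─_ to _─ˢ_)
  open import Data.Fin.Subset.Properties using (∪-comm; ∪-assoc; ∪-idem; ∪-identityˡ; ∪-identityʳ; ∣⊥∣≡0; ∣⁅x⁆∣≡1; x∈⁅x⁆; x∈⁅y⁆⇒x≡y; x∈p∪q⁺; x∈p∪q⁻; _⊆?_)
  open import Data.Integer hiding (suc)
  open import Data.Integer.Properties
  open import Data.Integer.Tactic.RingSolver
  open import Data.List using (List; []; _∷_; _++_; map; length; filterᵇ)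
  open import Data.List.Membership.Propositional using () renaming (_∈_ to _∈ˡ_)
  open import Data.List.Membership.Propositional.Properties using (∈-map⁺; ∈-++⁺ˡ; ∈-++⁺ʳ)
  open import Data.List.Relation.Unary.Any as Any using (here; satisfied)
  open import Data.List.Relation.Unary.Any.Properties using (any⁺; any⁻)
  import Data.Nat as ℕ
  import Data.Nat.Properties as ℕ
  open import Data.Nat using (ℕ; zero; suc)
  open import Data.Product using (∃; _×_; _,_; proj₁; proj₂)
  open import Data.Sum using (_⊎_; inj₁; inj₂)
  import Data.Empty as Empty
  open import Data.Empty using (⊥-elim)
  open import Data.Vec using ([]; _∷_; here; there)
  open import Function using (_∘_; Equivalence)
  open import Relation.Nullary using (does)
  open import Relation.Binary.PropositionalEquality

  count : ∀ {A : Set} → (A → Bool) → List A → ℤ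
  count f xs = + length (filterᵇ f xs)

  count-∷ : ∀ {A : Set} (f : A → Bool) x xs → count f (x ∷ xs) ≡ ι (f x) + count f xs
  count-∷ f x xs with f x
  ... | true  = refl
  ... | false = refl

  count-++ : ∀ {A : Set} (f : A → Bool) xs ys → count f (xs ++ ys) ≡ count f xs + count f ys
  count-++ f []       ys = sym (+-identityˡ (count f ys))
  count-++ f (x ∷ xs) ys = trans (count-∷ f x (xs ++ ys)) (trans (cong (_+_ (ι (f x))) (count-++ f xs ys))
    (trans (sym (+-assoc (ι (f x)) (count f xs) (count f ys))) (cong (_+ count f ys) (sym (count-∷ f x xs)))))

  count-map : ∀ {A B : Set} (f : B → Bool) (h : A → B) xs → count f (map h xs) ≡ count (f ∘ h) xs
  count-map f h []       = refl
  count-map f h (x ∷ xs) = trans (count-∷ f (h x) (map h xs)) (trans (cong (_+_ (ι (f (h x)))) (count-map f h xs)) (sym (count-∷ (f ∘ h) x xs)))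

  #sets : ∀ n → (Subset n → Bool) → ℤ
  #sets n f = count f (allSubsets n)

  #sets-suc : ∀ n f → #sets (suc n) f ≡ #sets n (f ∘ (outside ∷_)) + #sets n (f ∘ (inside ∷_))
  #sets-suc n f = trans (count-++ f (map (outside ∷_) (allSubsets n)) (map (inside ∷_) (allSubsets n)))
    (cong₂ _+_ (count-map f (outside ∷_) (allSubsets n)) (count-map f (inside ∷_) (allSubsets n)))

  OfSize : ∀ {n} → ℕ → (Subset n → Bool) → Set
  OfSize m f = ∀ A → f A ≡ true → ∣ A ∣ˢ ≡ m

  OfSize-outside : ∀ {n m} {f : Subset (suc n) → Bool} → OfSize m f → OfSize m (f ∘ (outside ∷_))
  OfSize-outside h A = h (outside ∷ A)

  OfSize-inside : ∀ {n m} {f : Subset (suc n) → Bool} → OfSize (suc m) f → OfSize m (f ∘ (inside ∷_))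
  OfSize-inside h A t = ℕ.suc-injective (h (inside ∷ A) t)

  OfSize-≢ : ∀ {n m} {f : Subset n → Bool} → OfSize m f → ∀ A → ∣ A ∣ˢ ≢ m → ι (f A) ≡ 0ℤ
  OfSize-≢ h A ne = cong ι (≢true λ t → ne (h A t))

  ∑₂-suc : ∀ {n} (φ : Fin (suc n) → Fin (suc n) → ℤ) →
    ∑₂ φ ≡ (φ zero zero + ∑ (λ v → φ zero (suc v))) + (∑ (λ u → φ (suc u) zero) + ∑₂ (λ u v → φ (suc u) (suc v)))
  ∑₂-suc φ = trans (∑-suc (λ u → ∑ (φ u))) (cong₂ _+_ (∑-suc (φ zero))
    (trans (∑-cong λ u → ∑-suc (φ (suc u))) (∑-+ (λ u → φ (suc u) zero) (λ u → ∑ λ v → φ (suc u) (suc v)))))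

  #sets₀ : ∀ n {f} → OfSize 0 f → #sets n f ≡ ι (f ⊥)
  #sets₀ zero    {f} h = trans (count-∷ f [] []) (+-identityʳ (ι (f [])))
  #sets₀ (suc n) {f} h = trans (#sets-suc n f) (trans (cong₂ _+_ (#sets₀ n (OfSize-outside h)) none) (+-identityʳ _))
    where
    empty : ∀ xs → count (f ∘ (inside ∷_)) xs ≡ 0ℤ
    empty []       = refl
    empty (A ∷ xs) = trans (count-∷ (f ∘ (inside ∷_)) A xs) (cong₂ _+_ (OfSize-≢ h (inside ∷ A) (λ ())) (empty xs))
    none : #sets n (f ∘ (inside ∷_)) ≡ 0ℤ
    none = empty (allSubsets n)

  #sets₁ : ∀ n {f} → OfSize 1 f → #sets n f ≡ ∑ (λ u → ι (f ⁅ u ⁆))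
  #sets₁ zero    {f} h = trans (trans (count-∷ f [] []) (trans (+-identityʳ _) (OfSize-≢ h [] (λ ())))) (sym (∑-zero _))
  #sets₁ (suc n) {f} h = trans (#sets-suc n f) (trans (cong₂ _+_ (#sets₁ n (OfSize-outside h)) (#sets₀ n (OfSize-inside h)))
    (trans (+-comm (∑ λ u → ι (f (outside ∷ ⁅ u ⁆))) (ι (f (inside ∷ ⊥)))) (sym (∑-suc λ u → ι (f ⁅ u ⁆)))))

  -- A repeated vertex produces a smaller union, on which `f` vanishes, so the double sum sees each
  -- 2-set exactly twice. The induction separates the tuples that use the vertex `zero`.
  #sets₂ : ∀ n {f} → OfSize 2 f → + 2 * #sets n f ≡ ∑₂ (λ u v → ι (f (⁅ u ⁆ ∪ˢ ⁅ v ⁆)))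
  #sets₂ zero    {f} h = trans (cong (+ 2 *_) (trans (count-∷ f [] []) (trans (+-identityʳ _) (OfSize-≢ h [] (λ ()))))) (sym (∑-zero _))
  #sets₂ (suc n) {f} h = begin
    + 2 * #sets (suc n) f
      ≡⟨ trans (cong (+ 2 *_) (#sets-suc n f)) (*-distribˡ-+ (+ 2) (#sets n (f ∘ (outside ∷_))) (#sets n (f ∘ (inside ∷_)))) ⟩
    + 2 * #sets n (f ∘ (outside ∷_)) + + 2 * #sets n (f ∘ (inside ∷_))
      ≡⟨ cong₂ (λ x y → x + + 2 * y) (#sets₂ n (OfSize-outside h)) (#sets₁ n (OfSize-inside h)) ⟩
    O + + 2 * I
      ≡⟨ lemma O I ⟩
    (0ℤ + I) + (I + O)
      ≡⟨ cong₂ (λ x y → x + (y + O)) (cong₂ _+_ (sym corner) (∑-cong λ v → cong (λ A → ι (f (inside ∷ A))) (sym (∪-identityˡ ⁅ v ⁆))))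
           (∑-cong λ u → cong (λ A → ι (f (inside ∷ A))) (sym (∪-identityʳ ⁅ u ⁆))) ⟩
    (ι (f (⁅ zero ⁆ ∪ˢ ⁅ zero ⁆)) + ∑ (λ v → ι (f (⁅ zero ⁆ ∪ˢ ⁅ suc v ⁆)))) + (∑ (λ u → ι (f (⁅ suc u ⁆ ∪ˢ ⁅ zero ⁆))) + O)
      ≡⟨ sym (∑₂-suc λ u v → ι (f (⁅ u ⁆ ∪ˢ ⁅ v ⁆))) ⟩
    ∑₂ (λ u v → ι (f (⁅ u ⁆ ∪ˢ ⁅ v ⁆))) ∎
    where
    open ≡-Reasoning
    I O : ℤ
    I = ∑ λ v → ι (f (inside ∷ ⁅ v ⁆))
    O = ∑₂ λ u v → ι (f (outside ∷ (⁅ u ⁆ ∪ˢ ⁅ v ⁆)))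
    lemma : ∀ O I → O + + 2 * I ≡ (0ℤ + I) + (I + O)
    lemma = solve-∀
    corner : ι (f (⁅ zero ⁆ ∪ˢ ⁅ zero ⁆)) ≡ 0ℤ
    corner = OfSize-≢ h (⁅ zero ⁆ ∪ˢ ⁅ zero ⁆) (λ eq → 1≢2 (trans (sym (trans (cong ∣_∣ˢ (∪-idem ⁅ zero {n} ⁆)) (∣⁅x⁆∣≡1 (zero {n})))) eq))
      where
      1≢2 : 1 ≢ 2
      1≢2 ()

  -- As for pairs: a set through `zero` comes from a pair of the remaining vertices, and `zero` may
  -- stand in any of three positions, so `6 = 3 * 2`.
  #sets₃ : ∀ n {f} → OfSize 3 f → + 6 * #sets n f ≡ ∑₃ (λ u v w → ι (f (⁅ u ⁆ ∪ˢ (⁅ v ⁆ ∪ˢ ⁅ w ⁆))))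
  #sets₃ zero    {f} h = trans (cong (+ 6 *_) (trans (count-∷ f [] []) (trans (+-identityʳ _) (OfSize-≢ h [] (λ ()))))) (sym (∑-zero _))
  #sets₃ (suc n) {f} h = begin
    + 6 * #sets (suc n) f
      ≡⟨ trans (cong (+ 6 *_) (#sets-suc n f)) (*-distribˡ-+ (+ 6) (#sets n (f ∘ (outside ∷_))) (#sets n (f ∘ (inside ∷_)))) ⟩
    + 6 * #sets n (f ∘ (outside ∷_)) + + 6 * #sets n (f ∘ (inside ∷_))
      ≡⟨ cong₂ _+_ (#sets₃ n (OfSize-outside h)) (trans (*-assoc (+ 3) (+ 2) (#sets n (f ∘ (inside ∷_)))) (cong (+ 3 *_) (#sets₂ n (OfSize-inside h)))) ⟩
    O + + 3 * I
      ≡⟨ lemma O I ⟩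
    I + (I + (I + O))
      ≡⟨ cong₂ _+_ (sym at-zero) (sym after-zero) ⟩
    ∑₂ (φ zero) + ∑ (λ u → ∑₂ (φ (suc u)))
      ≡⟨ sym (∑-suc λ u → ∑₂ (φ u)) ⟩
    ∑₃ φ ∎
    where
    open ≡-Reasoning
    φ : Fin (suc n) → Fin (suc n) → Fin (suc n) → ℤ
    φ u v w = ι (f (⁅ u ⁆ ∪ˢ (⁅ v ⁆ ∪ˢ ⁅ w ⁆)))
    I O : ℤ
    I = ∑₂ λ u v → ι (f (inside ∷ (⁅ u ⁆ ∪ˢ ⁅ v ⁆)))
    O = ∑₃ λ u v w → ι (f (outside ∷ (⁅ u ⁆ ∪ˢ (⁅ v ⁆ ∪ˢ ⁅ w ⁆))))
    lemma : ∀ O I → O + + 3 * I ≡ I + (I + (I + O))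
    lemma = solve-∀
    inner : Subset n → ℤ
    inner A = ι (f (inside ∷ A))
    small : ∀ {A B} → A ≡ B → ∣ B ∣ˢ ℕ.≤ 1 → inner A ≡ 0ℤ
    small refl le = OfSize-≢ h (inside ∷ _) (λ eq → ℕ.1+n≰n (ℕ.≤-trans (ℕ.≤-reflexive (sym (ℕ.suc-injective eq))) le))
    small-singleton : ∀ {A} v → A ≡ ⁅ v ⁆ → inner A ≡ 0ℤ
    small-singleton v eq = small eq (ℕ.≤-reflexive (∣⁅x⁆∣≡1 v))
    ⊥-small : ∀ {A} → A ≡ ⊥ → inner A ≡ 0ℤ
    ⊥-small eq = small eq (ℕ.≤-trans (ℕ.≤-reflexive (∣⊥∣≡0 n)) ℕ.z≤n)
    at-zero : ∑₂ (φ zero) ≡ I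
    at-zero = trans (∑₂-suc (φ zero)) (trans (cong₂ _+_
      (cong₂ _+_ (⊥-small (trans (∪-identityˡ _) (∪-identityˡ ⊥))) (∑-zeros λ v → small-singleton v (trans (∪-identityˡ _) (∪-identityˡ ⁅ v ⁆))))
      (cong₂ _+_ (∑-zeros λ u → small-singleton u (trans (∪-identityˡ _) (∪-identityʳ ⁅ u ⁆))) (∑₂-cong λ u v → cong inner (∪-identityˡ (⁅ u ⁆ ∪ˢ ⁅ v ⁆)))))
      (trans (+-identityˡ (0ℤ + I)) (+-identityˡ I)))
    O′ : Fin n → ℤ
    O′ u = ∑₂ λ v w → ι (f (outside ∷ (⁅ u ⁆ ∪ˢ (⁅ v ⁆ ∪ˢ ⁅ w ⁆))))
    after-zero : ∑ (λ u → ∑₂ (φ (suc u))) ≡ I + (I + O)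
    after-zero = trans (∑-cong row) (trans (∑-+ I′ (λ u → I′ u + O′ u)) (cong (_+_ I) (∑-+ I′ O′)))
      where
      I′ : Fin n → ℤ
      I′ u = ∑ λ v → inner (⁅ u ⁆ ∪ˢ ⁅ v ⁆)
      row : ∀ u → ∑₂ (φ (suc u)) ≡ I′ u + (I′ u + O′ u)
      row u = trans (∑₂-suc (φ (suc u))) (cong₂ _+_
        (trans (cong₂ _+_ (small-singleton u (trans (cong (⁅ u ⁆ ∪ˢ_) (∪-identityˡ ⊥)) (∪-identityʳ ⁅ u ⁆)))
                          (∑-cong λ v → cong (λ A → inner (⁅ u ⁆ ∪ˢ A)) (∪-identityˡ ⁅ v ⁆))) (+-identityˡ (I′ u)))
        (cong (_+ O′ u) (∑-cong λ v → cong (λ A → inner (⁅ u ⁆ ∪ˢ A)) (∪-identityʳ ⁅ v ⁆))))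

  ∣p∪q∣≤∣p∣+∣q∣ : ∀ {n} (p q : Subset n) → ∣ p ∪ˢ q ∣ˢ ℕ.≤ ∣ p ∣ˢ ℕ.+ ∣ q ∣ˢ
  ∣p∪q∣≤∣p∣+∣q∣ []            []            = ℕ.z≤n
  ∣p∪q∣≤∣p∣+∣q∣ (outside ∷ p) (outside ∷ q) = ∣p∪q∣≤∣p∣+∣q∣ p q
  ∣p∪q∣≤∣p∣+∣q∣ (outside ∷ p) (inside ∷ q)  = ℕ.≤-trans (ℕ.s≤s (∣p∪q∣≤∣p∣+∣q∣ p q)) (ℕ.≤-reflexive (sym (ℕ.+-suc ∣ p ∣ˢ ∣ q ∣ˢ)))
  ∣p∪q∣≤∣p∣+∣q∣ (inside ∷ p)  (outside ∷ q) = ℕ.s≤s (∣p∪q∣≤∣p∣+∣q∣ p q)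
  ∣p∪q∣≤∣p∣+∣q∣ (inside ∷ p)  (inside ∷ q)  = ℕ.s≤s (ℕ.≤-trans (∣p∪q∣≤∣p∣+∣q∣ p q) (ℕ.+-monoʳ-≤ ∣ p ∣ˢ (ℕ.n≤1+n ∣ q ∣ˢ)))

  x∈p─q⁻ : ∀ {n} {x : Fin n} (p q : Subset n) → x ∈ˢ (p ─ˢ q) → x ∈ˢ p × x ∉ˢ q
  x∈p─q⁻ {x = zero} (inside ∷ p)  (outside ∷ q) here = here , λ ()
  x∈p─q⁻ {x = zero} (outside ∷ p) (inside ∷ q)  ()
  x∈p─q⁻ {x = zero} (outside ∷ p) (outside ∷ q) ()
  x∈p─q⁻ (_ ∷ p) (_ ∷ q) (there h) = let h₁ , h₂ = x∈p─q⁻ p q h in there h₁ , λ { (there h₃) → h₂ h₃ }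

  ∈-allSubsets : ∀ {n} (A : Subset n) → A ∈ˡ allSubsets n
  ∈-allSubsets [] = here refl
  ∈-allSubsets {suc n} (outside ∷ A) = ∈-++⁺ˡ (∈-map⁺ (outside ∷_) (∈-allSubsets A))
  ∈-allSubsets {suc n} (inside ∷ A)  = ∈-++⁺ʳ (map (outside ∷_) (allSubsets n)) (∈-map⁺ (inside ∷_) (∈-allSubsets A))

  any-intro : ∀ {n} (P : Subset n → Bool) A → P A ≡ true → any P (allSubsets n) ≡ true
  any-intro {n} P A t = Equivalence.to T-≡ (any⁺ P (Any.map (λ { refl → Equivalence.from T-≡ t }) (∈-allSubsets A)))

  any-elim : ∀ {n} (P : Subset n → Bool) → any P (allSubsets n) ≡ true → ∃ λ A → P A ≡ true
  any-elim {n} P t = let A , h = satisfied (any⁻ P (allSubsets n) (Equivalence.from T-≡ t)) in A , Equivalence.to T-≡ h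

  module Bridge {n : ℕ} (H : Graph3 n) (canc : Cancellative H) where

    pair : Fin n → Fin n → Subset n
    pair u v = ⁅ u ⁆ ∪ˢ ⁅ v ⁆

    triple : Fin n → Fin n → Fin n → Subset n
    triple u v w = ⁅ u ⁆ ∪ˢ pair v w

    private
      ∣pair∣≤2 : ∀ u v → ∣ pair u v ∣ˢ ℕ.≤ 2
      ∣pair∣≤2 u v = ℕ.≤-trans (∣p∪q∣≤∣p∣+∣q∣ ⁅ u ⁆ ⁅ v ⁆) (ℕ.≤-reflexive (cong₂ ℕ._+_ (∣⁅x⁆∣≡1 u) (∣⁅x⁆∣≡1 v)))

      triple-rot : ∀ u v w → triple u v w ≡ triple v w u
      triple-rot u v w = trans (∪-comm ⁅ u ⁆ (pair v w)) (∪-assoc ⁅ v ⁆ ⁅ w ⁆ ⁅ u ⁆)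

      triple-swap : ∀ u v w → triple u v w ≡ triple v u w
      triple-swap u v w = trans (sym (∪-assoc ⁅ u ⁆ ⁅ v ⁆ ⁅ w ⁆)) (trans (cong (_∪ˢ ⁅ w ⁆) (∪-comm ⁅ u ⁆ ⁅ v ⁆)) (∪-assoc ⁅ v ⁆ ⁅ u ⁆ ⁅ w ⁆))

      ∣pair∣ : ∀ {u v w} → ∣ triple u v w ∣ˢ ≡ 3 → ∣ pair u v ∣ˢ ≡ 2
      ∣pair∣ {u} {v} {w} eq = ℕ.≤-antisym (∣pair∣≤2 u v) (ℕ.+-cancelʳ-≤ 1 2 ∣ pair u v ∣ˢ (ℕ.≤-trans (ℕ.≤-reflexive (sym eq))
        (ℕ.≤-trans (ℕ.≤-reflexive (cong ∣_∣ˢ (sym (∪-assoc ⁅ u ⁆ ⁅ v ⁆ ⁅ w ⁆)))) (ℕ.≤-trans (∣p∪q∣≤∣p∣+∣q∣ (pair u v) ⁅ w ⁆) (ℕ.≤-reflexive (cong (∣ pair u v ∣ˢ ℕ.+_) (∣⁅x⁆∣≡1 w)))))))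

      pair-≢ : ∀ {u v} → ∣ pair u v ∣ˢ ≡ 2 → u ≢ v
      pair-≢ {u} eq refl with trans (sym (trans (cong ∣_∣ˢ (∪-idem ⁅ u ⁆)) (∣⁅x⁆∣≡1 u))) eq
      ... | ()

      distinct : ∀ {u v w} → edge H (triple u v w) ≡ true → u ≢ w × v ≢ w
      distinct {u} {v} {w} h =
        (λ eq → pair-≢ (∣pair∣ {w} {u} {v} (trans (cong ∣_∣ˢ (triple-rot w u v)) (uniform H _ h))) (sym eq)) ,
        pair-≢ (∣pair∣ {v} {w} {u} (trans (cong ∣_∣ˢ (sym (triple-rot u v w))) (uniform H _ h)))

      in-triple : ∀ {x} u v w → x ∈ˢ triple u v w → x ≡ u ⊎ x ≡ v ⊎ x ≡ w
      in-triple u v w h with x∈p∪q⁻ ⁅ u ⁆ (pair v w) h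
      ... | inj₁ h₁ = inj₁ (x∈⁅y⁆⇒x≡y u h₁)
      ... | inj₂ h₁ with x∈p∪q⁻ ⁅ v ⁆ ⁅ w ⁆ h₁
      ...   | inj₁ h₂ = inj₂ (inj₁ (x∈⁅y⁆⇒x≡y v h₂))
      ...   | inj₂ h₂ = inj₂ (inj₂ (x∈⁅y⁆⇒x≡y w h₂))

      u∈triple : ∀ u v w → u ∈ˢ triple u v w
      u∈triple u v w = x∈p∪q⁺ (inj₁ (x∈⁅x⁆ u))

      v∈triple : ∀ u v w → v ∈ˢ triple u v w
      v∈triple u v w = x∈p∪q⁺ (inj₂ (x∈p∪q⁺ (inj₁ (x∈⁅x⁆ v))))

      w∈triple : ∀ u v w → w ∈ˢ triple u v w
      w∈triple u v w = x∈p∪q⁺ (inj₂ (x∈p∪q⁺ (inj₂ (x∈⁅x⁆ w))))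

      last : ∀ {x} u v w w′ → x ∈ˢ triple u v w × x ∉ˢ triple u v w′ → x ≡ w
      last u v w w′ (h , h′) with in-triple u v w h
      ... | inj₁ refl        = ⊥-elim (h′ (u∈triple u v w′))
      ... | inj₂ (inj₁ refl) = ⊥-elim (h′ (v∈triple u v w′))
      ... | inj₂ (inj₂ eq)   = eq

      in-△ : ∀ {x} u v w w′ → x ∈ˢ (triple u v w △ triple u v w′) → x ≡ w ⊎ x ≡ w′
      in-△ u v w w′ h with x∈p∪q⁻ (triple u v w ─ˢ triple u v w′) (triple u v w′ ─ˢ triple u v w) h
      ... | inj₁ h₁ = inj₁ (last u v w w′ (x∈p─q⁻ (triple u v w) (triple u v w′) h₁))
      ... | inj₂ h₁ = inj₂ (last u v w′ w (x∈p─q⁻ (triple u v w′) (triple u v w) h₁))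

      shadow-elim : ∀ {A} → inShadow H A ≡ true → ∣ A ∣ˢ ≡ 2 × ∃ λ B → edge H B ≡ true × A ⊆ˢ B
      shadow-elim {A} t with ∩-elim (∣ A ∣ˢ ℕ.≡ᵇ 2) t
      ... | t₁ , t₂ with any-elim (λ B → edge H B ∧ does (A ⊆? B)) t₂
      ...   | B , t₃ with ∩-elim (edge H B) t₃
      ...     | t₄ , t₅ = ℕ.≡ᵇ⇒≡ ∣ A ∣ˢ 2 (Equivalence.from T-≡ t₁) , B , t₄ , from-true (A ⊆? B) t₅

      shadow-intro : ∀ {A B} → ∣ A ∣ˢ ≡ 2 → edge H B ≡ true → A ⊆ˢ B → inShadow H A ≡ true
      shadow-intro {A} {B} eq t sub = ∩-intro (Equivalence.to T-≡ (ℕ.≡⇒≡ᵇ ∣ A ∣ˢ 2 eq)) (any-intro (λ B → edge H B ∧ does (A ⊆? B)) B (∩-intro t (does-true (A ⊆? B) sub)))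

      -- If `w w′` were covered by an edge `C`, the symmetric difference of `uvw` and `uvw′` would
      -- be `{w, w′}` and lie in `C`. The three edges are distinct because `C` contains both `w` and
      -- `w′`, and each of the other two contains only one of them.
      independent : ∀ {u v w w′} → edge H (triple u v w) ≡ true → edge H (triple u v w′) ≡ true → inShadow H (pair w w′) ≡ false
      independent {u} {v} {w} {w′} h h′ = ≢true λ t → contra (shadow-elim t)
        where
        contra : (∣ pair w w′ ∣ˢ ≡ 2 × ∃ λ B → edge H B ≡ true × pair w w′ ⊆ˢ B) → Empty.⊥
        contra (size , C , hC , sub) = canc (triple u v w) (triple u v w′) C h h′ hC
          (λ eq → w∉ (subst (w ∈ˢ_) eq (w∈triple u v w)))
          (λ eq → w∉ (subst (w ∈ˢ_) (sym eq) w∈C))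
          (λ eq → w′∉ (subst (w′ ∈ˢ_) (sym eq) w′∈C))
          inside-C
          where
          w≢w′ = pair-≢ size
          w∈C = sub (x∈p∪q⁺ (inj₁ (x∈⁅x⁆ w)))
          w′∈C = sub (x∈p∪q⁺ (inj₂ (x∈⁅x⁆ w′)))
          w∉ : w ∉ˢ triple u v w′
          w∉ m with in-triple u v w′ m
          ... | inj₁ eq        = proj₁ (distinct h) (sym eq)
          ... | inj₂ (inj₁ eq) = proj₂ (distinct h) (sym eq)
          ... | inj₂ (inj₂ eq) = w≢w′ eq
          w′∉ : w′ ∉ˢ triple u v w
          w′∉ m with in-triple u v w m
          ... | inj₁ eq        = proj₁ (distinct h′) (sym eq)
          ... | inj₂ (inj₁ eq) = proj₂ (distinct h′) (sym eq)
          ... | inj₂ (inj₂ eq) = w≢w′ (sym eq)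
          inside-C : (triple u v w △ triple u v w′) ⊆ˢ C
          inside-C m with in-△ u v w w′ m
          ... | inj₁ refl = w∈C
          ... | inj₂ refl = w′∈C

    system : TripleSystem n
    system = record
      { e      = λ u v w → edge H (triple u v w)
      ; g      = λ u v → inShadow H (pair u v)
      ; e-swap = λ {u} {v} {w} h → trans (cong (edge H) (sym (triple-swap u v w))) h
      ; e-rot  = λ {u} {v} {w} h → trans (cong (edge H) (sym (triple-rot u v w))) h
      ; g-sym  = λ {u} {v} h → trans (cong (inShadow H) (∪-comm ⁅ v ⁆ ⁅ u ⁆)) h
      ; e⇒g    = λ {u} {v} {w} h → shadow-intro (∣pair∣ {u} {v} {w} (uniform H _ h)) h
                   (λ m → subst (_ ∈ˢ_) (∪-assoc ⁅ u ⁆ ⁅ v ⁆ ⁅ w ⁆) (x∈p∪q⁺ (inj₁ m)))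
      ; indep  = λ h h′ → independent h h′
      }

    open Moments system using (E₆; G₂)

    E₆≡ : + 6 * + numEdges H ≡ E₆
    E₆≡ = #sets₃ n (uniform H)

    G₂≡ : + 2 * + shadowSize H ≡ G₂
    G₂≡ = #sets₂ n (λ A t → proj₁ (shadow-elim {A} t))

-- From the integral inequality to the rational statement.

module Transference where

  open Combinatorics
  open Shadows
  open import Defs
  open import Data.Nat using (ℕ; zero; suc; _∸_)
  import Data.Nat as ℕ
  import Data.Nat.Properties as ℕ
  import Data.Integer as ℤ
  import Data.Integer.Properties as ℤ
  open import Data.Integer using (ℤ; +_; 0ℤ; 1ℤ)
  open import Data.Maybe using (Maybe; just; nothing)
  open import Data.Sum using (inj₁; inj₂)
  open import Data.Rational using (ℚ; _+_; _-_; _*_; -_; _≤_; _<_; 0ℚ; 1ℚ; _/_; toℚᵘ; nonNegative; positive; nonPositive)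
  open import Data.Rational.Properties
  import Data.Rational.Unnormalised as ℚᵘ
  import Data.Rational.Unnormalised.Properties as ℚᵘ
  open import Level using (0ℓ)
  open import Relation.Nullary using (Dec; yes; no)
  open import Relation.Binary.PropositionalEquality
  open import Tactic.RingSolver using (solve-∀)
  open import Tactic.RingSolver.Core.AlmostCommutativeRing using (AlmostCommutativeRing; fromCommutativeRing)

  ℚ-ring : AlmostCommutativeRing 0ℓ 0ℓ
  ℚ-ring = fromCommutativeRing +-*-commutativeRing isZero
    where
    isZero : ∀ q → Maybe (0ℚ ≡ q)
    isZero q with 0ℚ ≟ q
    ... | yes eq = just eq
    ... | no _   = nothing

  opaque

    i : ℤ → ℚ
    i z = z / 1

    private
      ≃-int : ∀ z → toℚᵘ (i z) ℚᵘ.≃ ℚᵘ.mkℚᵘ z 0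
      ≃-int z = toℚᵘ-fromℚᵘ (ℚᵘ.mkℚᵘ z 0)

    i-+ : ∀ x y → i (x ℤ.+ y) ≡ i x + i y
    i-+ x y = toℚᵘ-injective (ℚᵘ.≃-trans (≃-int (x ℤ.+ y)) (ℚᵘ.≃-sym (ℚᵘ.≃-trans (toℚᵘ-homo-+ (i x) (i y))
      (ℚᵘ.≃-trans (ℚᵘ.+-cong (≃-int x) (≃-int y)) (ℚᵘ.*≡* (cong (ℤ._* 1ℤ) (cong₂ ℤ._+_ (ℤ.*-identityʳ x) (ℤ.*-identityʳ y))))))))

    i-* : ∀ x y → i (x ℤ.* y) ≡ i x * i y
    i-* x y = toℚᵘ-injective (ℚᵘ.≃-trans (≃-int (x ℤ.* y)) (ℚᵘ.≃-sym (ℚᵘ.≃-trans (toℚᵘ-homo-* (i x) (i y))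
      (ℚᵘ.*-cong (≃-int x) (≃-int y)))))

    i-neg : ∀ x → i (ℤ.- x) ≡ - i x
    i-neg x = toℚᵘ-injective (ℚᵘ.≃-trans (≃-int (ℤ.- x)) (ℚᵘ.≃-sym (ℚᵘ.≃-trans (toℚᵘ-homo‿- (i x)) (ℚᵘ.-‿cong (≃-int x)))))

    i-mono-≤ : ∀ {x y} → x ℤ.≤ y → i x ≤ i y
    i-mono-≤ {x} {y} le = toℚᵘ-cancel-≤ (ℚᵘ.≤-trans (ℚᵘ.≤-reflexive (≃-int x)) (ℚᵘ.≤-trans (ℚᵘ.*≤* (ℤ.*-monoʳ-≤-nonNeg 1ℤ le)) (ℚᵘ.≤-reflexive (ℚᵘ.≃-sym (≃-int y)))))

    i-cancel-≤ : ∀ {x y} → i x ≤ i y → x ℤ.≤ y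
    i-cancel-≤ {x} {y} le with ℚᵘ.≤-trans (ℚᵘ.≤-reflexive (ℚᵘ.≃-sym (≃-int x))) (ℚᵘ.≤-trans (toℚᵘ-mono-≤ le) (ℚᵘ.≤-reflexive (≃-int y)))
    ... | ℚᵘ.*≤* h = subst₂ ℤ._≤_ (ℤ.*-identityʳ x) (ℤ.*-identityʳ y) h

    i-0 : i 0ℤ ≡ 0ℚ
    i-0 = refl

    i-1 : i 1ℤ ≡ 1ℚ
    i-1 = refl

    frac-int : ∀ a → frac a 1 ≡ i (+ a)
    frac-int a = refl

    frac-spec : ∀ a d → 0 ℕ.< d → frac a d * i (+ d) ≡ i (+ a)
    frac-spec a (suc d) _ = toℚᵘ-injective (ℚᵘ.≃-trans (toℚᵘ-homo-* (frac a (suc d)) (i (+ suc d)))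
      (ℚᵘ.≃-trans (ℚᵘ.*-cong (toℚᵘ-fromℚᵘ (ℚᵘ.mkℚᵘ (+ a) d)) (≃-int (+ suc d)))
        (ℚᵘ.≃-trans (ℚᵘ.*≡* (trans (ℤ.*-identityʳ (+ a ℤ.* + suc d)) (cong (+ a ℤ.*_) (cong (λ m → + suc m) (sym (ℕ.*-identityʳ d)))))) (ℚᵘ.≃-sym (≃-int (+ a))))))

    i-pos : ∀ {x} → 0ℤ ℤ.< x → 0ℚ < i x
    i-pos {+ suc m} _ = positive⁻¹ (i (+ suc m)) {{normalize-pos (suc m) 1}}
    i-pos {+ zero} (ℤ.+<+ ())

  i-- : ∀ x y → i (x ℤ.- y) ≡ i x - i y
  i-- x y = trans (i-+ x (ℤ.- y)) (cong (_+_ (i x)) (i-neg y))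

  0<frac1 : ∀ d → 0 ℕ.< d → 0ℚ < frac 1 d
  0<frac1 (suc d) _ = positive⁻¹ (frac 1 (suc d)) {{normalize-pos 1 (suc d)}}

  sq-nonNegℚ : ∀ p → 0ℚ ≤ p * p
  sq-nonNegℚ p with ≤-total 0ℚ p
  ... | inj₁ 0≤p = ≤-trans (≤-reflexive (sym (*-zeroʳ p))) (*-monoˡ-≤-nonNeg p {{nonNegative 0≤p}} 0≤p)
  ... | inj₂ p≤0 = ≤-trans (≤-reflexive (sym (*-zeroʳ p))) (*-monoˡ-≤-nonPos p {{nonPositive p≤0}} p≤0)

  module Transfer {n : ℕ} (H : Graph3 n) (canc : Cancellative H) (k : ℕ) (3≤k : 3 ℕ.≤ k) (1≤n : 1 ℕ.≤ n) where

    open Bridge H canc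
    open Moments system
    open Stability system (+ k)
    open Deviations (+ k)
    open Constants (+ k)

    private
      K : ℤ
      K = + k

      p N κ two three four six : ℚ
      p = i K
      N = i ν
      κ = i (K ℤ.- 1ℤ)
      two = i (+ 2)
      three = i (+ 3)
      four = i (+ 4)
      six = i (+ 6)

      N₂ N₃ h s f₁ f₂ f₃ : ℚ
      N₂ = frac (n ℕ.* n) 1
      N₃ = frac (n ℕ.* n ℕ.* n) 1
      h = frac (numEdges H) 1
      s = frac (shadowSize H) 1
      f₁ = frac (k ∸ 1) (2 ℕ.* k)
      f₂ = frac (k ∸ 1) (6 ℕ.* k ℕ.* k)
      f₃ = frac (k ∸ 1) (4 ℕ.* k ℕ.* k)

      0<k : 0 ℕ.< k
      0<k = ℕ.≤-trans (ℕ.s≤s ℕ.z≤n) 3≤k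

      k∸1 : + (k ∸ 1) ≡ K ℤ.- 1ℤ
      k∸1 = sym (trans (ℤ.[+m]-[+n]≡m⊖n k 1) (ℤ.⊖-≥ 0<k))

      N₂≡ : N₂ ≡ i (ν ℤ.* ν)
      N₂≡ = trans (frac-int (n ℕ.* n)) (cong i (ℤ.pos-* n n))

      N₃≡ : N₃ ≡ i (ν ℤ.* ν ℤ.* ν)
      N₃≡ = trans (frac-int (n ℕ.* n ℕ.* n)) (cong i (trans (ℤ.pos-* (n ℕ.* n) n) (cong (ℤ._* ν) (ℤ.pos-* n n))))

      N₃≡N₂N : N₃ ≡ N₂ * N
      N₃≡N₂N = trans N₃≡ (trans (i-* (ν ℤ.* ν) ν) (cong (_* N) (sym N₂≡)))

      quadratic : ∀ m → + (m ℕ.* k ℕ.* k) ≡ + m ℤ.* K ℤ.* K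
      quadratic m = trans (ℤ.pos-* (m ℕ.* k) k) (cong (ℤ._* K) (ℤ.pos-* m k))

      i-quadratic : ∀ m → i (+ (m ℕ.* k ℕ.* k)) ≡ i (+ m) * p * p
      i-quadratic m = trans (cong i (quadratic m)) (trans (i-* (+ m ℤ.* K) K) (cong (_* p) (i-* (+ m) K)))

      spec : ∀ d → 0 ℕ.< d → frac (k ∸ 1) d * i (+ d) ≡ κ
      spec d 0<d = trans (frac-spec (k ∸ 1) d 0<d) (cong i k∸1)

      f₁-spec : f₁ * (two * p) ≡ κ
      f₁-spec = trans (cong (f₁ *_) (sym (trans (cong i (ℤ.pos-* 2 k)) (i-* (+ 2) K)))) (spec (2 ℕ.* k) (ℕ.*-mono-≤ {1} {2} (ℕ.s≤s ℕ.z≤n) 0<k))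

      f₂-spec : f₂ * (six * p * p) ≡ κ
      f₂-spec = trans (cong (f₂ *_) (sym (i-quadratic 6))) (spec (6 ℕ.* k ℕ.* k) (ℕ.*-mono-≤ (ℕ.*-mono-≤ {1} {6} (ℕ.s≤s ℕ.z≤n) 0<k) 0<k))

      f₃-spec : f₃ * (four * p * p) ≡ κ
      f₃-spec = trans (cong (f₃ *_) (sym (i-quadratic 4))) (spec (4 ℕ.* k ℕ.* k) (ℕ.*-mono-≤ (ℕ.*-mono-≤ {1} {4} (ℕ.s≤s ℕ.z≤n) 0<k) 0<k))

      -- The factor `12k²` clears `6k²` and `4k²` at once. It is written as `2 * 6` to match
      -- `f₂-spec`; `twelve` converts it for `f₃-spec`.
      A : ℚ
      A = two * (six * p * p)

      twelve : two * six ≡ three * four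
      twelve = trans (sym (i-* (+ 2) (+ 6))) (i-* (+ 3) (+ 4))

      A≡ : A ≡ i (+ 12 ℤ.* (K ℤ.* K))
      A≡ = trans (sym (trans (i-* (+ 2) (+ 6 ℤ.* K ℤ.* K)) (cong (two *_) (trans (i-* (+ 6 ℤ.* K) K) (cong (_* p) (i-* (+ 6) K)))))) (cong i (lemma K))
        where
        open import Data.Integer.Tactic.RingSolver renaming (solve-∀ to ℤ-solve-∀)
        lemma : ∀ K → + 2 ℤ.* (+ 6 ℤ.* K ℤ.* K) ≡ + 12 ℤ.* (K ℤ.* K)
        lemma = ℤ-solve-∀

      0≤K-1 : 0ℤ ℤ.≤ K ℤ.- 1ℤ
      0≤K-1 = ℤ.i≤j⇒0≤j-i (ℤ.+≤+ 0<k)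

      1≤12KK : 1ℤ ℤ.≤ (+ 12 ℤ.* (K ℤ.* K)) ℤ.* (+ 12 ℤ.* (K ℤ.* K))
      1≤12KK = <⇒1+≤ (*-pos 0<12KK 0<12KK)
        where
        0<12KK : 0ℤ ℤ.< + 12 ℤ.* (K ℤ.* K)
        0<12KK = *-pos {+ 12} (ℤ.+<+ (ℕ.s≤s ℕ.z≤n)) (*-pos (ℤ.+<+ 0<k) (ℤ.+<+ 0<k))

      1≤AA : 1ℚ ≤ A * A
      1≤AA = ≤-trans (≤-reflexive (sym i-1)) (≤-trans (i-mono-≤ 1≤12KK) (≤-reflexive (trans (i-* _ _) (cong₂ _*_ (sym A≡) (sym A≡)))))

      0<A : 0ℚ < A
      0<A = subst (0ℚ <_) (sym A≡) (i-pos (*-pos {+ 12} (ℤ.+<+ (ℕ.s≤s ℕ.z≤n)) (*-pos (ℤ.+<+ 0<k) (ℤ.+<+ 0<k))))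

    module _ (ε : ℚ) (0≤ε : 0ℚ ≤ ε) (shadow : s ≡ (1ℚ - ε) * f₁ * N₂) where

      private
        X : ℚ
        X = h - f₂ * N₃ + f₃ * ε * N₃

        -- The prescribed shadow size enters here: `G₂` is twice `|∂H|`, and `η` is what it lacks
        -- from `(k - 1)n²/k`, times `k`.
        iη : i η ≡ ε * κ * N₂
        iη = begin
          i η ≡⟨ trans (i-- _ _) (cong₂ _-_ (trans (i-* _ _) (cong (κ *_) (sym N₂≡))) (trans (i-* K G₂) (cong (p *_) (trans (cong i (sym G₂≡)) (i-* (+ 2) (+ shadowSize H)))))) ⟩
          κ * N₂ - p * (two * i (+ shadowSize H))   ≡⟨ cong (λ x → κ * N₂ - p * (two * x)) (trans (sym (frac-int (shadowSize H))) shadow) ⟩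
          κ * N₂ - p * (two * ((1ℚ - ε) * f₁ * N₂)) ≡⟨ lemma κ N₂ p two ε f₁ ⟩
          κ * N₂ - (1ℚ - ε) * (f₁ * (two * p)) * N₂ ≡⟨ cong (λ x → κ * N₂ - (1ℚ - ε) * x * N₂) f₁-spec ⟩
          κ * N₂ - (1ℚ - ε) * κ * N₂ ≡⟨ lemma′ κ N₂ ε ⟩
          ε * κ * N₂ ∎
          where
          open ≡-Reasoning
          lemma : ∀ κ N p t ε f → κ * N - p * (t * ((1ℚ - ε) * f * N)) ≡ κ * N - (1ℚ - ε) * (f * (t * p)) * N
          lemma = solve-∀ ℚ-ring
          lemma′ : ∀ κ N ε → κ * N - (1ℚ - ε) * κ * N ≡ ε * κ * N
          lemma′ = solve-∀ ℚ-ring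

        iY : i Y ≡ A * X
        iY = begin
          i Y
            ≡⟨ trans (i-+ _ _) (cong₂ _+_ (trans (i-- _ _) (cong₂ _-_ edges cubes)) (trans (i-* (+ 3) (η ℤ.* ν)) (cong (three *_) (trans (i-* η ν) (cong (_* N) iη))))) ⟩
          A * h - two * κ * N₃ + three * (ε * κ * N₂ * N)
            ≡⟨ lemma A h two κ N₃ three ε N₂ N ⟩
          A * h - two * κ * N₃ + three * κ * ε * (N₂ * N)
            ≡⟨ cong₂ (λ x y → A * h - two * x * N₃ + three * y * ε * (N₂ * N)) (sym f₂-spec) (sym f₃-spec) ⟩
          A * h - two * (f₂ * (six * p * p)) * N₃ + three * (f₃ * (four * p * p)) * ε * (N₂ * N)
            ≡⟨ lemma′ h f₂ f₃ six p two three four ε N₃ (N₂ * N) ⟩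
          A * h - A * f₂ * N₃ + (three * four) * (p * p) * f₃ * ε * (N₂ * N)
            ≡⟨ cong₂ (λ x y → A * h - A * f₂ * N₃ + x * (p * p) * f₃ * ε * y) (sym twelve) (sym N₃≡N₂N) ⟩
          A * h - A * f₂ * N₃ + (two * six) * (p * p) * f₃ * ε * N₃
            ≡⟨ lemma″ h f₂ f₃ six p two ε N₃ ⟩
          A * X ∎
          where
          open ≡-Reasoning
          edges : i (+ 2 ℤ.* (K ℤ.* K) ℤ.* E₆) ≡ A * h
          edges = trans (i-* _ E₆) (trans (cong₂ _*_ (trans (i-* (+ 2) (K ℤ.* K)) (cong (two *_) (i-* K K)))
            (trans (cong i (sym E₆≡)) (trans (i-* (+ 6) (+ numEdges H)) (cong (six *_) (sym (frac-int (numEdges H))))))) (lemma₀ two p six h))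
            where
            lemma₀ : ∀ t p s h → t * (p * p) * (s * h) ≡ t * (s * p * p) * h
            lemma₀ = solve-∀ ℚ-ring
          cubes : i (+ 2 ℤ.* (K ℤ.- 1ℤ) ℤ.* (ν ℤ.* ν ℤ.* ν)) ≡ two * κ * N₃
          cubes = trans (i-* _ _) (cong₂ _*_ (i-* (+ 2) (K ℤ.- 1ℤ)) (sym N₃≡))
          lemma : ∀ A h t κ N₃ r ε N₂ N → A * h - t * κ * N₃ + r * (ε * κ * N₂ * N) ≡ A * h - t * κ * N₃ + r * κ * ε * (N₂ * N)
          lemma = solve-∀ ℚ-ring
          lemma′ : ∀ h f₂ f₃ s p t r q ε N₃ M → t * (s * p * p) * h - t * (f₂ * (s * p * p)) * N₃ + r * (f₃ * (q * p * p)) * ε * M ≡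
            t * (s * p * p) * h - t * (s * p * p) * f₂ * N₃ + (r * q) * (p * p) * f₃ * ε * M
          lemma′ = solve-∀ ℚ-ring
          lemma″ : ∀ h f₂ f₃ s p t ε N₃ → t * (s * p * p) * h - t * (s * p * p) * f₂ * N₃ + (t * s) * (p * p) * f₃ * ε * N₃ ≡
            t * (s * p * p) * (h - f₂ * N₃ + f₃ * ε * N₃)
          lemma″ = solve-∀ ℚ-ring

        0≤N₂ : 0ℚ ≤ N₂
        0≤N₂ = subst (0ℚ ≤_) (sym N₂≡) (≤-trans (≤-reflexive (sym i-0)) (i-mono-≤ (sq-nonNeg ν)))

        0≤κ : 0ℚ ≤ κ
        0≤κ = ≤-trans (≤-reflexive (sym i-0)) (i-mono-≤ 0≤K-1)

        nonNeg* : ∀ {x y} → 0ℚ ≤ x → 0ℚ ≤ y → 0ℚ ≤ x * y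
        nonNeg* {x} {y} 0≤x 0≤y = ≤-trans (≤-reflexive (sym (*-zeroʳ x))) (*-monoˡ-≤-nonNeg x {{nonNegative 0≤x}} 0≤y)

        0≤η : 0ℤ ℤ.≤ η
        0≤η = i-cancel-≤ (≤-trans (≤-reflexive i-0) (≤-trans (nonNeg* (nonNeg* 0≤ε 0≤κ) 0≤N₂) (≤-reflexive (sym iη))))

      conclusion : ∀ c → ε ≤ c → c * i (C₂ ℤ.* (K ℤ.- 1ℤ)) ≡ 1ℚ → 0ℤ ℤ.≤ C₂ → 1ℤ ℤ.≤ C₃ ℤ.* ((K ℤ.- 1ℤ) ℤ.* (K ℤ.- 1ℤ) ℤ.* (K ℤ.- 1ℤ)) →
        LeMulSqrt X (i (C₃ ℤ.* ((K ℤ.- 1ℤ) ℤ.* (K ℤ.- 1ℤ) ℤ.* (K ℤ.- 1ℤ))) * N₃) (ε * ε * ε)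
      conclusion c ε≤c c-spec 0≤C₂ 1≤C = cases (0ℤ ℤ.<? Y)
       where
       iC′ : ℚ
       iC′ = i (C₃ ℤ.* ((K ℤ.- 1ℤ) ℤ.* (K ℤ.- 1ℤ) ℤ.* (K ℤ.- 1ℤ)))
       small : C₂ ℤ.* η ℤ.≤ ν ℤ.* ν
       iC : iC′ ≡ i C₃ * (κ * κ * κ)
       C≤C² : iC′ ≤ iC′ * iC′
       N₂³ : N₂ * N₂ * N₂ ≡ N₃ * N₃
       square : 0ℤ ℤ.< Y → X * X ≤ iC′ * N₃ * (iC′ * N₃) * (ε * ε * ε)
       cases : Dec (0ℤ ℤ.< Y) → LeMulSqrt X (iC′ * N₃) (ε * ε * ε)
       cases (yes 0<Y) = inj₂ (square 0<Y)
       -- Without an excess the left side is at most zero, the first alternative of `LeMulSqrt`; the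
       -- assumption `0 < Y` of the structural part thus costs nothing.
       cases (no ¬0<Y) = inj₁ (*-cancelˡ-≤-pos A {{positive 0<A}} (≤-trans (≤-reflexive (sym iY)) (≤-trans (i-mono-≤ (ℤ.≮⇒≥ ¬0<Y)) (≤-reflexive (trans i-0 (sym (*-zeroʳ A)))))))
       square 0<Y = begin
          X * X ≡⟨ sym (*-identityʳ (X * X)) ⟩
          X * X * 1ℚ ≤⟨ *-monoˡ-≤-nonNeg (X * X) {{nonNegative (sq-nonNegℚ X)}} 1≤AA ⟩
          X * X * (A * A) ≡⟨ trans (lemma₁ X A) (cong₂ _*_ (sym iY) (sym iY)) ⟩
          i Y * i Y ≡⟨ sym (i-* Y Y) ⟩
          i (Y ℤ.* Y) ≤⟨ i-mono-≤ (Dense.Y-sq (ℤ.+≤+ 3≤k) (ℤ.+<+ 1≤n) 0≤η small 0<Y) ⟩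
          i (C₃ ℤ.* (η ℤ.* η ℤ.* η)) ≡⟨ trans (i-* C₃ _) (cong (i C₃ *_) (trans (i-* _ η) (cong (_* i η) (i-* η η)))) ⟩
          i C₃ * (i η * i η * i η) ≡⟨ cong (λ x → i C₃ * (x * x * x)) iη ⟩
          i C₃ * (ε * κ * N₂ * (ε * κ * N₂) * (ε * κ * N₂)) ≡⟨ lemma₂ (i C₃) ε κ N₂ ⟩
          i C₃ * (κ * κ * κ) * (N₂ * N₂ * N₂ * (ε * ε * ε)) ≡⟨ cong₂ (λ x y → x * (y * (ε * ε * ε))) (sym iC) N₂³ ⟩
          -- `LeMulSqrt` squares its constant. Being at least 1, `iC′` may stand in for its own
          -- square root.
          iC′ * (N₃ * N₃ * (ε * ε * ε)) ≤⟨ *-monoʳ-≤-nonNeg (N₃ * N₃ * (ε * ε * ε)) {{nonNegative (nonNeg* (sq-nonNegℚ N₃) (nonNeg* (nonNeg* 0≤ε 0≤ε) 0≤ε))}} C≤C² ⟩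
          iC′ * iC′ * (N₃ * N₃ * (ε * ε * ε)) ≡⟨ lemma₃ iC′ N₃ (ε * ε * ε) ⟩
          iC′ * N₃ * (iC′ * N₃) * (ε * ε * ε) ∎
         where
         open ≤-Reasoning
         lemma₁ : ∀ X A → X * X * (A * A) ≡ A * X * (A * X)
         lemma₁ = solve-∀ ℚ-ring
         lemma₂ : ∀ C ε κ N → C * (ε * κ * N * (ε * κ * N) * (ε * κ * N)) ≡ C * (κ * κ * κ) * (N * N * N * (ε * ε * ε))
         lemma₂ = solve-∀ ℚ-ring
         lemma₃ : ∀ C N e → C * C * (N * N * e) ≡ C * N * (C * N) * e
         lemma₃ = solve-∀ ℚ-ring
       iC = trans (i-* C₃ _) (cong (i C₃ *_) (trans (i-* _ (K ℤ.- 1ℤ)) (cong (_* κ) (i-* (K ℤ.- 1ℤ) (K ℤ.- 1ℤ)))))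
       C≤C² = ≤-trans (i-mono-≤ (≤-sq 1≤C)) (≤-reflexive (i-* _ _))
         where
         ≤-sq : ∀ {z} → 1ℤ ℤ.≤ z → z ℤ.≤ z ℤ.* z
         ≤-sq {z} 1≤z = ℤ.≤-trans (ℤ.≤-reflexive (sym (ℤ.*-identityʳ z))) (ℤ.≤-trans 0≤+ 1≤z ⊗ 1≤z)
       N₂³ = trans (cong (λ x → x * x * x) N₂≡N) (trans (lemma₄ N) (cong (λ x → x * x) (sym (trans N₃≡N₂N (cong (_* N) N₂≡N)))))
         where
         N₂≡N : N₂ ≡ N * N
         N₂≡N = trans N₂≡ (i-* ν ν)
         lemma₄ : ∀ N → N * N * (N * N) * (N * N) ≡ N * N * N * (N * N * N)
         lemma₄ = solve-∀ ℚ-ring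
       -- As `η = ε(k - 1)n²`, the condition is `ε C₂(k - 1) ≤ 1`, and `c` is the reciprocal of
       -- `C₂(k - 1)`.
       small = i-cancel-≤ (begin
         i (C₂ ℤ.* η) ≡⟨ trans (i-* C₂ η) (cong (i C₂ *_) iη) ⟩
         i C₂ * (ε * κ * N₂) ≡⟨ lemma₅ (i C₂) ε κ N₂ ⟩
         ε * (i C₂ * κ) * N₂ ≤⟨ *-monoʳ-≤-nonNeg N₂ {{nonNegative 0≤N₂}} (*-monoʳ-≤-nonNeg (i C₂ * κ) {{nonNegative (nonNeg* (≤-trans (≤-reflexive (sym i-0)) (i-mono-≤ 0≤C₂)) 0≤κ)}} ε≤c) ⟩
         c * (i C₂ * κ) * N₂ ≡⟨ cong (_* N₂) (trans (cong (c *_) (sym (i-* C₂ (K ℤ.- 1ℤ)))) c-spec) ⟩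
         1ℚ * N₂ ≡⟨ trans (*-identityˡ N₂) N₂≡ ⟩
         i (ν ℤ.* ν) ∎)
         where
         open ≤-Reasoning
         lemma₅ : ∀ C ε κ N → C * (ε * κ * N) ≡ ε * (C * κ) * N
         lemma₅ = solve-∀ ℚ-ring

  module Witnesses (k : ℕ) (3≤k : 3 ℕ.≤ k) where

    open Constants (+ k)

    private
      0<K : 0ℤ ℤ.< + k
      0<K = ℤ.+<+ (ℕ.≤-trans (ℕ.s≤s ℕ.z≤n) 3≤k)

      open ConstantBounds 0<K using (0<C₂; 0<C₃)

      K-1 : ℤ
      K-1 = + k ℤ.- 1ℤ

      0<K-1 : 0ℤ ℤ.< K-1
      0<K-1 = ℤ.suc[i]≤j⇒i<j (ℤ.≤-trans (ℤ.+≤+ (ℕ.s≤s ℕ.z≤n)) (ℤ.+-monoˡ-≤ (ℤ.- 1ℤ) (ℤ.+≤+ 3≤k)))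

      d D : ℤ
      d = C₂ ℤ.* K-1
      D = C₃ ℤ.* (K-1 ℤ.* K-1 ℤ.* K-1)

      0<d : 0ℤ ℤ.< d
      0<d = *-pos 0<C₂ 0<K-1

      0<D : 0ℤ ℤ.< D
      0<D = *-pos 0<C₃ (*-pos (*-pos 0<K-1 0<K-1) 0<K-1)

      +∣d∣ : + ℤ.∣ d ∣ ≡ d
      +∣d∣ = ℤ.0≤i⇒+∣i∣≡i (ℤ.<⇒≤ 0<d)

      0<∣d∣ : 0 ℕ.< ℤ.∣ d ∣
      0<∣d∣ = ℤ.drop‿+<+ (subst (0ℤ ℤ.<_) (sym +∣d∣) 0<d)

    -- The factors `k - 1` and `(k - 1)³` in the two constants come from replacing `η` and `η³` by
    -- powers of ε.
    c₃ C : ℚ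
    c₃ = frac 1 ℤ.∣ d ∣
    C = i D

    0<c₃ : 0ℚ < c₃
    0<c₃ = 0<frac1 ℤ.∣ d ∣ 0<∣d∣

    0<C : 0ℚ < C
    0<C = i-pos 0<D

    c₃-spec : c₃ * i d ≡ 1ℚ
    c₃-spec = trans (cong (λ z → c₃ * i z) (sym +∣d∣)) (trans (frac-spec 1 ℤ.∣ d ∣ 0<∣d∣) i-1)

    0≤C₂ : 0ℤ ℤ.≤ C₂
    0≤C₂ = ℤ.<⇒≤ 0<C₂

    1≤D : 1ℤ ℤ.≤ D
    1≤D = <⇒1+≤ 0<D

open import Defs
open import Data.Nat using (ℕ; _≥_; _%_; _∸_)
open import Data.Rational using (ℚ; _+_; _-_; _*_; _≤_; _<_; 0ℚ; 1ℚ)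
open import Data.Product using (Σ; _×_)
open import Data.Sum using (_⊎_)
open import Relation.Binary.PropositionalEquality using (_≡_)
import Data.Nat as ℕ
open import Data.Product using (_,_)

theorem3p1 : (k : ℕ) → k ≥ 3 → (k % 6 ≡ 1 ⊎ k % 6 ≡ 3) →
    Σ ℚ λ c₃ → Σ ℚ λ C → 0ℚ < c₃ × 0ℚ < C ×
    ((ε : ℚ) → 0ℚ ≤ ε → ε ≤ c₃ →
    Σ ℕ λ n₀ → (n : ℕ) → n ≥ n₀ → (H : Graph3 n) → Cancellative H →
    frac (shadowSize H) 1 ≡ (1ℚ - ε) * frac (k ∸ 1) (2 ℕ.* k) * frac (n ℕ.* n) 1 →
    LeMulSqrt
    (frac (numEdges H) 1 - frac (k ∸ 1) (6 ℕ.* k ℕ.* k) * frac (n ℕ.* n ℕ.* n) 1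
    + frac (k ∸ 1) (4 ℕ.* k ℕ.* k) * ε * frac (n ℕ.* n ℕ.* n) 1)
    (C * frac (n ℕ.* n ℕ.* n) 1)
    (ε * ε * ε))
-- `n₀ = 1` secures `0 < ν`, by which the counts of exceptional vertices are divided.
theorem3p1 k k≥3 _ = c₃ , C , 0<c₃ , 0<C , λ ε 0≤ε ε≤c₃ → 1 , λ n 1≤n H canc shadow →
  Transference.Transfer.conclusion H canc k k≥3 1≤n ε 0≤ε shadow c₃ ε≤c₃ c₃-spec 0≤C₂ 1≤D
  where open Transference.Witnesses k k≥3
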